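{- The dynamic variant of Disjoint Factors admits a data structure with initialization time $\mathcal{O}(k2^k+kn)$, worst-case query time $\mathcal{O}(1)$, and worst-case update time $\mathcal{O}(k2^k\log\log n)$.
   Context: Disjoint Factors: given an integer $k$ and a word $w\in\{1,\ldots,k\}^\star$ of length $n$, decide whether there exist pairwise disjoint (contiguous) subwords $w_1,\ldots,w_k$ of $w$ such that each $w_i$ has length at least $2$ and begins and ends with the symbol $i$. The dynamic variant asks for a data structure supporting initialization on $w$, updates replacing a single symbol of $w$, and a query deciding whether the current word is a yes-instance; $k$ and $n$ are fixed at initialization. Word-RAM model. -}

module Defs where

open import Data.Bool.Base using (if_then_else_)
open import Data.Fin.Base as Fin using (Fin; zero; suc; toℕ; finToFun; funToFin; opposite)
open import Data.Nat.Base
open import Data.Nat.DivMod using (_mod_)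
open import Data.Nat.Logarithm using (⌊log₂_⌋)
import Data.Nat.Properties as ℕ
open import Data.Product.Base using (Σ-syntax; ∃₂; _×_)
open import Data.Sum.Base using (_⊎_)
open import Data.Vec.Base using (Vec; lookup; _[_]≔_)
open import Data.Vec.Functional using (Vector; updateAt)
open import Function.Base using (const)
open import Relation.Binary.PropositionalEquality using (_≡_; _≢_)
open import Relation.Nullary using (¬_; does)

------------------------------------------------------------------------
-- Disjoint Factors

-- The alphabet {1,…,k} is Fin k, so the symbol i is represented by i ∸ 1.
Text : ℕ → ℕ → Set
Text k n = Vec (Fin k) n

-- Nonempty contiguous subwords, as inclusive ranges of positions.
record Factor (n : ℕ) : Set where
  field
    first last : Fin n
    first≤last : first Fin.≤ last

  length : ℕ
  length = suc (toℕ last ∸ toℕ first)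

open Factor public

_∈ᶠ_ : ∀ {n} → Fin n → Factor n → Set
p ∈ᶠ F = first F Fin.≤ p × p Fin.≤ last F

Disjoint : ∀ {n} → Factor n → Factor n → Set
Disjoint F G = ∀ p → p ∈ᶠ F → ¬ (p ∈ᶠ G)

DisjointFactors : ∀ {k n} → Text k n → Set
DisjointFactors {k} {n} w =
  Σ[ F ∈ (Fin k → Factor n) ]
    (∀ i → 2 ≤ length (F i)
         × lookup w (first (F i)) ≡ i
         × lookup w (last (F i)) ≡ i)
  × (∀ i j → i ≢ j → Disjoint (F i) (F j))

------------------------------------------------------------------------
-- A unit-cost word RAM with b-bit words and 2 ^ b memory cells, programmed
-- in a structured while-language.  A program is finite syntax that does not
-- mention b; it can name only finitely many registers, and indirect
-- addressing is available for memory only.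

Word : ℕ → Set
Word b = Fin (2 ^ b)

word : ∀ b → ℕ → Word b
word b m = _mod_ m (2 ^ b) {{ℕ.m^n≢0 2 b}}

data BinOp : Set where
  add sub mul div mod and or xor shl shr eq lt : BinOp

infix 9 mem[_]

data Expr : Set where
  lit    : ℕ → Expr
  reg    : ℕ → Expr
  mem[_] : Expr → Expr
  op     : BinOp → Expr → Expr → Expr

infix  5 _:=_ mem[_]:=_
infixr 4 _⨾_

data Cmd : Set where
  skip      : Cmd
  _:=_      : ℕ → Expr → Cmd
  mem[_]:=_ : Expr → Expr → Cmd
  _⨾_       : Cmd → Cmd → Cmd
  ite       : Expr → Cmd → Cmd → Cmd
  while     : Expr → Cmd → Cmd

record State (b : ℕ) : Set where
  constructor ⟨_,_⟩
  field
    registers : ℕ → Word b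
    memory    : Vector (Word b) (2 ^ b)

open State public

setReg : ∀ {b} → ℕ → Word b → State b → State b
setReg r v s =
  ⟨ (λ q → if does (q ℕ.≟ r) then v else registers s q) , memory s ⟩

setMem : ∀ {b} → Word b → Word b → State b → State b
setMem a v s = ⟨ registers s , updateAt (memory s) a (const v) ⟩

-- Division and remainder by zero return 0.
quot rem : ℕ → ℕ → ℕ
quot m zero      = 0
quot m n@(suc _) = m / n
rem  m zero      = 0
rem  m n@(suc _) = m % n

andBit orBit xorBit : Fin 2 → Fin 2 → Fin 2
andBit zero    y = zero
andBit (suc _) y = y
orBit  zero    y = y
orBit  (suc x) y = suc x
xorBit zero    y = y
xorBit (suc _) y = opposite y

-- finToFun reads off the b binary digits of a word.
bitwise : ∀ b → (Fin 2 → Fin 2 → Fin 2) → Word b → Word b → Word b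
bitwise b f x y =
  funToFin {b} {2} (λ i → f (finToFun {2} {b} x i) (finToFun {2} {b} y i))

applyOp : ∀ b → BinOp → Word b → Word b → Word b
applyOp b add x y = word b (toℕ x + toℕ y)
applyOp b sub x y = word b (toℕ x + (2 ^ b ∸ toℕ y))
applyOp b mul x y = word b (toℕ x * toℕ y)
applyOp b div x y = word b (quot (toℕ x) (toℕ y))
applyOp b mod x y = word b (rem (toℕ x) (toℕ y))
applyOp b and x y = bitwise b andBit x y
applyOp b or  x y = bitwise b orBit x y
applyOp b xor x y = bitwise b xorBit x y
applyOp b shl x y = word b (toℕ x * 2 ^ toℕ y)
applyOp b shr x y = word b (_/_ (toℕ x) (2 ^ toℕ y) {{ℕ.m^n≢0 2 (toℕ y)}})
applyOp b eq  x y = word b (if toℕ x ≡ᵇ toℕ y then 1 else 0)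
applyOp b lt  x y = word b (if toℕ x <ᵇ toℕ y then 1 else 0)

eval : ∀ {b} → Expr → State b → Word b
eval {b} (lit m)      s = word b m
eval     (reg r)      s = registers s r
eval     mem[ e ]     s = memory s (eval e s)
eval {b} (op o e₁ e₂) s = applyOp b o (eval e₁ s) (eval e₂ s)

-- Every constant, register read, memory read and word operation costs 1.
cost : Expr → ℕ
cost (lit _)      = 1
cost (reg _)      = 1
cost mem[ e ]     = 1 + cost e
cost (op _ e₁ e₂) = 1 + cost e₁ + cost e₂

-- s ⊢ c ⇓[ t ] s′ : run from s, the command c halts in s′ after t steps.
infix 3 _⊢_⇓[_]_

data _⊢_⇓[_]_ {b : ℕ} (s : State b) : Cmd → ℕ → State b → Set where
  ⇓skip   : s ⊢ skip ⇓[ 1 ] s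
  ⇓assign : ∀ {r e} →
            s ⊢ r := e ⇓[ 1 + cost e ] setReg r (eval e s) s
  ⇓store  : ∀ {e₁ e₂} →
            s ⊢ mem[ e₁ ]:= e₂ ⇓[ 1 + cost e₁ + cost e₂ ]
              setMem (eval e₁ s) (eval e₂ s) s
  ⇓seq    : ∀ {c₁ c₂ t₁ t₂ s₁ s₂} →
            s ⊢ c₁ ⇓[ t₁ ] s₁ → s₁ ⊢ c₂ ⇓[ t₂ ] s₂ →
            s ⊢ c₁ ⨾ c₂ ⇓[ t₁ + t₂ ] s₂
  ⇓then   : ∀ {e c₁ c₂ t s₁} → toℕ (eval e s) ≢ 0 →
            s ⊢ c₁ ⇓[ t ] s₁ →
            s ⊢ ite e c₁ c₂ ⇓[ 1 + cost e + t ] s₁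
  ⇓else   : ∀ {e c₁ c₂ t s₁} → toℕ (eval e s) ≡ 0 →
            s ⊢ c₂ ⇓[ t ] s₁ →
            s ⊢ ite e c₁ c₂ ⇓[ 1 + cost e + t ] s₁
  ⇓exit   : ∀ {e c} → toℕ (eval e s) ≡ 0 →
            s ⊢ while e c ⇓[ 1 + cost e ] s
  ⇓loop   : ∀ {e c t₁ t₂ s₁ s₂} → toℕ (eval e s) ≢ 0 →
            s ⊢ c ⇓[ t₁ ] s₁ → s₁ ⊢ while e c ⇓[ t₂ ] s₂ →
            s ⊢ while e c ⇓[ 1 + cost e + t₁ + t₂ ] s₂

RunsWithin : ∀ {b} → ℕ → Cmd → State b → (State b → Set) → Set
RunsWithin T c s Q = ∃₂ λ t s′ → s ⊢ c ⇓[ t ] s′ × t ≤ T × Q s′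

------------------------------------------------------------------------
-- Data structures for the dynamic problem

record DataStructure : Set where
  field
    initialise update query : Cmd

open DataStructure public

-- The text occupies the first n memory cells.  All other memory cells and
-- registers have arbitrary contents.
record Input {b k n : ℕ} (w : Text k n) (s : State b) : Set where
  field
    alphabet : registers s 0 ≡ word b k
    size     : registers s 1 ≡ word b n
    text     : ∀ (i : Fin n) →
               memory s (word b (toℕ i)) ≡ word b (toℕ (lookup w i))

withArgs : ∀ {b k n} → Fin n → Fin k → State b → State b
withArgs {b} p a s = setReg 0 (word b (toℕ p)) (setReg 1 (word b (toℕ a)) s)

-- The answer is returned in register 0.
Answers : ∀ {b} → Set → State b → Set
Answers P s = (toℕ (registers s 0) ≡ 1 × P)
            ⊎ (toℕ (registers s 0) ≡ 0 × ¬ P)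

-- Reachable D w s : some sequence of operations (an initialisation, then any
-- updates and queries) makes w the current text and leaves the machine in s.
data Reachable (D : DataStructure) {b k n : ℕ} : Text k n → State b → Set where
  initialised : ∀ {w s t s′} → Input w s →
                s ⊢ initialise D ⇓[ t ] s′ → Reachable D w s′
  updated     : ∀ {w s t s′} (p : Fin n) (a : Fin k) → Reachable D w s →
                withArgs p a s ⊢ update D ⇓[ t ] s′ →
                Reachable D (w [ p ]≔ a) s′
  queried     : ∀ {w s t s′} → Reachable D w s →
                s ⊢ query D ⇓[ t ] s′ → Reachable D w s′

-- Truncated below at 1, since log log n < 1 for n < 4.
loglog : ℕ → ℕ
loglog n = 1 ⊔ ⌊log₂ ⌊log₂ n ⌋ ⌋

{-# OPTIONS --safe #-}

-- For a set S of symbols let F(S) be the least length of a prefix that contains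
-- disjoint factors for all symbols of S.  Removing the rightmost factor shows
-- F(S) = min over i in S of e_i(F(S - i)), where e_i(p) is the end of the
-- second occurrence of i from position p on.  So k 2^k successor queries
-- recompute F after an update, and the answer is whether F of the alphabet is
-- at most n.
--
-- The text is cut into blocks of length B = O(log log n), and for each symbol a
-- van Emde Boas tree holds the numbers of the blocks in which it occurs; a
-- successor query scans two blocks and asks the tree once.  Each node keeps its
-- minimum and its maximum out of its children, so insertion and deletion are
-- tail recursive and become loops.  As there are only n / B blocks, building a
-- tree by insertions, each of cost O(B), takes O(n) time.  The first
-- computation of F reads the successors from tables filled in O(k n) time.
module Submission where

open import Defs
open import Data.Bool.Base using (true; false; T; if_then_else_)
open import Data.Empty using (⊥)
open import Data.Fin.Base as Fin using (Fin; toℕ; fromℕ<)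
import Data.Fin.Properties as Fin
open import Data.Maybe.Base using (Maybe; just; nothing; maybe′; is-nothing)
open import Data.Nat.Base hiding (_!)
open import Data.Nat.DivMod hiding (_div_; _mod_)
open import Data.Nat.Logarithm using (⌊log₂_⌋; ⌊log₂⌋-mono-≤; ⌊log₂[2^n]⌋≡n)
open import Data.Nat.Properties
open import Data.Nat.Solver using (module +-*-Solver)
open import Data.Product.Base using (Σ-syntax; ∃; ∃₂; _×_; _,_; proj₁; proj₂)
open import Data.Sum.Base using (_⊎_; inj₁; inj₂; [_,_]′)
open import Data.Unit.Base using (⊤; tt)
open import Data.Vec.Base using (lookup; _[_]≔_; []; _∷_)
open import Data.Vec.Functional.Properties using (updateAt-updates; updateAt-minimal)
open import Data.Vec.Properties using (lookup∘update; lookup∘update′)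
open import Function.Base using (id; const; _∘_)
open import Relation.Binary.Definitions using (tri<; tri≈; tri>)
open import Relation.Binary.PropositionalEquality
open import Relation.Nullary using (¬_; Dec; yes; no; contradiction)

open +-*-Solver using (solve; con; _:+_; _:*_) renaming (_:=_ to infix 4 _:≈_)

-- The machine has no call stack, its arithmetic wraps around and its memory is dirty; these facts
-- shape the proof. Words are read as natural numbers: registers stay below a bound `X` with
-- `X ^ 8 < 2 ^ b`, which is where the word length `161 * (1 + k + log n)` comes from. Without a
-- stack the tree operations have to be loops. For insertion and deletion this works because a
-- cluster with a single key is created or destroyed by writing its own pair, so only one of summary
-- and cluster is entered. A successor search is different: after a turn into the summary, the
-- minimum of a cluster remains to be looked up. The turns are kept as bits of one word, and a
-- second loop unwinds them. Memory is addressed directly, so a tree is an array indexed by vertex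
-- and level; a summary shares the vertex of its node and differs from it in the level only. The
-- array has about `2 ^ ℓ * B` words. Since the keys are block numbers, this is O(n), and zeroing it
-- is affordable. The number B = h + 2 is at once the block length and the number of levels.

-- Shifts and point updates

private
  shift : ℕ → ℕ → ℕ
  shift x e = _/_ x (2 ^ e) {{m^n≢0 2 e}}

  shift-shift : ∀ x a c → shift (shift x a) c ≡ shift x (a + c)
  shift-shift x a c = trans (m/n/o≡m/[n*o] x (2 ^ a) (2 ^ c)) (/-congʳ (sym (^-distribˡ-+-* 2 a c)))
    where
    instance
      _ = m^n≢0 2 a
      _ = m^n≢0 2 c
      _ = m^n≢0 2 (a + c)
      _ = m*n≢0 (2 ^ a) (2 ^ c)

  shift-mono : ∀ {x y} a → x ≤ y → shift x a ≤ shift y a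
  shift-mono a = /-monoˡ-≤ (2 ^ a) {{m^n≢0 2 a}}

  shift-< : ∀ {x a} → 1 ≤ x → 1 ≤ a → shift x a < x
  shift-< {suc x} {suc a} _ _ = m/n<m (suc x) (2 ^ suc a) (^-monoʳ-≤ 2 {1} {suc a} (s≤s z≤n))
    where instance _ = m^n≢0 2 (suc a)

opaque
  infixl 7 _≫_
  _≫_ : ℕ → ℕ → ℕ
  _≫_ = shift

  ≫-def : ∀ x e → x ≫ e ≡ _/_ x (2 ^ e) {{m^n≢0 2 e}}
  ≫-def x e = refl

  ≫≤ : ∀ x e → x ≫ e ≤ x
  ≫≤ x e = m/n≤m x (2 ^ e) {{m^n≢0 2 e}}

  ≫-≫ : ∀ x a c → x ≫ a ≫ c ≡ x ≫ (a + c)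
  ≫-≫ = shift-shift

  ≫-0 : ∀ x → x ≫ 0 ≡ x
  ≫-0 = n/1≡n

  ≫-1 : ∀ x → x ≫ 1 ≡ x / 2
  ≫-1 x = refl

  ≫-monoˡ : ∀ {x y} a → x ≤ y → x ≫ a ≤ y ≫ a
  ≫-monoˡ = shift-mono

  ≫-< : ∀ {x a} → 1 ≤ x → 1 ≤ a → x ≫ a < x
  ≫-< = shift-<

_[_↦_] : (ℕ → ℕ) → ℕ → ℕ → ℕ → ℕ
(f [ a ↦ v ]) x = if x ≡ᵇ a then v else f x

≡ᵇ-refl : ∀ m → (m ≡ᵇ m) ≡ true
≡ᵇ-refl zero    = refl
≡ᵇ-refl (suc m) = ≡ᵇ-refl m

≢⇒≡ᵇ : ∀ {m n} → m ≢ n → (m ≡ᵇ n) ≡ false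
≢⇒≡ᵇ {zero}  {zero}  m≢n = contradiction refl m≢n
≢⇒≡ᵇ {zero}  {suc n} m≢n = refl
≢⇒≡ᵇ {suc m} {zero}  m≢n = refl
≢⇒≡ᵇ {suc m} {suc n} m≢n = ≢⇒≡ᵇ (m≢n ∘ cong suc)

<⇒<ᵇ≡ : ∀ {m n} → m < n → (m <ᵇ n) ≡ true
<⇒<ᵇ≡ {zero}  {suc n} m<n       = refl
<⇒<ᵇ≡ {suc m} {suc n} (s≤s m<n) = <⇒<ᵇ≡ m<n

≥⇒<ᵇ≡ : ∀ {m n} → n ≤ m → (m <ᵇ n) ≡ false
≥⇒<ᵇ≡ {m}     {zero}  n≤m       = refl
≥⇒<ᵇ≡ {suc m} {suc n} (s≤s n≤m) = ≥⇒<ᵇ≡ n≤m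

↦-here : ∀ f a v → (f [ a ↦ v ]) a ≡ v
↦-here f a v rewrite ≡ᵇ-refl a = refl

↦-there : ∀ f {a} v {x} → x ≢ a → (f [ a ↦ v ]) x ≡ f x
↦-there f v x≢a rewrite ≢⇒≡ᵇ x≢a = refl

-- Machine words as natural numbers

record Store : Set where
  constructor mk
  field loc M : ℕ → ℕ
open Store public

arith : BinOp → ℕ → ℕ → ℕ
arith add x y = x + y
arith sub x y = x ∸ y
arith mul x y = x * y
arith div x y = quot x y
arith mod x y = rem x y
arith shl x y = x * 2 ^ y
arith shr x y = x ≫ y
arith eq  x y = if x ≡ᵇ y then 1 else 0
arith lt  x y = if x <ᵇ y then 1 else 0
-- A default: `Wfᵒ` rejects the bitwise operations, so this never stands for the value of a word.
arith and x y = 0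
arith or  x y = 0
arith xor x y = 0

-- `Reachable` speaks of arbitrary runs, whereas the correctness proofs construct one. Determinism
-- carries the invariant over from the constructed run to the given one.
deterministic : ∀ {b c t t′} {s s₁ s₂ : State b} →
                s ⊢ c ⇓[ t ] s₁ → s ⊢ c ⇓[ t′ ] s₂ → s₁ ≡ s₂
deterministic ⇓skip ⇓skip = refl
deterministic ⇓assign ⇓assign = refl
deterministic ⇓store ⇓store = refl
deterministic (⇓seq p q) (⇓seq p′ q′) with refl ← deterministic p p′ = deterministic q q′
deterministic (⇓then x p) (⇓then y q) = deterministic p q
deterministic (⇓then x p) (⇓else y q) = contradiction y x
deterministic (⇓else x p) (⇓then y q) = contradiction x y
deterministic (⇓else x p) (⇓else y q) = deterministic p q
deterministic (⇓exit x) (⇓exit y) = refl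
deterministic (⇓exit x) (⇓loop y _ _) = contradiction x y
deterministic (⇓loop x _ _) (⇓exit y) = contradiction y x
deterministic (⇓loop x p q) (⇓loop y p′ q′) with refl ← deterministic p p′ = deterministic q q′

quot≤ : ∀ x y → quot x y ≤ x
quot≤ x zero    = z≤n
quot≤ x (suc y) = m/n≤m x (suc y)

rem≤ : ∀ x y → rem x y ≤ x
rem≤ x zero    = z≤n
rem≤ x (suc y) = m%n≤m x (suc y)

bool≤1 : ∀ c → (if c then 1 else 0) ≤ 1
bool≤1 true  = ≤-refl
bool≤1 false = z≤n

-- An expression is bounded by X ^ bd e whenever bd e ≤ 8; the exponent 9
-- stands for an unbounded value.
bd : Expr → ℕ
bd (lit m)      = 1
bd (reg r)      = 1
bd mem[ e ]     = 9
bd (op add e f) = bd e + bd f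
bd (op mul e f) = bd e + bd f
bd (op sub e f) = bd e
bd (op div e f) = bd e
bd (op mod e f) = bd e
bd (op shr e f) = bd e
bd (op shl e f) = 1
bd (op eq e f)  = 1
bd (op lt e f)  = 1
bd (op _ e f)   = 9

-- Overflow of a sum or a product is excluded by its exponent alone, whatever the registers contain.
-- Subtraction and left shift depend on the values and are left to `obᵒ`.
Wfᵒ : BinOp → ℕ → ℕ → Set
Wfᵒ add x y = T (x + y ≤ᵇ 8)
Wfᵒ mul x y = T (x + y ≤ᵇ 8)
Wfᵒ and x y = ⊥
Wfᵒ or  x y = ⊥
Wfᵒ xor x y = ⊥
Wfᵒ _   x y = ⊤

-- Phrased with boolean tests, so that on a concrete program it reduces to a product of unit types
-- whose element is inferred. The two limits 64 match `64 ≤ X` and the range of `bound`.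
Wf : Expr → Set
Wf (lit m)     = T (m ≤ᵇ 64)
Wf (reg r)     = T (r <ᵇ 64)
Wf mem[ e ]    = Wf e
Wf (op o e f)  = Wf e × Wf f × Wfᵒ o (bd e) (bd f)

-- A view of the machine in which words are natural numbers.  It is faithful as
-- long as all registers stay below X, since X ^ 8 < 2 ^ b leaves room for the
-- intermediate values of the expressions in use.  Registers to which par
-- assigns a constant are read as that constant and must not be written, so
-- their contents need not be tracked.
module Machine (b X : ℕ) (fits : X ^ 8 < 2 ^ b) (64≤X : 64 ≤ X)
               (par : ℕ → Maybe ℕ) where

  R : Store → ℕ → ℕ
  R σ r = maybe′ id (loc σ r) (par r)

  setR : ℕ → ℕ → Store → Store
  setR r v σ = mk (loc σ [ r ↦ v ]) (M σ)

  setMm : ℕ → ℕ → Store → Store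
  setMm a v σ = mk (loc σ) (M σ [ a ↦ v ])

  val : Expr → Store → ℕ
  val (lit m)    σ = m
  val (reg r)    σ = R σ r
  val mem[ e ]   σ = M σ (val e σ)
  val (op o e f) σ = arith o (val e σ) (val f σ)

  obᵒ : BinOp → ℕ → ℕ → Set
  obᵒ sub x y = y ≤ x
  obᵒ shl x y = x * 2 ^ y ≤ X
  obᵒ _   x y = ⊤

  ob : Expr → Store → Set
  ob (lit m)    σ = ⊤
  ob (reg r)    σ = ⊤
  ob mem[ e ]   σ = ob e σ
  ob (op o e f) σ = ob e σ × ob f σ × obᵒ o (val e σ) (val f σ)

  infix 4 _~_
  record _~_ (s : State b) (σ : Store) : Set where
    constructor sim
    field
      regs  : ∀ r → toℕ (registers s r) ≡ R σ r
      cells : ∀ a → toℕ (memory s a) ≡ M σ (toℕ a)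
      -- Registers from 64 on may hold anything: they are neither cleared nor read by well-formed
      -- expressions.
      bound : ∀ r → r < 64 → R σ r ≤ X
  open _~_ public

  private
    1≤X : 1 ≤ X
    1≤X = ≤-trans (s≤s z≤n) 64≤X

    instance
      X≢0 : NonZero X
      X≢0 = >-nonZero 1≤X

    X^≤ : ∀ {i j} → i ≤ j → X ^ i ≤ X ^ j
    X^≤ = ^-monoʳ-≤ X

    <2^b : ∀ {i m} → i ≤ 8 → m ≤ X ^ i → m < 2 ^ b
    <2^b i≤8 m≤ = ≤-<-trans (≤-trans m≤ (X^≤ i≤8)) fits

    X≤2^b : ∀ {m} → m ≤ X → m < 2 ^ b
    X≤2^b m≤ = <2^b {1} (s≤s z≤n) (≤-trans m≤ (≤-reflexive (sym (^-identityʳ X))))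

    1<2^b : ∀ {m} → m ≤ 1 → m < 2 ^ b
    1<2^b m≤1 = X≤2^b (≤-trans m≤1 1≤X)

  toℕ-word : ∀ {m} → m < 2 ^ b → toℕ (word b m) ≡ m
  toℕ-word {m} m< = trans (Fin.toℕ-fromℕ< (m%n<n m (2 ^ b))) (m<n⇒m%n≡m m<)
    where instance _ = m^n≢0 2 b

  private
    Fitsᵒ : BinOp → ℕ → ℕ → Set
    Fitsᵒ add x y = x + y < 2 ^ b
    Fitsᵒ mul x y = x * y < 2 ^ b
    Fitsᵒ sub x y = y ≤ x
    Fitsᵒ shl x y = x * 2 ^ y < 2 ^ b
    Fitsᵒ and x y = ⊥
    Fitsᵒ or  x y = ⊥
    Fitsᵒ xor x y = ⊥
    Fitsᵒ _   x y = ⊤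

    applyOK : ∀ o (x y : Word b) → Fitsᵒ o (toℕ x) (toℕ y) →
              toℕ (applyOp b o x y) ≡ arith o (toℕ x) (toℕ y)
    applyOK add x y p = toℕ-word p
    applyOK sub x y p = begin
      toℕ (word b (toℕ x + (2 ^ b ∸ toℕ y)))
        ≡⟨ Fin.toℕ-fromℕ< (m%n<n (toℕ x + (2 ^ b ∸ toℕ y)) (2 ^ b)) ⟩
      (toℕ x + (2 ^ b ∸ toℕ y)) % 2 ^ b
        ≡⟨ cong (_% 2 ^ b) (sym (+-∸-assoc (toℕ x) (<⇒≤ (Fin.toℕ<n y)))) ⟩
      (toℕ x + 2 ^ b ∸ toℕ y) % 2 ^ b
        ≡⟨ cong (_% 2 ^ b) (+-∸-comm (2 ^ b) p) ⟩
      (toℕ x ∸ toℕ y + 2 ^ b) % 2 ^ b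
        ≡⟨ [m+n]%n≡m%n (toℕ x ∸ toℕ y) (2 ^ b) ⟩
      (toℕ x ∸ toℕ y) % 2 ^ b
        ≡⟨ m<n⇒m%n≡m (≤-<-trans (m∸n≤m (toℕ x) (toℕ y)) (Fin.toℕ<n x)) ⟩
      toℕ x ∸ toℕ y ∎
      where
      open ≡-Reasoning
      instance _ = m^n≢0 2 b
    applyOK mul x y p = toℕ-word p
    applyOK div x y p = toℕ-word (≤-<-trans (quot≤ (toℕ x) (toℕ y)) (Fin.toℕ<n x))
    applyOK mod x y p = toℕ-word (≤-<-trans (rem≤ (toℕ x) (toℕ y)) (Fin.toℕ<n x))
    applyOK shl x y p = toℕ-word p
    applyOK shr x y p = trans (cong (toℕ ∘ word b) (sym (≫-def (toℕ x) (toℕ y))))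
      (toℕ-word (≤-<-trans (≫≤ (toℕ x) (toℕ y)) (Fin.toℕ<n x)))
    applyOK eq  x y p = toℕ-word (1<2^b (bool≤1 (toℕ x ≡ᵇ toℕ y)))
    applyOK lt  x y p = toℕ-word (1<2^b (bool≤1 (toℕ x <ᵇ toℕ y)))

    -- Bounds `X ^ i + X ^ j` by `X ^ (i + j)`, which is why `bd` may treat sums like products.
    x+y≤x*y : ∀ {x y} → 2 ≤ x → 2 ≤ y → x + y ≤ x * y
    x+y≤x*y {suc (suc x)} {suc (suc y)} (s≤s (s≤s _)) (s≤s (s≤s _)) =
      subst (suc (suc x) + suc (suc y) ≤_) lem (m≤m+n _ (x + y + x * y))
      where
      lem : suc (suc x) + suc (suc y) + (x + y + x * y) ≡ suc (suc x) * suc (suc y)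
      lem = solve 2 (λ x y → (con 2 :+ x) :+ (con 2 :+ y) :+ (x :+ y :+ x :* y) :≈ (con 2 :+ x) :* (con 2 :+ y)) refl x y

    bd≥1 : ∀ e → 1 ≤ bd e
    bd≥1 (lit x) = s≤s z≤n
    bd≥1 (reg x) = s≤s z≤n
    bd≥1 mem[ e ] = s≤s z≤n
    bd≥1 (op add e f) = ≤-trans (bd≥1 e) (m≤m+n _ _)
    bd≥1 (op sub e f) = bd≥1 e
    bd≥1 (op mul e f) = ≤-trans (bd≥1 e) (m≤m+n _ _)
    bd≥1 (op div e f) = bd≥1 e
    bd≥1 (op mod e f) = bd≥1 e
    bd≥1 (op and e f) = s≤s z≤n
    bd≥1 (op or e f) = s≤s z≤n
    bd≥1 (op xor e f) = s≤s z≤n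
    bd≥1 (op shl e f) = s≤s z≤n
    bd≥1 (op shr e f) = bd≥1 e
    bd≥1 (op eq e f) = s≤s z≤n
    bd≥1 (op lt e f) = s≤s z≤n

    2≤X^ : ∀ {i} → 1 ≤ i → 2 ≤ X ^ i
    2≤X^ 1≤i = ≤-trans (≤-trans (s≤s (s≤s z≤n)) 64≤X)
                 (≤-trans (≤-reflexive (sym (^-identityʳ X))) (X^≤ 1≤i))

    mono : ∀ {i} {x y : ℕ} → (y ≤ x) → (i ≤ 8 → x ≤ X ^ i) → i ≤ 8 → y ≤ X ^ i
    mono y≤x h p = ≤-trans y≤x (h p)

  Sound : Expr → State b → Store → Set
  Sound e s σ = toℕ (eval e s) ≡ val e σ × (bd e ≤ 8 → val e σ ≤ X ^ bd e)

  eval-val : ∀ {s σ} e → s ~ σ → Wf e → ob e σ → Sound e s σ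
  private
    op-val : ∀ {s σ} o e f → Wfᵒ o (bd e) (bd f) → obᵒ o (val e σ) (val f σ) →
             Sound e s σ → Sound f s σ → Sound (op o e f) s σ
    op-val′ : ∀ {s σ} o e f → Fitsᵒ o (val e σ) (val f σ) →
             toℕ (eval e s) ≡ val e σ → toℕ (eval f s) ≡ val f σ →
             toℕ (eval (op o e f) s) ≡ val (op o e f) σ
    op-val′ {s} o e f p q r =
      trans (applyOK o (eval e s) (eval f s) (subst₂ (Fitsᵒ o) (sym q) (sym r) p)) (cong₂ (arith o) q r)

    op-val {σ = σ} add e f w p (q , q′) (r , r′) =
      op-val′ add e f (<2^b {bd e + bd f} w′ h) q r , λ _ → h
      where
      w′ = ≤ᵇ⇒≤ (bd e + bd f) 8 w
      h : val e σ + val f σ ≤ X ^ (bd e + bd f)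
      h = begin
        val e σ + val f σ ≤⟨ +-mono-≤ (q′ (m+n≤o⇒m≤o (bd e) w′)) (r′ (m+n≤o⇒n≤o (bd e) w′)) ⟩
        X ^ bd e + X ^ bd f ≤⟨ x+y≤x*y (2≤X^ (bd≥1 e)) (2≤X^ (bd≥1 f)) ⟩
        X ^ bd e * X ^ bd f ≡⟨ sym (^-distribˡ-+-* X (bd e) (bd f)) ⟩
        X ^ (bd e + bd f) ∎
        where open ≤-Reasoning
    op-val {σ = σ} mul e f w p (q , q′) (r , r′) =
      op-val′ mul e f (<2^b {bd e + bd f} w′ h) q r , λ _ → h
      where
      w′ = ≤ᵇ⇒≤ (bd e + bd f) 8 w
      h : val e σ * val f σ ≤ X ^ (bd e + bd f)
      h = begin
        val e σ * val f σ ≤⟨ *-mono-≤ (q′ (m+n≤o⇒m≤o (bd e) w′)) (r′ (m+n≤o⇒n≤o (bd e) w′)) ⟩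
        X ^ bd e * X ^ bd f ≡⟨ sym (^-distribˡ-+-* X (bd e) (bd f)) ⟩
        X ^ (bd e + bd f) ∎
        where open ≤-Reasoning
    op-val {σ = σ} sub e f w p (q , q′) (r , r′) =
      op-val′ sub e f p q r , mono (m∸n≤m (val e σ) (val f σ)) q′
    op-val {σ = σ} div e f w p (q , q′) (r , r′) =
      op-val′ div e f _ q r , mono (quot≤ (val e σ) (val f σ)) q′
    op-val {σ = σ} mod e f w p (q , q′) (r , r′) =
      op-val′ mod e f _ q r , mono (rem≤ (val e σ) (val f σ)) q′
    op-val {σ = σ} shr e f w p (q , q′) (r , r′) =
      op-val′ shr e f _ q r , mono (≫≤ (val e σ) (val f σ)) q′
    op-val {σ = σ} shl e f w p (q , q′) (r , r′) =
      op-val′ shl e f (X≤2^b p) q r , λ _ → ≤-trans p (≤-reflexive (sym (^-identityʳ X)))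
    op-val {σ = σ} eq e f w p (q , q′) (r , r′) =
      op-val′ eq e f _ q r , λ _ → ≤-trans (bool≤1 (val e σ ≡ᵇ val f σ)) (≤-trans 1≤X (≤-reflexive (sym (^-identityʳ X))))
    op-val {σ = σ} lt e f w p (q , q′) (r , r′) =
      op-val′ lt e f _ q r , λ _ → ≤-trans (bool≤1 (val e σ <ᵇ val f σ)) (≤-trans 1≤X (≤-reflexive (sym (^-identityʳ X))))

  eval-val (lit m) s~σ w p =
    toℕ-word (X≤2^b m≤X) , λ _ → ≤-trans m≤X (≤-reflexive (sym (^-identityʳ X)))
    where m≤X = ≤-trans (≤ᵇ⇒≤ m 64 w) 64≤X
  eval-val (reg r) s~σ w p =
    regs s~σ r , λ _ → ≤-trans (bound s~σ r (<ᵇ⇒< r 64 w)) (≤-reflexive (sym (^-identityʳ X)))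
  eval-val {s} {σ} mem[ e ] s~σ w p =
    trans (cells s~σ (eval e s)) (cong (M σ) (proj₁ (eval-val e s~σ w p))) ,
    λ 9≤8 → contradiction 9≤8 (n≮n 8)
  eval-val (op o e f) s~σ (w₁ , w₂ , w) (p₁ , p₂ , p) =
    op-val o e f w p (eval-val e s~σ w₁ p₁) (eval-val f s~σ w₂ p₂)

  -- What remains to be checked for the value of an expression to be at most X.
  lim : Expr → Store → Set
  lim (lit m)      σ = ⊤
  lim (reg r)      σ = ⊤
  lim mem[ e ]     σ = M σ (val e σ) ≤ X
  lim (op add e f) σ = val (op add e f) σ ≤ X
  lim (op mul e f) σ = val (op mul e f) σ ≤ X
  lim (op sub e f) σ = lim e σ
  lim (op div e f) σ = lim e σ
  lim (op mod e f) σ = lim e σ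
  lim (op shr e f) σ = lim e σ
  lim (op shl e f) σ = ⊤
  lim (op eq e f)  σ = ⊤
  lim (op lt e f)  σ = ⊤
  lim (op _ e f)   σ = ⊥

  val≤X : ∀ {s σ} e → s ~ σ → Wf e → ob e σ → lim e σ → val e σ ≤ X
  val≤X (lit m) s~σ w p q = ≤-trans (≤ᵇ⇒≤ m 64 w) 64≤X
  val≤X (reg r) s~σ w p q = bound s~σ r (<ᵇ⇒< r 64 w)
  val≤X mem[ e ] s~σ w p q = q
  val≤X (op add e f) s~σ w p q = q
  val≤X (op mul e f) s~σ w p q = q
  val≤X {σ = σ} (op sub e f) s~σ (w , _) (p , _) q = ≤-trans (m∸n≤m (val e σ) (val f σ)) (val≤X e s~σ w p q)
  val≤X {σ = σ} (op div e f) s~σ (w , _) (p , _) q = ≤-trans (quot≤ (val e σ) (val f σ)) (val≤X e s~σ w p q)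
  val≤X {σ = σ} (op mod e f) s~σ (w , _) (p , _) q = ≤-trans (rem≤ (val e σ) (val f σ)) (val≤X e s~σ w p q)
  val≤X {σ = σ} (op shr e f) s~σ (w , _) (p , _) q = ≤-trans (≫≤ (val e σ) (val f σ)) (val≤X e s~σ w p q)
  val≤X (op shl e f) s~σ w (_ , _ , p) q = p
  val≤X {σ = σ} (op eq e f) s~σ w p q = ≤-trans (bool≤1 (val e σ ≡ᵇ val f σ)) 1≤X
  val≤X {σ = σ} (op lt e f) s~σ w p q = ≤-trans (bool≤1 (val e σ <ᵇ val f σ)) 1≤X

  ~setR : ∀ {s σ r w v} → T (is-nothing (par r)) → s ~ σ → toℕ w ≡ v → v ≤ X →
          setReg r w s ~ setR r v σ
  ~setR {s} {σ} {r} {w} {v} np s~σ w≡v v≤X =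
    sim regs′ (cells s~σ) bound′
    where
    regs′ : ∀ q → toℕ (if (q ≡ᵇ r) then w else registers s q) ≡ maybe′ id ((loc σ [ r ↦ v ]) q) (par q)
    regs′ q with q ≡ᵇ r in q≡r | regs s~σ q
    ... | false | h = h
    ... | true  | h with refl ← ≡ᵇ⇒≡ q r (subst T (sym q≡r) tt) with par q
    ...   | nothing = w≡v
    bound′ : ∀ q → q < 64 → maybe′ id ((loc σ [ r ↦ v ]) q) (par q) ≤ X
    bound′ q q< with q ≡ᵇ r | bound s~σ q q<
    ... | false | h = h
    ... | true  | h with par q
    ...   | nothing = v≤X
    ...   | just _  = h

  ~setM : ∀ {s σ} a v {a′ v′} → s ~ σ → toℕ a ≡ a′ → toℕ v ≡ v′ →
          setMem a v s ~ setMm a′ v′ σ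
  ~setM {s} {σ} a v {v′ = v′} s~σ refl refl = sim (regs s~σ) cells′ (bound s~σ)
    where
    cells′ : ∀ c → toℕ (memory (setMem a v s) c) ≡ (M σ [ toℕ a ↦ v′ ]) (toℕ c)
    cells′ c with c Fin.≟ a
    ... | yes refl rewrite updateAt-updates a {const v} (memory s) | ≡ᵇ-refl (toℕ a) = refl
    ... | no  c≢a rewrite updateAt-minimal c a {const v} (memory s) c≢a
                        | ≢⇒≡ᵇ (c≢a ∘ Fin.toℕ-injective) = cells s~σ c

  -- Total correctness with time bounds

  -- The precondition is a single store instead of a predicate. Facts about it live in the Agda
  -- context, and `pin` turns an equation about a register into one that holds by computation.
  Run : Cmd → Store → ℕ → (Store → Set) → Set
  Run c σ t Q = ∀ s → s ~ σ →
    ∃₂ λ t′ s′ → (s ⊢ c ⇓[ t′ ] s′) × t′ ≤ t × ∃ λ σ′ → s′ ~ σ′ × Q σ′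

  weaken : ∀ {c σ t t′} {Q Q′ : Store → Set} → t ≤ t′ → (∀ {σ′} → Q σ′ → Q′ σ′) →
           Run c σ t Q → Run c σ t′ Q′
  weaken t≤t′ f run s s~σ with run s s~σ
  ... | t , s′ , d , t≤ , σ′ , s′~σ′ , q = t , s′ , d , ≤-trans t≤ t≤t′ , σ′ , s′~σ′ , f q

  infixr 4 _▷_
  _▷_ : ∀ {c d σ t u} {P Q : Store → Set} →
        Run c σ t P → (∀ {σ′} → P σ′ → Run d σ′ u Q) → Run (c ⨾ d) σ (t + u) Q
  (run ▷ k) s s~σ with run s s~σ
  ... | t , s′ , d , t≤ , σ′ , s′~σ′ , p with k p s′ s′~σ′
  ... | u , s″ , d′ , u≤ , σ″ , s″~σ″ , q =
    t + u , s″ , ⇓seq d d′ , +-mono-≤ t≤ u≤ , σ″ , s″~σ″ , q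

  -- Replaces σ by a store in which looking up r computes to v.
  pin : ∀ {c σ t Q} r {v} {np : T (is-nothing (par r))} → R σ r ≡ v →
        Run c (setR r v σ) t Q → Run c σ t Q
  pin {σ = σ} r {v} {np} p run s s~σ = run s (sim regs′ (cells s~σ) bound′)
    where
    regs′ : ∀ q → toℕ (registers s q) ≡ maybe′ id ((loc σ [ r ↦ v ]) q) (par q)
    regs′ q with q ≡ᵇ r in q≡r | regs s~σ q
    ... | false | h = h
    ... | true  | h with refl ← ≡ᵇ⇒≡ q r (subst T (sym q≡r) tt) with par q
    ...   | nothing = trans h p
    bound′ : ∀ q → q < 64 → maybe′ id ((loc σ [ r ↦ v ]) q) (par q) ≤ X
    bound′ q q< = subst (_≤ X) (trans (sym (regs s~σ q)) (regs′ q)) (bound s~σ q q<)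

  -- The programs write conjunction as `mul` and negation as comparison with 0. Both are translated
  -- back here, so that a test yields the arithmetic fact which the proof uses.
  Tru Fls : Expr → Store → Set
  Tru (op eq e (lit 0)) σ = Fls e σ
  Tru (op eq e f)       σ = val e σ ≡ val f σ
  Tru (op lt e f)       σ = val e σ < val f σ
  Tru (op mul e f)      σ = Tru e σ × Tru f σ
  Tru e                 σ = val e σ ≢ 0
  Fls (op eq e (lit 0)) σ = Tru e σ
  Fls (op eq e f)       σ = val e σ ≢ val f σ
  Fls (op lt e f)       σ = val f σ ≤ val e σ
  Fls (op mul e f)      σ = Fls e σ ⊎ Fls f σ
  Fls e                 σ = val e σ ≡ 0

  Decided : Expr → Store → Set
  Decided e σ = (val e σ ≢ 0 × Tru e σ) ⊎ (val e σ ≡ 0 × Fls e σ)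

  private
    nz : ∀ x → x ≢ 0 × x ≢ 0 ⊎ x ≡ 0 × x ≡ 0
    nz zero    = inj₂ (refl , refl)
    nz (suc x) = inj₁ ((λ ()) , (λ ()))

    dec-eq : ∀ x y → arith eq x y ≢ 0 × x ≡ y ⊎ arith eq x y ≡ 0 × x ≢ y
    dec-eq x y with x ≟ y
    ... | yes refl rewrite ≡ᵇ-refl x = inj₁ ((λ ()) , refl)
    ... | no  x≢y  rewrite ≢⇒≡ᵇ x≢y  = inj₂ (refl , x≢y)

    dec-lt : ∀ x y → arith lt x y ≢ 0 × x < y ⊎ arith lt x y ≡ 0 × y ≤ x
    dec-lt x y with x <? y
    ... | yes x<y rewrite <⇒<ᵇ≡ x<y = inj₁ ((λ ()) , x<y)
    ... | no  x≮y rewrite ≥⇒<ᵇ≡ (≮⇒≥ x≮y) = inj₂ (refl , ≮⇒≥ x≮y)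

  decide : ∀ e σ → Decided e σ
  decide (lit m) σ = nz m
  decide (reg r) σ = nz (R σ r)
  decide mem[ e ] σ = nz (M σ (val e σ))
  decide (op add e f) σ = nz (val e σ + val f σ)
  decide (op sub e f) σ = nz (val e σ ∸ val f σ)
  decide (op mul e f) σ with decide e σ | decide f σ
  ... | inj₂ (p , p′) | _ rewrite p = inj₂ (refl , inj₁ p′)
  ... | inj₁ (p , p′) | inj₂ (q , q′) rewrite q = inj₂ (*-zeroʳ (val e σ) , inj₂ q′)
  ... | inj₁ (p , p′) | inj₁ (q , q′) = inj₁ (([ p , q ]′ ∘ m*n≡0⇒m≡0∨n≡0 (val e σ)) , p′ , q′)
  decide (op div e f) σ = nz (quot (val e σ) (val f σ))
  decide (op mod e f) σ = nz (rem (val e σ) (val f σ))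
  decide (op and e f) σ = inj₂ (refl , refl)
  decide (op or e f) σ = inj₂ (refl , refl)
  decide (op xor e f) σ = inj₂ (refl , refl)
  decide (op shl e f) σ = nz (val e σ * 2 ^ val f σ)
  decide (op shr e f) σ = nz (val e σ ≫ val f σ)
  decide (op lt e f) σ = dec-lt (val e σ) (val f σ)
  decide (op eq e (lit (suc m))) σ = dec-eq (val e σ) (suc m)
  decide (op eq e (reg r)) σ = dec-eq (val e σ) (R σ r)
  decide (op eq e mem[ f ]) σ = dec-eq (val e σ) (M σ (val f σ))
  decide (op eq e (op o f g)) σ = dec-eq (val e σ) (val (op o f g) σ)
  decide (op eq e (lit 0)) σ with decide e σ
  ... | inj₂ (p , p′) rewrite p = inj₁ ((λ ()) , p′)
  ... | inj₁ (p , p′) rewrite ≢⇒≡ᵇ p = inj₂ (refl , p′)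

  -- One unrolling. The body ends in a state from which the rest of the loop runs, so a loop is
  -- verified by ordinary induction on the number of rounds left.
  while-step : ∀ {e c σ t u Q} {w : Wf e} → ob e σ → (Fls e σ → Q σ) →
               (Tru e σ → Run c σ t (λ σ′ → Run (while e c) σ′ u Q)) →
               Run (while e c) σ (1 + cost e + t + u) Q
  while-step {e} {c} {σ} {t} {u} {w = w} p exit step s s~σ
    with decide e σ | proj₁ (eval-val e s~σ w p)
  ... | inj₂ (q , q′) | v =
    1 + cost e , s , ⇓exit (trans v q) ,
    ≤-trans (m≤m+n (1 + cost e) t) (m≤m+n (1 + cost e + t) u) , σ , s~σ , exit q′
  ... | inj₁ (q , q′) | v with step q′ s s~σ
  ...   | t₁ , s₁ , d₁ , t₁≤ , σ₁ , s₁~σ₁ , k with k s₁ s₁~σ₁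
  ...     | t₂ , s₂ , d₂ , t₂≤ , σ₂ , s₂~σ₂ , r =
    1 + cost e + t₁ + t₂ , s₂ , ⇓loop (q ∘ trans (sym v)) d₁ d₂ ,
    +-mono-≤ (+-monoʳ-≤ (1 + cost e) t₁≤) t₂≤ , σ₂ , s₂~σ₂ , r

  if-step : ∀ {e c d σ t u Q} {w : Wf e} → ob e σ →
            (Tru e σ → Run c σ t Q) → (Fls e σ → Run d σ u Q) →
            Run (ite e c d) σ (1 + cost e + (t ⊔ u)) Q
  if-step {e} {σ = σ} {t} {u} {w = w} p k l s s~σ
    with decide e σ | proj₁ (eval-val e s~σ w p)
  ... | inj₂ (q , q′) | v with l q′ s s~σ
  ...   | t′ , s′ , d , t≤ , r =
    _ , s′ , ⇓else (trans v q) d , +-monoʳ-≤ (1 + cost e) (≤-trans t≤ (m≤n⊔m t u)) , r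
  if-step {e} {σ = σ} {t} {u} {w = w} p k l s s~σ | inj₁ (q , q′) | v with k q′ s s~σ
  ...   | t′ , s′ , d , t≤ , r =
    _ , s′ , ⇓then (q ∘ trans (sym v)) d , +-monoʳ-≤ (1 + cost e) (≤-trans t≤ (m≤m⊔n t u)) , r

  branch : ∀ {e c d σ t Q} {w : Wf e} → ob e σ →
           (Tru e σ → Run c σ t Q) → (Fls e σ → Run d σ t Q) → Run (ite e c d) σ (1 + cost e + t) Q
  branch {e} {t = t} {w = w} p k l = weaken (≤-reflexive (cong (1 + cost e +_) (⊔-idem t))) id (if-step {w = w} p k l)

  wp : Cmd → (Store → Set) → Store → Set
  wp skip           Q σ = Q σ
  wp (r := e)       Q σ = ob e σ × lim e σ × Q (setR r (val e σ) σ)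
  wp (mem[ a ]:= e) Q σ = ob a σ × ob e σ × Q (setMm (val a σ) (val e σ) σ)
  wp (c ⨾ d)        Q σ = wp c (wp d Q) σ
  wp (ite e c d)    Q σ = ob e σ × (Tru e σ → wp c Q σ) × (Fls e σ → wp d Q σ)
  wp (while e c)    Q σ = ⊥

  Wfᶜ : Cmd → Set
  Wfᶜ skip           = ⊤
  Wfᶜ (r := e)       = T (is-nothing (par r)) × Wf e
  Wfᶜ (mem[ a ]:= e) = Wf a × Wf e
  Wfᶜ (c ⨾ d)        = Wfᶜ c × Wfᶜ d
  Wfᶜ (ite e c d)    = Wf e × Wfᶜ c × Wfᶜ d
  Wfᶜ (while e c)    = ⊥

  time : Cmd → ℕ
  time skip           = 1
  time (r := e)       = 1 + cost e
  time (mem[ a ]:= e) = 1 + cost a + cost e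
  time (c ⨾ d)        = time c + time d
  time (ite e c d)    = 1 + cost e + (time c ⊔ time d)
  time (while e c)    = 0

  straight : ∀ c {σ Q} {w : Wfᶜ c} → wp c Q σ → Run c σ (time c) Q
  straight skip q s s~σ = 1 , s , ⇓skip , ≤-refl , _ , s~σ , q
  straight (r := e) {w = np , w} (p , l , q) s s~σ =
    _ , _ , ⇓assign , ≤-refl , _ ,
    ~setR np s~σ (proj₁ (eval-val e s~σ w p)) (val≤X e s~σ w p l) , q
  straight (mem[ a ]:= e) {w = w₁ , w₂} (p₁ , p₂ , q) s s~σ =
    _ , _ , ⇓store , ≤-refl , _ ,
    ~setM (eval a s) (eval e s) s~σ (proj₁ (eval-val a s~σ w₁ p₁)) (proj₁ (eval-val e s~σ w₂ p₂)) , q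
  straight (c ⨾ d) {w = w₁ , w₂} p = straight c {w = w₁} p ▷ λ q → straight d {w = w₂} q
  straight (ite e c d) {w = w , w₁ , w₂} (p , k , l) =
    if-step {w = w} p (λ t → straight c {w = w₁} (k t)) (λ f → straight d {w = w₂} (l f))
  straight (while e c) ()

  final : Cmd → Store → Store
  final (r := e)       σ = setR r (val e σ) σ
  final (mem[ a ]:= e) σ = setMm (val a σ) (val e σ) σ
  final (c ⨾ d)        σ = final d (final c σ)
  final _              σ = σ

  Fine : Cmd → Store → Set
  Fine skip           σ = ⊤
  Fine (r := e)       σ = ob e σ × lim e σ
  Fine (mem[ a ]:= e) σ = ob a σ × ob e σ
  Fine (c ⨾ d)        σ = Fine c σ × Fine d (final c σ)
  Fine (ite e c d)    σ = ⊥
  Fine (while e c)    σ = ⊥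

  finish : ∀ c {σ Q} {w : Wfᶜ c} → Fine c σ → Q (final c σ) → Run c σ (time c) Q
  finish skip {w = w} p q = straight skip {w = w} q
  finish (r := e) {w = w} (p , l) q = straight (r := e) {w = w} (p , l , q)
  finish (mem[ a ]:= e) {w = w} (p , l) q = straight (mem[ a ]:= e) {w = w} (p , l , q)
  finish (c ⨾ d) {w = w , w′} (p , p′) q =
    finish c {Q = _≡ final c _} {w = w} p refl ▷ λ { refl → finish d {w = w′} p′ q }

  -- The outcome of branch-free code is a store that computes. What the code establishes then holds
  -- by `refl`, and no equations have to be carried along.
  exec : ∀ c {d σ u Q} {w : Wfᶜ c} → Fine c σ → Run d (final c σ) u Q → Run (c ⨾ d) σ (time c + u) Q
  exec c {σ = σ} {w = w} p r = finish c {Q = _≡ final c σ} {w = w} p refl ▷ λ { refl → r }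

  Above : ℕ → Cmd → Set
  Above q skip           = ⊤
  Above q (r := e)       = T (q ≤ᵇ r)
  Above q (mem[ a ]:= e) = ⊤
  Above q (c ⨾ d)        = Above q c × Above q d
  Above q (ite e c d)    = Above q c × Above q d
  Above q (while e c)    = Above q c

  private
    above : ∀ {q c t} {s s′ : State b} → Above q c → s ⊢ c ⇓[ t ] s′ →
            ∀ r → r < q → registers s′ r ≡ registers s r
    above w ⇓skip r r<q = refl
    above {q} w (⇓assign {r′}) r r<q
      rewrite ≢⇒≡ᵇ (<⇒≢ (<-≤-trans r<q (≤ᵇ⇒≤ q r′ w))) = refl
    above w ⇓store r r<q = refl
    above (w₁ , w₂) (⇓seq d d′) r r<q = trans (above w₂ d′ r r<q) (above w₁ d r r<q)
    above (w₁ , w₂) (⇓then x d) = above w₁ d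
    above (w₁ , w₂) (⇓else x d) = above w₂ d
    above w (⇓exit x) r r<q = refl
    above w (⇓loop x d d′) r r<q = trans (above w d′ r r<q) (above w d r r<q)

  -- Which registers a command may change can be read off its text. The registers are numbered
  -- accordingly: the variables of a caller lie below those of its subroutines.
  framed : ∀ q {c σ t Q} {w : Above q c} → Run c σ t Q →
           Run c σ t (λ σ′ → Q σ′ × ∀ r → r < q → R σ′ r ≡ R σ r)
  framed q {w = w} run s s~σ with run s s~σ
  ... | t , s′ , d , t≤ , σ′ , s′~σ′ , p =
    t , s′ , d , t≤ , σ′ , s′~σ′ , p ,
    λ r r<q → trans (sym (regs s′~σ′ r)) (trans (cong toℕ (above w d r r<q)) (regs s~σ r))

-- Van Emde Boas nodes and their footprints

half≡ : ∀ e → e / 2 ≡ ⌊ e /2⌋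
half≡ zero          = refl
half≡ (suc zero)    = refl
half≡ (suc (suc e)) = trans (m/n≡1+[m∸n]/n {suc (suc e)} {2} (s≤s (s≤s z≤n))) (cong suc (half≡ e))

opaque
  fl cl : ℕ → ℕ
  fl e = e / 2
  cl e = (e + 1) / 2

  fl-def : ∀ e → e / 2 ≡ fl e
  fl-def e = refl

  cl-def : ∀ e → (e + 1) / 2 ≡ cl e
  cl-def e = refl

fl≡ : ∀ e → fl e ≡ ⌊ e /2⌋
fl≡ e = trans (sym (fl-def e)) (half≡ e)

cl≡ : ∀ e → cl e ≡ ⌈ e /2⌉
cl≡ e = trans (sym (cl-def e)) (trans (half≡ (e + 1)) (cong ⌊_/2⌋ (+-comm e 1)))

fl+cl : ∀ e → fl e + cl e ≡ e
fl+cl e = trans (cong₂ _+_ (fl≡ e) (cl≡ e)) (⌊n/2⌋+⌈n/2⌉≡n e)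

fl≤ : ∀ e → fl e ≤ e
fl≤ e = m+n≤o⇒m≤o (fl e) (≤-reflexive (fl+cl e))

cl≤ : ∀ e → cl e ≤ e
cl≤ e = m+n≤o⇒n≤o (fl e) (≤-reflexive (fl+cl e))

1≤cl : ∀ {e} → 1 ≤ e → 1 ≤ cl e
1≤cl {suc e} _ = subst (1 ≤_) (sym (cl≡ (suc e))) (s≤s z≤n)

1≤fl : ∀ {e} → 2 ≤ e → 1 ≤ fl e
1≤fl {suc (suc e)} _ = subst (1 ≤_) (sym (fl≡ (suc (suc e)))) (s≤s z≤n)
1≤fl {suc zero} (s≤s ())

fl-level : ∀ {e p} → e ≤ p → fl e + fl e ≤ p
fl-level {e} e≤p = ≤-trans (+-monoʳ-≤ (fl e) fl≤cl) (≤-trans (≤-reflexive (fl+cl e)) e≤p)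
  where fl≤cl = subst₂ _≤_ (sym (fl≡ e)) (sym (cl≡ e)) (⌊n/2⌋≤⌈n/2⌉ e)

-- Rounding up is harmless because the bound is even: half of `p + p` is p exactly. So both halves
-- of a height fit one level further down.
cl-level : ∀ {e p} → e ≤ p + p → cl e + cl e ≤ p + p
cl-level {e} {p} e≤ = +-mono-≤ h h
  where h = subst₂ _≤_ (sym (cl≡ e)) (sym (n≡⌈n+n/2⌉ p)) (⌈n/2⌉-mono e≤)

≫-cancel-< : ∀ {x y} a → x ≫ a < y ≫ a → x < y
≫-cancel-< a p = ≰⇒> (λ y≤x → <⇒≱ p (≫-monoˡ a y≤x))

-- Three keys do not fit into a universe of two.
span≥2 : ∀ e {x y z v} → x < y → y < z → x ≫ e ≡ v → y ≫ e ≡ v → z ≫ e ≡ v → 2 ≤ e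
span≥2 zero {x} {y} x<y y<z p q r = contradiction (trans (sym (≫-0 x)) (trans (trans p (sym q)) (≫-0 y))) (<⇒≢ x<y)
span≥2 (suc zero) {x} {y} {z} x<y y<z p q r = contradiction (trans r (sym p)) (≢-sym (<⇒≢ x≫1<z≫1))
  where
  x≫1<z≫1 : x ≫ 1 < z ≫ 1
  x≫1<z≫1 = begin-strict
    x ≫ 1             ≡⟨ ≫-1 x ⟩
    x / 2             <⟨ n<1+n _ ⟩
    suc (x / 2)       ≡⟨ sym (m/n≡1+[m∸n]/n {suc (suc x)} {2} (s≤s (s≤s z≤n))) ⟩
    suc (suc x) / 2   ≤⟨ /-monoˡ-≤ 2 (≤-trans (s≤s x<y) y<z) ⟩
    z / 2             ≡⟨ sym (≫-1 z) ⟩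
    z ≫ 1             ∎
    where open ≤-Reasoning
span≥2 (suc (suc e)) _ _ _ _ _ = s≤s (s≤s z≤n)

Cells : Set
Cells = ℕ → ℕ → ℕ × ℕ

Keys : Set₁
Keys = ℕ → Set

lo hi : Cells → ℕ → ℕ → ℕ
lo m J H = proj₁ (m J H)
hi m J H = proj₂ (m J H)

Btw : ℕ × ℕ → Keys → Keys
Btw c S y = S y × proj₁ c < y × suc y < proj₂ c

record Node (c : ℕ × ℕ) (S : Keys) : Set where
  constructor node
  field
    lo∈ : proj₂ c ≢ 0 → S (proj₁ c)
    hi∈ : proj₂ c ≢ 0 → S (pred (proj₂ c))
    lo≤ : ∀ {y} → S y → proj₁ c ≤ y
    <hi : ∀ {y} → S y → y < proj₂ c
open Node

-- The van Emde Boas node at vertex H of the binary trie represents the set S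
-- of vertices e levels below H.  A vertex at depth d is coded by a number with
-- leading bit 2 ^ d, so that x ≫ a is the ancestor of x that is a levels up.
-- Of the pair stored at a node, the second component is the maximum plus one
-- (0 if the set is empty); neither the minimum nor the maximum is stored
-- further down.
Good : Cells → ℕ → ℕ → ℕ → Keys → Set
Good m zero    H e S = (∀ y → ¬ S y) × hi m 0 H ≡ 0
Good m (suc j) H e S =
  Node (m (suc j) H) S
  × Good m j H (fl e) (λ u → ∃ λ y → Btw (m (suc j) H) S y × y ≫ cl e ≡ u)
  × (∀ u → u ≫ fl e ≡ H → Good m j u (cl e) (λ y → Btw (m (suc j) H) S y × y ≫ cl e ≡ u))

Good-lo∈ : ∀ {m} J {H e S} → Good m J H e S → hi m J H ≢ 0 → S (lo m J H)
Good-lo∈ zero    (_ , h) p = contradiction h p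
Good-lo∈ (suc J) (n , _) p = lo∈ n p

Good-hi∈ : ∀ {m} J {H e S} → Good m J H e S → hi m J H ≢ 0 → S (pred (hi m J H))
Good-hi∈ zero    (_ , h) p = contradiction h p
Good-hi∈ (suc J) (n , _) p = hi∈ n p

Good-lo≤ : ∀ {m} J {H e S} → Good m J H e S → ∀ {y} → S y → lo m J H ≤ y
Good-lo≤ zero    (h , _) {y} p = contradiction p (h y)
Good-lo≤ (suc J) (n , _) p = lo≤ n p

Good-<hi : ∀ {m} J {H e S} → Good m J H e S → ∀ {y} → S y → y < hi m J H
Good-<hi zero    (h , _) {y} p = contradiction p (h y)
Good-<hi (suc J) (n , _) p = <hi n p

Good-∅ : ∀ {m} J {H e S} → Good m J H e S → hi m J H ≡ 0 → ∀ {y} → ¬ S y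
Good-∅ J g p {y} q = contradiction (subst (y <_) p (Good-<hi J g q)) λ ()

Good-≢0 : ∀ {m} J {H e S} → Good m J H e S → ∀ {y} → S y → hi m J H ≢ 0
Good-≢0 J g q p = Good-∅ J g p q

Good-cong : ∀ {m} J {H e S S′} → (∀ {y} → S y → S′ y) → (∀ {y} → S′ y → S y) →
            Good m J H e S → Good m J H e S′
Good-cong zero f g (h , z) = (λ y q → h y (g q)) , z
Good-cong (suc J) f g (node a b c d , s , k) =
  node (f ∘ a) (f ∘ b) (c ∘ g) (d ∘ g) ,
  Good-cong J (λ { (y , (p , q) , r) → y , (f p , q) , r }) (λ { (y , (p , q) , r) → y , (g p , q) , r }) s ,
  λ u v → Good-cong J (λ { ((p , q) , r) → (f p , q) , r }) (λ { ((p , q) , r) → (g p , q) , r }) (k u v)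

-- Contains every cell that `Good` reads. The bound `pred e` is what separates children: the summary
-- reaches fewer than `fl e` levels below H, whereas the clusters begin `fl e` levels below it.
Foot : ℕ → ℕ → ℕ → ℕ → ℕ → Set
Foot J H e J′ H′ = J′ ≤ J × ∃ λ r → r ≤ pred e × H′ ≫ r ≡ H

foot-self : ∀ J H e → Foot J H e J H
foot-self J H e = ≤-refl , 0 , z≤n , ≫-0 H

foot-summary : ∀ {j H J′ H′} e → Foot j H (fl e) J′ H′ → Foot (suc j) H e J′ H′
foot-summary e (p , r , q , h) = m≤n⇒m≤1+n p , r , ≤-trans q (pred-mono-≤ (fl≤ e)) , h

foot-cluster : ∀ {j H u J′ H′} e → u ≫ fl e ≡ H → Foot j u (cl e) J′ H′ → Foot (suc j) H e J′ H′
foot-cluster {H′ = H′} e uH (p , r , q , h) =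
  m≤n⇒m≤1+n p , r + fl e , bnd e q , trans (sym (≫-≫ H′ r (fl e))) (trans (cong (_≫ fl e) h) uH)
  where
  bnd : ∀ {r} e → r ≤ pred (cl e) → r + fl e ≤ pred e
  bnd {r} zero q rewrite fl≡ 0 | cl≡ 0 = ≤-trans (≤-reflexive (+-identityʳ r)) q
  bnd {r} (suc e) q = s≤s⁻¹ (begin
    suc r + fl (suc e)            ≤⟨ +-monoˡ-≤ (fl (suc e)) (s≤s q) ⟩
    suc (pred (cl (suc e))) + fl (suc e) ≡⟨ cong (_+ fl (suc e)) (suc-pred (cl (suc e)) {{>-nonZero (1≤cl {suc e} (s≤s z≤n))}}) ⟩
    cl (suc e) + fl (suc e)       ≡⟨ +-comm (cl (suc e)) _ ⟩
    fl (suc e) + cl (suc e)       ≡⟨ fl+cl (suc e) ⟩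
    suc e                         ∎)
    where open ≤-Reasoning

-- The code of a vertex is positive, and shifting a positive number makes it smaller, so no vertex
-- is its own proper ancestor. This is what the leading bit of the codes is for.
ancestor-unique : ∀ {x H r s} → 1 ≤ H → r < s → x ≫ r ≡ H → x ≫ s ≡ H → ⊥
ancestor-unique {x} {H} {r} {s} 1≤H r<s p q = <⇒≢ (≫-< {H} {s ∸ r} 1≤H (m<n⇒0<n∸m r<s)) (begin
  H ≫ (s ∸ r)       ≡⟨ cong (_≫ (s ∸ r)) (sym p) ⟩
  x ≫ r ≫ (s ∸ r)   ≡⟨ ≫-≫ x r (s ∸ r) ⟩
  x ≫ (r + (s ∸ r)) ≡⟨ cong (x ≫_) (m+[n∸m]≡n (<⇒≤ r<s)) ⟩
  x ≫ s             ≡⟨ q ⟩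
  H                 ∎)
  where open ≡-Reasoning

summary-cluster : ∀ {j H u J′ H′} e → 2 ≤ e → 1 ≤ H → u ≫ fl e ≡ H →
                  Foot j H (fl e) J′ H′ → Foot j u (cl e) J′ H′ → ⊥
summary-cluster {H′ = H′} e 2≤e 1≤H uH (_ , r , q , h) (_ , r′ , _ , h′) =
  ancestor-unique {x = H′} {s = r′ + fl e} 1≤H
    (≤-trans (≤-trans (s≤s q) (≤-reflexive (suc-pred (fl e) {{>-nonZero (1≤fl 2≤e)}}))) (m≤n+m (fl e) r′))
    h (trans (sym (≫-≫ H′ r′ (fl e))) (trans (cong (_≫ fl e) h′) uH))

cluster-cluster : ∀ {j H u u′ J′ H′} e → 1 ≤ H → u ≫ fl e ≡ H → u′ ≫ fl e ≡ H → u ≢ u′ →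
                  Foot j u (cl e) J′ H′ → Foot j u′ (cl e) J′ H′ → ⊥
cluster-cluster {H = H} {H′ = H′} e 1≤H uH u′H u≢u′ (_ , r , _ , h) (_ , r′ , _ , h′) with <-cmp r r′
... | tri< r<r′ _ _ = ancestor-unique {x = H′} 1≤H (+-monoˡ-< (fl e) r<r′)
    (trans (sym (≫-≫ H′ r (fl e))) (trans (cong (_≫ fl e) h) uH))
    (trans (sym (≫-≫ H′ r′ (fl e))) (trans (cong (_≫ fl e) h′) u′H))
... | tri≈ _ refl _ = u≢u′ (trans (sym h) h′)
... | tri> _ _ r′<r = ancestor-unique {x = H′} 1≤H (+-monoˡ-< (fl e) r′<r)
    (trans (sym (≫-≫ H′ r′ (fl e))) (trans (cong (_≫ fl e) h′) u′H))
    (trans (sym (≫-≫ H′ r (fl e))) (trans (cong (_≫ fl e) h) uH))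

Good-frame : ∀ {m m′} J {H e S} → Good m J H e S →
             (∀ {J′ H′} → Foot J H e J′ H′ → m′ J′ H′ ≡ m J′ H′) → Good m′ J H e S
Good-frame zero {H} {e} (h , z) f = h , trans (cong proj₂ (f (foot-self 0 H e))) z
Good-frame {m} {m′} (suc J) {H} {e} (n , s , k) f rewrite f (foot-self (suc J) H e) =
  n , Good-frame J s (f ∘ foot-summary e) , λ u v → Good-frame J (k u v) (f ∘ foot-cluster e v)

infixl 6 _∪_ _∖_
_∪_ _∖_ : Keys → ℕ → Keys
(S ∪ x) y = S y ⊎ y ≡ x
(S ∖ x) y = S y × y ≢ x

-- Insertion

module Trees (B : ℕ) where

  -- Agreement is asked only for levels below B, because the address computed from `H * B + J`
  -- determines vertex and level only there.
  record Upd (m m′ : Cells) (J H : ℕ) (c : ℕ × ℕ) : Set where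
    constructor upd
    field
      at   : m′ J H ≡ c
      else : ∀ {J′ H′} → J′ < B → ¬ (J′ ≡ J × H′ ≡ H) → m′ J′ H′ ≡ m J′ H′
  open Upd public

  Out : Cells → Cells → ℕ → ℕ → ℕ → Set
  Out m m′ J H e = ∀ {J′ H′} → J′ < B → ¬ Foot J H e J′ H′ → m′ J′ H′ ≡ m J′ H′

  private
    below : ∀ {m m′ j H K c e S} → j < B → Upd m m′ (suc j) H c → Good m j K e S → Good m′ j K e S
    below {j = j} j<B U g = Good-frame j g λ { (p , _) → else U (≤-<-trans p j<B) λ { (refl , _) → 1+n≰n p } }

  module _ {m m′ : Cells} {j H e : ℕ} {S S′ : Keys} {c : ℕ × ℕ} (j<B : suc j < B) (g : Good m (suc j) H e S)
           (n : Node c S′) where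

    private
      j<B′ = <-trans (n<1+n j) j<B
      Bt  = Btw (m (suc j) H) S
      Bt′ = Btw c S′

    -- The keys strictly between the extremes stay the same, hence so do the sets of all children.
    rebuild-here : Upd m m′ (suc j) H c → (∀ {y} → Bt y → Bt′ y) → (∀ {y} → Bt′ y → Bt y) →
                   Good m′ (suc j) H e S′ × Out m m′ (suc j) H e
    rebuild-here U f h rewrite at U =
      ( n
      , below j<B′ U (Good-cong j (λ { (y , p , q) → y , f p , q }) (λ { (y , p , q) → y , h p , q }) (proj₁ (proj₂ g)))
      , λ u v → below j<B′ U (Good-cong j (λ { (p , q) → f p , q }) (λ { (p , q) → h p , q }) (proj₂ (proj₂ g) u v)))
      , λ p q → else U p λ { (refl , refl) → q (foot-self (suc j) H e) }

    module _ {m₁ : Cells} {u : ℕ} (U : Upd m m₁ (suc j) H c) (2≤e : 2 ≤ e) (1≤H : 1 ≤ H) (uH : u ≫ fl e ≡ H)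
             (f : ∀ {y} → y ≫ cl e ≢ u → Bt y → Bt′ y)
             (h : ∀ {y} → y ≫ cl e ≢ u → Bt′ y → Bt y) where

      -- Cluster u has a key afterwards exactly if it had one before, so the summary keeps its set.
      -- Disjoint footprints protect the summary and the other clusters.
      rebuild-cluster : (∀ {y} → Bt y → y ≫ cl e ≡ u → ∃ λ z → Bt′ z × z ≫ cl e ≡ u) →
                        (∀ {y} → Bt′ y → y ≫ cl e ≡ u → ∃ λ z → Bt z × z ≫ cl e ≡ u) →
                        Good m′ j u (cl e) (λ y → Bt′ y × y ≫ cl e ≡ u) → Out m₁ m′ j u (cl e) →
                        Good m′ (suc j) H e S′ × Out m m′ (suc j) H e
      rebuild-cluster fu hu g′ out
        rewrite trans (out {suc j} {H} j<B (λ { (p , _) → 1+n≰n p })) (at U) =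
        ( n
        , Good-frame j (below j<B′ U (Good-cong j to from (proj₁ (proj₂ g))))
            (λ F → out (≤-<-trans (proj₁ F) j<B′) (summary-cluster e 2≤e 1≤H uH F))
        , clusters )
        , λ p q → trans (out p (q ∘ foot-cluster e uH)) (else U p λ { (refl , refl) → q (foot-self (suc j) H e) })
        where
        to : ∀ {v} → (∃ λ y → Bt y × y ≫ cl e ≡ v) → ∃ λ y → Bt′ y × y ≫ cl e ≡ v
        to {v} (y , p , q) with v ≟ u
        ... | yes refl = fu p q
        ... | no v≢u = y , f (v≢u ∘ trans (sym q)) p , q
        from : ∀ {v} → (∃ λ y → Bt′ y × y ≫ cl e ≡ v) → ∃ λ y → Bt y × y ≫ cl e ≡ v
        from {v} (y , p , q) with v ≟ u
        ... | yes refl = hu p q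
        ... | no v≢u = y , h (v≢u ∘ trans (sym q)) p , q
        clusters : ∀ v → v ≫ fl e ≡ H → Good m′ j v (cl e) (λ y → Bt′ y × y ≫ cl e ≡ v)
        clusters v vH with v ≟ u
        ... | yes refl = g′
        ... | no v≢u =
          Good-frame j (below j<B′ U (Good-cong j (λ { (p , q) → f (v≢u ∘ trans (sym q)) p , q })
                                                  (λ { (p , q) → h (v≢u ∘ trans (sym q)) p , q })
                                                  (proj₂ (proj₂ g) v vH)))
            (λ F → out (≤-<-trans (proj₁ F) j<B′) (cluster-cluster e 1≤H vH uH v≢u F))

      -- Cluster u appears or vanishes. Its own pair has been written outright, and the recursion
      -- goes on in the summary, whose footprint meets no cluster.
      rebuild-summary : ∀ {m₂ c₂} → Upd m₁ m₂ j u c₂ →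
                        Good m₂ j u (cl e) (λ y → Bt′ y × y ≫ cl e ≡ u) →
                        Good m′ j H (fl e) (λ v → ∃ λ y → Bt′ y × y ≫ cl e ≡ v) → Out m₂ m′ j H (fl e) →
                        Good m′ (suc j) H e S′ × Out m m′ (suc j) H e
      rebuild-summary {m₂} U₂ gu gs out
        rewrite trans (out {suc j} {H} j<B (λ { (p , _) → 1+n≰n p }))
                  (trans (else U₂ {suc j} {H} j<B λ { (p , _) → 1+n≢n p }) (at U)) =
        ( n , gs , clusters )
        , λ p q → trans (out p (q ∘ foot-summary e))
                    (trans (else U₂ p λ { (refl , refl) → q (foot-cluster e uH (foot-self j u (cl e))) })
                           (else U p λ { (refl , refl) → q (foot-self (suc j) H e) }))
        where
        out′ : ∀ {v} → v ≫ fl e ≡ H → Good m₂ j v (cl e) (λ y → Bt′ y × y ≫ cl e ≡ v) →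
               Good m′ j v (cl e) (λ y → Bt′ y × y ≫ cl e ≡ v)
        out′ vH gv = Good-frame j gv
          (λ F → out (≤-<-trans (proj₁ F) j<B′) (λ F′ → summary-cluster e 2≤e 1≤H vH F′ F))
        clusters : ∀ v → v ≫ fl e ≡ H → Good m′ j v (cl e) (λ y → Bt′ y × y ≫ cl e ≡ v)
        clusters v vH with v ≟ u
        ... | yes refl = out′ vH gu
        ... | no v≢u = out′ vH
          (Good-frame j (below j<B′ U (Good-cong j (λ { (p , q) → f (v≢u ∘ trans (sym q)) p , q })
                                                   (λ { (p , q) → h (v≢u ∘ trans (sym q)) p , q })
                                                   (proj₂ (proj₂ g) v vH)))
            (λ F → else U₂ (≤-<-trans (proj₁ F) j<B′)
                     λ { (refl , refl) → cluster-cluster e 1≤H vH uH v≢u F (foot-self j u (cl e)) }))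

      summary-frame : ∀ {m₂ c₂} → Upd m₁ m₂ j u c₂ →
                      Good m₂ j H (fl e) (λ v → ∃ λ y → Bt y × y ≫ cl e ≡ v)
      summary-frame U₂ = Good-frame j (below j<B′ U (proj₁ (proj₂ g)))
        (λ F → else U₂ (≤-<-trans (proj₁ F) j<B′)
                 λ { (refl , refl) → summary-cluster e 2≤e 1≤H uH F (foot-self j u (cl e)) })

    cluster-frame : ∀ {m₁ u} → Upd m m₁ (suc j) H c → u ≫ fl e ≡ H →
                    Good m₁ j u (cl e) (λ y → Bt y × y ≫ cl e ≡ u)
    cluster-frame U uH = below j<B′ U (proj₂ (proj₂ g) _ uH)

  -- Mirrors the two tests of `swapᶜ`: the new pair, and the key displaced by it, which has to go
  -- further down. The tests alone do not exclude `swap-bad`, but the pair of a nonempty node does.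
  data Swap (l h x : ℕ) : ℕ → ℕ → ℕ → Set where
    swap-lo  : x < l → l < h → Swap l h x x h l
    swap-in  : l ≤ x → x < h → Swap l h x l h x
    swap-hi  : l ≤ x → h ≤ x → Swap l h x l (suc x) (pred h)
    swap-bad : x < l → h ≤ l → Swap l h x x (suc l) (pred h)

  -- Traces of the loop, one constructor for each way through its body. This separates two tasks:
  -- the program follows some trace, and every trace adds the key.
  data Ins : Cells → ℕ → ℕ → ℕ → ℕ → Cells → Set where
    ins-leaf : ∀ {m H e x} → Ins m 0 H e x m
    ins-new  : ∀ {m j H e x m′} → hi m (suc j) H ≡ 0 → Upd m m′ (suc j) H (x , suc x) →
               Ins m (suc j) H e x m′
    ins-stop : ∀ {m j H e x m′ l h y} → hi m (suc j) H ≢ 0 →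
               Swap (lo m (suc j) H) (hi m (suc j) H) x l h y → y ≡ l ⊎ suc y ≡ h →
               Upd m m′ (suc j) H (l , h) → Ins m (suc j) H e x m′
    ins-summary : ∀ {m j H e x m₁ m₂ m′ l h y} → hi m (suc j) H ≢ 0 →
               Swap (lo m (suc j) H) (hi m (suc j) H) x l h y → y ≢ l → suc y ≢ h →
               Upd m m₁ (suc j) H (l , h) → hi m₁ j (y ≫ cl e) ≡ 0 →
               Upd m₁ m₂ j (y ≫ cl e) (y , suc y) →
               Ins m₂ j H (fl e) (y ≫ cl e) m′ → Ins m (suc j) H e x m′
    ins-cluster : ∀ {m j H e x m₁ m′ l h y} → hi m (suc j) H ≢ 0 →
               Swap (lo m (suc j) H) (hi m (suc j) H) x l h y → y ≢ l → suc y ≢ h →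
               Upd m m₁ (suc j) H (l , h) → hi m₁ j (y ≫ cl e) ≢ 0 →
               Ins m₁ j (y ≫ cl e) (cl e) y m′ → Ins m (suc j) H e x m′

  private
    record Swapped (c : ℕ × ℕ) (S : Keys) (x : ℕ) (c′ : ℕ × ℕ) (y : ℕ) : Set where
      field
        node′ : Node c′ (S ∪ x)
        fwd   : ∀ {z} → Btw c′ (S ∪ x) z → Btw c S z ⊎ z ≡ y
        bwd   : ∀ {z} → Btw c S z → Btw c′ (S ∪ x) z
        key   : (S ∪ x) y
        fresh : ¬ Btw c S y
        l≤y   : proj₁ c′ ≤ y
        y<h   : y < proj₂ c′
    open Swapped

    swapped : ∀ {c S x l h y} → Node c S → proj₂ c ≢ 0 → ¬ S x →
              Swap (proj₁ c) (proj₂ c) x l h y → Swapped c S x (l , h) y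
    swapped {c} {S} {x} n h≢0 x∉ (swap-lo x<l l<h) = record
      { node′ = node (λ _ → inj₂ refl) (λ p → inj₁ (hi∈ n p))
                  (λ { (inj₁ p) → <⇒≤ (<-≤-trans x<l (lo≤ n p)) ; (inj₂ refl) → ≤-refl })
                  (λ { (inj₁ p) → <hi n p ; (inj₂ refl) → <-trans x<l l<h })
      ; fwd = fwd′
      ; bwd = λ (p , q , r) → inj₁ p , <-trans x<l q , r
      ; key = inj₁ (lo∈ n h≢0)
      ; fresh = λ (_ , p , _) → n≮n _ p
      ; l≤y = <⇒≤ x<l
      ; y<h = l<h }
      where
      fwd′ : ∀ {z} → Btw (x , proj₂ c) (S ∪ x) z → Btw c S z ⊎ z ≡ proj₁ c
      fwd′ (inj₂ refl , p , _) = contradiction p (n≮n _)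
      fwd′ (inj₁ p , q , r) with m≤n⇒m<n∨m≡n (lo≤ n p)
      ... | inj₁ l<z = inj₁ (p , l<z , r)
      ... | inj₂ refl = inj₂ refl
    swapped {c} {S} {x} n h≢0 x∉ (swap-in l≤x x<h) = record
      { node′ = node (λ p → inj₁ (lo∈ n p)) (λ p → inj₁ (hi∈ n p))
                  (λ { (inj₁ p) → lo≤ n p ; (inj₂ refl) → l≤x })
                  (λ { (inj₁ p) → <hi n p ; (inj₂ refl) → x<h })
      ; fwd = λ { (inj₁ p , q) → inj₁ (p , q) ; (inj₂ p , q) → inj₂ p }
      ; bwd = λ (p , q) → inj₁ p , q
      ; key = inj₂ refl
      ; fresh = λ (p , _) → x∉ p
      ; l≤y = l≤x
      ; y<h = x<h }
    swapped {c} {S} {x} n h≢0 x∉ (swap-hi l≤x h≤x) = record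
      { node′ = node (λ p → inj₁ (lo∈ n h≢0)) (λ p → inj₂ refl)
                  (λ { (inj₁ p) → lo≤ n p ; (inj₂ refl) → l≤x })
                  (λ { (inj₁ p) → <-≤-trans (<hi n p) (m≤n⇒m≤1+n h≤x) ; (inj₂ refl) → ≤-refl })
      ; fwd = fwd′
      ; bwd = λ (p , q , r) → inj₁ p , q , <-≤-trans r (m≤n⇒m≤1+n h≤x)
      ; key = inj₁ (hi∈ n h≢0)
      ; fresh = λ (_ , _ , p) → <⇒≢ p h≡
      ; l≤y = <⇒≤pred (<hi n (lo∈ n h≢0))
      ; y<h = ≤-trans (≤-reflexive h≡) (m≤n⇒m≤1+n h≤x) }
      where
      h≡ : suc (pred (proj₂ c)) ≡ proj₂ c
      h≡ = suc-pred (proj₂ c) {{≢-nonZero h≢0}}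
      fwd′ : ∀ {z} → Btw (proj₁ c , suc x) (S ∪ x) z → Btw c S z ⊎ z ≡ pred (proj₂ c)
      fwd′ (inj₂ refl , _ , p) = contradiction p (n≮n _)
      fwd′ (inj₁ p , q , r) with m≤n⇒m<n∨m≡n (<hi n p)
      ... | inj₁ z<h = inj₁ (p , q , z<h)
      ... | inj₂ sz≡h = inj₂ (cong pred sz≡h)
    swapped n h≢0 x∉ (swap-bad x<l h≤l) = contradiction (<hi n (lo∈ n h≢0)) (≤⇒≯ h≤l)

    suc<⇒<pred : ∀ {a c} → suc a < c → a < pred c
    suc<⇒<pred (s≤s p) = p

    half-≤ : ∀ {e j} → e + e ≤ 2 ^ suc j → e ≤ 2 ^ j
    half-≤ {e} {j} p = *-cancelˡ-≤ 2 (≤-trans (≤-reflexive (cong (e +_) (+-identityʳ e))) p)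

    cl-half : ∀ {e} j → 2 ≤ e → e + e ≤ 2 ^ suc j → cl e + cl e ≤ 2 ^ j
    cl-half zero 2≤e p = contradiction (≤-trans (+-mono-≤ 2≤e 2≤e) p) λ { (s≤s (s≤s ())) }
    cl-half {e} (suc j) 2≤e p =
      subst (cl e + cl e ≤_) (cong (2 ^ j +_) (sym (+-identityʳ (2 ^ j))))
        (cl-level {p = 2 ^ j} (≤-trans (half-≤ {j = suc j} p) (≤-reflexive (cong (2 ^ j +_) (+-identityʳ (2 ^ j))))))

    new-good : ∀ {m j H e x m′ S S′} → suc j < B → hi m (suc j) H ≡ 0 → Upd m m′ (suc j) H (x , suc x) →
               Good m (suc j) H e S → (∀ {z} → S′ z → z ≡ x) → S′ x →
               Good m′ (suc j) H e S′ × Out m m′ (suc j) H e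
    new-good {j = j} J<B h≡0 U g only x∈ = rebuild-here J<B g
      (node (λ _ → x∈) (λ _ → x∈) (λ p → ≤-reflexive (sym (only p))) (λ p → s≤s (≤-reflexive (only p))))
      U (λ (p , _) → contradiction p (Good-∅ (suc j) g h≡0))
        (λ (_ , p , q) → contradiction (<-≤-trans p (s≤s⁻¹ (<⇒≤ q))) (n≮n _))

    above-key : ∀ {e H z} → z ≫ e ≡ H → z ≫ cl e ≫ fl e ≡ H
    above-key {e} {z = z} p =
      trans (≫-≫ z (cl e) (fl e)) (trans (cong (z ≫_) (trans (+-comm (cl e) _) (fl+cl e))) p)

    module Descend {m : Cells} {j H e x : ℕ} {S : Keys} {l h y : ℕ} (g : Good m (suc j) H e S) (h≢0 : hi m (suc j) H ≢ 0) (x∉ : ¬ S x)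
      (under : ∀ {y} → S y → y ≫ e ≡ H) (xH : x ≫ e ≡ H)
      (sw : Swap (lo m (suc j) H) (hi m (suc j) H) x l h y) (y≢l : y ≢ l) (sy≢h : suc y ≢ h) where
      W = swapped (proj₁ g) h≢0 x∉ sw
      u = y ≫ cl e
      l<y : l < y
      l<y = ≤∧≢⇒< (l≤y W) (≢-sym y≢l)
      sy<h : suc y < h
      sy<h = ≤∧≢⇒< (y<h W) sy≢h
      under′ : ∀ {z} → (S ∪ x) z → z ≫ e ≡ H
      under′ (inj₁ p) = under p
      under′ (inj₂ refl) = xH
      h≢0′ : h ≢ 0
      h≢0′ p = contradiction (subst (suc y <_) p sy<h) λ ()
      -- The two extremes and y are three distinct keys below H, so neither half of the height is 0.
      2≤e : 2 ≤ e
      2≤e = span≥2 e l<y (suc<⇒<pred sy<h) (under′ (lo∈ (node′ W) h≢0′)) (under′ (key W)) (under′ (hi∈ (node′ W) h≢0′))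
      uH : u ≫ fl e ≡ H
      uH = above-key {e} (under′ (key W))
      other : ∀ {z} → z ≫ cl e ≢ u → Btw (l , h) (S ∪ x) z → Btw (m (suc j) H) S z
      other zu p with fwd W p
      ... | inj₁ q = q
      ... | inj₂ refl = contradiction refl zu

  -- `e + e ≤ 2 ^ J` says that J levels serve heights up to `2 ^ (J - 1)`. It excludes level 0,
  -- where no key can be stored, and it passes to both kinds of children because they have half the
  -- height.
  Ins-good : ∀ {m J H e x m′ S} → J < B → Ins m J H e x m′ → Good m J H e S → ¬ S x →
             (∀ {y} → S y → y ≫ e ≡ H) → x ≫ e ≡ H → 1 ≤ H → 1 ≤ e → e + e ≤ 2 ^ J →
             Good m′ J H e (S ∪ x) × Out m m′ J H e
  Ins-good {e = suc e} J<B ins-leaf g x∉ under xH 1≤H 1≤e (s≤s p) =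
    contradiction (≤-trans (m≤n+m (suc e) e) p) λ ()
  Ins-good {J = suc j} J<B (ins-new h≡0 U) g x∉ under xH 1≤H 1≤e lvl =
    new-good J<B h≡0 U g
      (λ { (inj₁ p) → contradiction p (Good-∅ (suc j) g h≡0) ; (inj₂ p) → p }) (inj₂ refl)
  Ins-good {m} {suc j} {x = x} {S = S} J<B (ins-stop {l = l} {h} {y} h≢0 sw stop U) g x∉ under xH 1≤H 1≤e lvl =
    rebuild-here J<B g (node′ W) U (bwd W) (λ p → back {C = S ∪ x} p (fwd W p) stop)
    where
    W = swapped (proj₁ g) h≢0 x∉ sw
    back : ∀ {z C} {P : Set} → Btw (l , h) C z → P ⊎ z ≡ y → y ≡ l ⊎ suc y ≡ h → P
    back p (inj₁ q) _ = q
    back (_ , p , _) (inj₂ refl) (inj₁ refl) = contradiction p (n≮n _)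
    back (_ , _ , p) (inj₂ refl) (inj₂ refl) = contradiction p (n≮n _)
  Ins-good {m} {suc j} {H} {e} {x} {m′} {S} J<B (ins-summary {l = l} {h} {y} h≢0 sw y≢l sy≢h U hu≡0 U₂ I) g x∉ under xH 1≤H 1≤e lvl =
    rebuild-summary J<B g (node′ W) U 2≤e 1≤H uH (λ _ → bwd W) other U₂ (gu j (<-trans (n<1+n j) J<B) U₂ gc hu≡0 lvl) gs (proj₂ IH)
    where
    open Descend {e = e} g h≢0 x∉ under xH sw y≢l sy≢h
    gc = cluster-frame {m′ = m} J<B g (node′ W) U uH
    gu : ∀ j′ {m₁ m₂ T} → j′ < B → Upd m₁ m₂ j′ u (y , suc y) → Good m₁ j′ u (cl e) T → hi m₁ j′ u ≡ 0 →
         e + e ≤ 2 ^ suc j′ →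
         Good m₂ j′ u (cl e) (λ z → Btw (l , h) (S ∪ x) z × z ≫ cl e ≡ u)
    gu zero _ U₂ g h≡0 lvl = contradiction (≤-trans (+-mono-≤ 2≤e 2≤e) lvl) λ { (s≤s (s≤s ())) }
    gu (suc i) i<B U₂ g h≡0 lvl = proj₁ (new-good i<B h≡0 U₂ g only ((key W , l<y , sy<h) , refl))
      where
      only : ∀ {z} → Btw (l , h) (S ∪ x) z × z ≫ cl e ≡ u → z ≡ y
      only (p , q) with fwd W p
      ... | inj₁ r = contradiction (r , q) (Good-∅ j gc hu≡0)
      ... | inj₂ r = r
    IH = Ins-good {S = λ v → ∃ λ z → Btw (m (suc j) H) S z × z ≫ cl e ≡ v} (<-trans (n<1+n j) J<B) I
           (summary-frame {m′ = m} J<B g (node′ W) U 2≤e 1≤H uH (λ _ → bwd W) other U₂)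
           (λ (z , p , q) → Good-∅ j gc hu≡0 (p , q))
           (λ { (z , p , refl) → above-key {e} (under (proj₁ p)) }) uH 1≤H (1≤fl 2≤e)
           (fl-level (half-≤ {j = j} lvl))
    gs : Good m′ j H (fl e) (λ v → ∃ λ z → Btw (l , h) (S ∪ x) z × z ≫ cl e ≡ v)
    gs = Good-cong j
      (λ { (inj₁ (z , p , q)) → z , bwd W p , q ; (inj₂ refl) → y , (key W , l<y , sy<h) , refl })
      (λ { (z , p , q) → [ (λ r → inj₁ (z , r , q)) , (λ { refl → inj₂ (sym q) }) ]′ (fwd W p) })
      (proj₁ IH)
  Ins-good {m} {suc j} {H} {e} {x} {m′} {S} J<B (ins-cluster {l = l} {h} {y} h≢0 sw y≢l sy≢h U hu≢0 I) g x∉ under xH 1≤H 1≤e lvl =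
    rebuild-cluster J<B g (node′ W) U 2≤e 1≤H uH (λ _ → bwd W) other
      (λ p q → _ , bwd W p , q) (λ p q → _ , proj₁ w , proj₂ w)
      (Good-cong j (λ { (inj₁ (p , q)) → bwd W p , q ; (inj₂ refl) → (key W , l<y , sy<h) , refl })
                   (λ { (p , q) → [ (λ r → inj₁ (r , q)) , inj₂ ]′ (fwd W p) }) (proj₁ IH))
      (proj₂ IH)
    where
    open Descend {e = e} g h≢0 x∉ under xH sw y≢l sy≢h
    gc = cluster-frame {m′ = m} J<B g (node′ W) U uH
    w = Good-lo∈ j gc hu≢0
    IH = Ins-good (<-trans (n<1+n j) J<B) I gc (λ (p , _) → fresh W p) proj₂ refl
           (≤-trans 1≤H (≤-trans (≤-reflexive (sym uH)) (≫≤ u (fl e)))) (1≤cl 1≤e) (cl-half j 2≤e lvl)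

  -- Deletion

  -- As the extremes are not stored further down, deleting one of them promotes an inner key, and it
  -- is this key that has to be deleted below in place of x.
  data Pick (m : Cells) (j H l h x : ℕ) : ℕ → ℕ → ℕ → Set where
    pick-lo : x ≡ l → hi m j H ≢ 0 →
              Pick m j H l h x (lo m j (lo m j H)) h (lo m j (lo m j H))
    pick-hi : x ≢ l → suc x ≡ h → hi m j H ≢ 0 →
              Pick m j H l h x l (suc (pred (hi m j (pred (hi m j H))))) (pred (hi m j (pred (hi m j H))))
    pick-in : x ≢ l → suc x ≢ h → Pick m j H l h x l h x

  -- Traces of the deletion loop. The key is assumed to be present, so a node with a single key is
  -- emptied without a comparison.
  data Del : Cells → ℕ → ℕ → ℕ → ℕ → Cells → Set where
    del-leaf : ∀ {m H e x} → Del m 0 H e x m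
    del-one  : ∀ {m j H e x m′} → suc (lo m (suc j) H) ≡ hi m (suc j) H →
               Upd m m′ (suc j) H (lo m (suc j) H , 0) → Del m (suc j) H e x m′
    del-lo   : ∀ {m j H e x m′} → suc (lo m (suc j) H) ≢ hi m (suc j) H → x ≡ lo m (suc j) H → hi m j H ≡ 0 →
               Upd m m′ (suc j) H (pred (hi m (suc j) H) , hi m (suc j) H) → Del m (suc j) H e x m′
    del-hi   : ∀ {m j H e x m′} → suc (lo m (suc j) H) ≢ hi m (suc j) H → x ≢ lo m (suc j) H →
               suc x ≡ hi m (suc j) H → hi m j H ≡ 0 →
               Upd m m′ (suc j) H (lo m (suc j) H , suc (lo m (suc j) H)) → Del m (suc j) H e x m′
    del-summary : ∀ {m j H e x m₁ m₂ m′ l h y} → suc (lo m (suc j) H) ≢ hi m (suc j) H →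
               Pick m j H (lo m (suc j) H) (hi m (suc j) H) x l h y →
               Upd m m₁ (suc j) H (l , h) → suc (lo m₁ j (y ≫ cl e)) ≡ hi m₁ j (y ≫ cl e) →
               Upd m₁ m₂ j (y ≫ cl e) (lo m₁ j (y ≫ cl e) , 0) →
               Del m₂ j H (fl e) (y ≫ cl e) m′ → Del m (suc j) H e x m′
    del-cluster : ∀ {m j H e x m₁ m′ l h y} → suc (lo m (suc j) H) ≢ hi m (suc j) H →
               Pick m j H (lo m (suc j) H) (hi m (suc j) H) x l h y →
               Upd m m₁ (suc j) H (l , h) → suc (lo m₁ j (y ≫ cl e)) ≢ hi m₁ j (y ≫ cl e) →
               Del m₁ j (y ≫ cl e) (cl e) y m′ → Del m (suc j) H e x m′

  private
    Good-suc-pred-hi : ∀ {m} J {H e S} → Good m J H e S → ∀ {y} → S y → suc (pred (hi m J H)) ≡ hi m J H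
    Good-suc-pred-hi {m} J {H} g p = suc-pred (hi m J H) {{≢-nonZero (Good-≢0 J g p)}}

    module _ {m : Cells} {j H e : ℕ} {S : Keys} (g : Good m (suc j) H e S) (under : ∀ {y} → S y → y ≫ e ≡ H)
             (h≢0 : hi m j H ≢ 0) where

      private
        s = lo m j H
        t = pred (hi m j H)
        s∈ = Good-lo∈ j (proj₁ (proj₂ g)) h≢0
        t∈ = Good-hi∈ j (proj₁ (proj₂ g)) h≢0
        member : ∀ {v} → (∃ λ y → Btw (m (suc j) H) S y × y ≫ cl e ≡ v) → v ≫ fl e ≡ H
        member (y , p , refl) = above-key {e} (under (proj₁ p))
        gs = proj₂ (proj₂ g) s (member s∈)
        gt = proj₂ (proj₂ g) t (member t∈)

      -- Clusters are consecutive intervals of keys, so the cluster that holds the least inner key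
      -- is the minimum of the summary.
      inner-min : Btw (m (suc j) H) S (lo m j s) × (∀ {y} → Btw (m (suc j) H) S y → lo m j s ≤ y)
      inner-min = proj₁ y* , least
        where
        y* = Good-lo∈ j gs (Good-≢0 j gs (proj₂ s∈))
        least : ∀ {y} → Btw (m (suc j) H) S y → lo m j s ≤ y
        least {y} p with m≤n⇒m<n∨m≡n (Good-lo≤ j (proj₁ (proj₂ g)) (y , p , refl))
        ... | inj₂ s≡ = Good-lo≤ j gs (p , sym s≡)
        ... | inj₁ s< = <⇒≤ (≫-cancel-< (cl e) (subst (_< y ≫ cl e) (sym (proj₂ y*)) s<))

      inner-max : Btw (m (suc j) H) S (pred (hi m j t)) × (∀ {y} → Btw (m (suc j) H) S y → y ≤ pred (hi m j t))
      inner-max = proj₁ y* , greatest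
        where
        y* = Good-hi∈ j gt (Good-≢0 j gt (proj₂ t∈))
        greatest : ∀ {y} → Btw (m (suc j) H) S y → y ≤ pred (hi m j t)
        greatest {y} p with m≤n⇒m<n∨m≡n (<⇒≤pred (Good-<hi j (proj₁ (proj₂ g)) (y , p , refl)))
        ... | inj₂ ≡t = <⇒≤pred (Good-<hi j gt (p , ≡t))
        ... | inj₁ <t = <⇒≤ (≫-cancel-< (cl e) (subst (y ≫ cl e <_) (sym (proj₂ y*)) <t))

    record Picked (c : ℕ × ℕ) (S : Keys) (x : ℕ) (c′ : ℕ × ℕ) (y : ℕ) : Set where
      field
        node″ : Node c′ (S ∖ x)
        fwd″  : ∀ {z} → Btw c′ (S ∖ x) z → Btw c S z × z ≢ y
        bwd″  : ∀ {z} → Btw c S z → z ≢ y → Btw c′ (S ∖ x) z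
        inner : Btw c S y

    module _ {m : Cells} {j H e x : ℕ} {S : Keys} (g : Good m (suc j) H e S) (x∈ : S x) (under : ∀ {y} → S y → y ≫ e ≡ H)
             (l≢h : suc (lo m (suc j) H) ≢ hi m (suc j) H) where
      private
        c = m (suc j) H
        n = proj₁ g
        h≢0 = Good-≢0 (suc j) g x∈
        h≡ : suc (pred (proj₂ c)) ≡ proj₂ c
        h≡ = Good-suc-pred-hi (suc j) g x∈
        l<ph : proj₁ c < pred (proj₂ c)
        l<ph = suc<⇒<pred (≤∧≢⇒< (<hi n (lo∈ n h≢0)) l≢h)
        split : ∀ {z} → S z → z ≢ proj₁ c → suc z ≢ proj₂ c → Btw c S z
        split p q r = p , ≤∧≢⇒< (lo≤ n p) (≢-sym q) , ≤∧≢⇒< (<hi n p) r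

      picked : ∀ {l h y} → Pick m j H (proj₁ c) (proj₂ c) x l h y → Picked c S x (l , h) y
      picked (pick-lo refl s≢0) = record
        { node″ = node (λ _ → proj₁ y∈ , ≢-sym (<⇒≢ (proj₁ (proj₂ y∈))))
                    (λ p → hi∈ n p , ≢-sym (<⇒≢ l<ph)) least′ (λ (p , _) → <hi n p)
        ; fwd″ = λ { ((p , q) , r , t) → (p , <-trans (proj₁ (proj₂ y∈)) r , t) , ≢-sym (<⇒≢ r) }
        ; bwd″ = λ { (p , q , r) z≢y → (p , ≢-sym (<⇒≢ q)) , ≤∧≢⇒< (least (p , q , r)) (≢-sym z≢y) , r }
        ; inner = y∈ }
        where
        y∈ = proj₁ (inner-min g under s≢0)
        least : ∀ {z} → Btw c S z → _ ≤ z
        least = proj₂ (inner-min g under s≢0)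
        least′ : ∀ {z} → (S ∖ proj₁ c) z → lo m j (lo m j H) ≤ z
        least′ {z} (p , q) with suc z ≟ proj₂ c
        ... | yes r = ≤-trans (n≤1+n _) (s≤s⁻¹ (≤-trans (proj₂ (proj₂ y∈)) (≤-reflexive (sym r))))
        ... | no r = least (split p q r)
      picked (pick-hi x≢l x≡h s≢0) = record
        { node″ = node (λ _ → lo∈ n h≢0 , ≢-sym x≢l)
                    (λ _ → proj₁ y∈ , λ y≡x → <⇒≢ (proj₂ (proj₂ y∈)) (trans (cong suc y≡x) x≡h))
                    (λ (p , _) → lo≤ n p) greatest′
        ; fwd″ = λ { ((p , q) , r , t) → (p , r , <-≤-trans t (<⇒≤ (proj₂ (proj₂ y∈)))) , <⇒≢ (s≤s⁻¹ t) }
        ; bwd″ = λ { (p , q , r) z≢y → (p , λ z≡x → <⇒≢ r (trans (cong suc z≡x) x≡h)) , q , s≤s (≤∧≢⇒< (greatest (p , q , r)) z≢y) }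
        ; inner = y∈ }
        where
        y∈ = proj₁ (inner-max g under s≢0)
        greatest : ∀ {z} → Btw c S z → z ≤ _
        greatest = proj₂ (inner-max g under s≢0)
        greatest′ : ∀ {z} → (S ∖ x) z → z < suc (pred (hi m j (pred (hi m j H))))
        greatest′ {z} (p , q) with z ≟ proj₁ c
        ... | yes refl = <-trans (proj₁ (proj₂ y∈)) (n<1+n _)
        ... | no r = s≤s (greatest (split p r λ z≡h → q (suc-injective (trans z≡h (sym x≡h)))))
      picked (pick-in x≢l x≢h) = record
        { node″ = node (λ p → lo∈ n p , ≢-sym x≢l)
                    (λ p → hi∈ n p , λ q → x≢h (trans (cong suc (sym q)) h≡))
                    (λ (p , _) → lo≤ n p) (λ (p , _) → <hi n p)
        ; fwd″ = λ { ((p , q) , r) → (p , r) , q }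
        ; bwd″ = λ { (p , r) q → (p , q) , r }
        ; inner = split x∈ x≢l x≢h }

      module Delve {l h y : ℕ} (k : Pick m j H (proj₁ c) (proj₂ c) x l h y) (1≤H : 1 ≤ H) where
        open Picked (picked k) public
        u = y ≫ cl e
        y∈ = proj₁ inner
        2≤e : 2 ≤ e
        2≤e = span≥2 e (proj₁ (proj₂ inner)) (suc<⇒<pred (proj₂ (proj₂ inner)))
                (under (lo∈ n h≢0)) (under y∈) (under (hi∈ n h≢0))
        uH : u ≫ fl e ≡ H
        uH = above-key {e} (under y∈)
        off : ∀ {z} → z ≫ cl e ≢ u → Btw c S z → Btw (l , h) (S ∖ x) z
        off q p = bwd″ p (q ∘ cong (_≫ cl e))
        on : ∀ {z} → z ≫ cl e ≢ u → Btw (l , h) (S ∖ x) z → Btw c S z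
        on _ p = proj₁ (fwd″ p)
        1≤u : 1 ≤ u
        1≤u = ≤-trans 1≤H (≤-trans (≤-reflexive (sym uH)) (≫≤ u (fl e)))

      no-inner : hi m j H ≡ 0 → ∀ {z} → ¬ Btw c S z
      no-inner s≡0 {z} p = Good-∅ j (proj₁ (proj₂ g)) s≡0 (z , p , refl)

      del-lo-node : x ≡ lo m (suc j) H → hi m j H ≡ 0 → Node (pred (proj₂ c) , proj₂ c) (S ∖ x)
      del-lo-node refl s≡0 = node max∈ max∈ (λ { (p , q) → ≤-reflexive (sym (only p q)) }) (λ (p , _) → <hi n p)
        where
        max∈ : proj₂ c ≢ 0 → (S ∖ x) (pred (proj₂ c))
        max∈ p = hi∈ n p , ≢-sym (<⇒≢ l<ph)
        only : ∀ {z} → S z → z ≢ proj₁ c → z ≡ pred (proj₂ c)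
        only {z} p q with suc z ≟ proj₂ c
        ... | yes r = cong pred r
        ... | no r = contradiction (split p q r) (no-inner s≡0)

      del-hi-node : x ≢ lo m (suc j) H → suc x ≡ hi m (suc j) H → hi m j H ≡ 0 → Node (proj₁ c , suc (proj₁ c)) (S ∖ x)
      del-hi-node x≢l x≡h s≡0 = node (λ _ → lo∈ n h≢0 , ≢-sym x≢l) (λ _ → lo∈ n h≢0 , ≢-sym x≢l)
          (λ (p , _) → lo≤ n p) (λ { (p , q) → s≤s (≤-reflexive (only p q)) })
        where
        only : ∀ {z} → S z → z ≢ x → z ≡ proj₁ c
        only {z} p q with z ≟ proj₁ c
        ... | yes r = r
        ... | no r = contradiction (split p r λ z≡h → q (suc-injective (trans z≡h (sym x≡h)))) (no-inner s≡0)

    one-good : ∀ {m j H e m′ S S′} → suc j < B → suc (lo m (suc j) H) ≡ hi m (suc j) H →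
               Upd m m′ (suc j) H (lo m (suc j) H , 0) → Good m (suc j) H e S → (∀ {z} → ¬ S′ z) →
               Good m′ (suc j) H e S′ × Out m m′ (suc j) H e
    one-good J<B l≡h U g none = rebuild-here J<B g
      (node (contradiction refl) (contradiction refl) (λ p → contradiction p none) (λ p → contradiction p none)) U
      (λ { (_ , p , q) → contradiction (<-≤-trans p (s≤s⁻¹ (≤-trans (<⇒≤ q) (≤-reflexive (sym l≡h))))) (n≮n _) })
      (λ { (p , _) → contradiction p none })

    one-only : ∀ {m} J {H e S} → suc (lo m J H) ≡ hi m J H → Good m J H e S → ∀ {y z} → S y → S z → y ≡ z
    one-only {m} J {H} l≡h g p q = trans (is-lo p) (sym (is-lo q))
      where
      is-lo : ∀ {y} → _ → y ≡ lo m J H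
      is-lo p = ≤-antisym (s≤s⁻¹ (≤-trans (Good-<hi J g p) (≤-reflexive (sym l≡h)))) (Good-lo≤ J g p)

    -- A cluster that is not a singleton survives the deletion, so the summary need not be told.
    another : ∀ {m} J {H e S} → suc (lo m J H) ≢ hi m J H → Good m J H e S → ∀ {y} → S y → ∃ λ z → S z × z ≢ y
    another {m} J {H} l≢h g {y} p with lo m J H ≟ y
    ... | no q = lo m J H , Good-lo∈ J g (Good-≢0 J g p) , q
    ... | yes q = pred (hi m J H) , Good-hi∈ J g (Good-≢0 J g p) ,
      λ r → l≢h (trans (cong suc (trans q (sym r))) (Good-suc-pred-hi J g p))

  Del-good : ∀ {m J H e x m′ S} → J < B → Del m J H e x m′ → Good m J H e S → S x →
             (∀ {y} → S y → y ≫ e ≡ H) → 1 ≤ H → 1 ≤ e →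
             Good m′ J H e (S ∖ x) × Out m m′ J H e
  Del-good J<B del-leaf g x∈ under 1≤H 1≤e = contradiction x∈ (proj₁ g _)
  Del-good {J = suc j} {H} {e} {x} J<B (del-one l≡h U) g x∈ under 1≤H 1≤e =
    one-good J<B l≡h U g λ (p , q) → q (one-only (suc j) {H} {e} l≡h g p x∈)
  Del-good {J = suc j} J<B (del-lo l≢h x≡l s≡0 U) g x∈ under 1≤H 1≤e =
    rebuild-here J<B g (del-lo-node g x∈ under l≢h x≡l s≡0) U
      (λ p → contradiction p (no-inner g x∈ under l≢h s≡0))
      (λ { (_ , p , q) → contradiction (<-≤-trans p (s≤s⁻¹ (≤-trans (<⇒≤ q) (≤-reflexive (sym (Good-suc-pred-hi (suc j) g x∈)))))) (n≮n _) })
  Del-good {J = suc j} J<B (del-hi l≢h x≢l x≡h s≡0 U) g x∈ under 1≤H 1≤e =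
    rebuild-here J<B g (del-hi-node g x∈ under l≢h x≢l x≡h s≡0) U
      (λ p → contradiction p (no-inner g x∈ under l≢h s≡0))
      (λ { (_ , p , q) → contradiction (<-≤-trans p (s≤s⁻¹ (<⇒≤ q))) (n≮n _) })
  Del-good {m} {suc j} {H} {e} {x} {m′} {S} J<B (del-summary {l = l} {h} {y} l≢h k U u1 U₂ D) g x∈ under 1≤H 1≤e =
    rebuild-summary J<B g node″ U 2≤e 1≤H uH off on U₂ (gu j (<-trans (n<1+n j) J<B) U₂ gc u1)
      (Good-cong j
        (λ { ((z , p , q) , r) → z , bwd″ p (λ { refl → r (sym q) }) , q })
        (λ { (z , p , q) → (z , proj₁ (fwd″ p) , q) ,
                λ { refl → proj₂ (fwd″ p) (one-only j u1 gc (proj₁ (fwd″ p) , q) (inner , refl)) } })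
        (proj₁ IH))
      (proj₂ IH)
    where
    open Delve {e = e} g x∈ under l≢h k 1≤H
    gc = cluster-frame {m′ = m} J<B g node″ U uH
    gu : ∀ j′ {m₁ m₂} → j′ < B → Upd m₁ m₂ j′ u (lo m₁ j′ u , 0) →
         Good m₁ j′ u (cl e) (λ z → Btw (m (suc j) H) S z × z ≫ cl e ≡ u) → suc (lo m₁ j′ u) ≡ hi m₁ j′ u →
         Good m₂ j′ u (cl e) (λ z → Btw (l , h) (S ∖ x) z × z ≫ cl e ≡ u)
    gu zero _ _ g _ = contradiction (inner , refl) (proj₁ g y)
    gu (suc i) i<B U₂ g u1 = proj₁ (one-good i<B u1 U₂ g λ { (p , q) →
      proj₂ (fwd″ p) (one-only (suc i) u1 g (proj₁ (fwd″ p) , q) (inner , refl)) })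
    IH = Del-good {S = λ v → ∃ λ z → Btw (m (suc j) H) S z × z ≫ cl e ≡ v} (<-trans (n<1+n j) J<B) D
           (summary-frame {m′ = m} J<B g node″ U 2≤e 1≤H uH off on U₂) (y , inner , refl)
           (λ { (z , p , refl) → above-key {e} (under (proj₁ p)) }) 1≤H (1≤fl 2≤e)
  Del-good {m} {suc j} {H} {e} {x} {m′} {S} J<B (del-cluster {l = l} {h} {y} l≢h k U u≢1 D) g x∈ under 1≤H 1≤e =
    rebuild-cluster J<B g node″ U 2≤e 1≤H uH off on
      (λ _ _ → w , bwd″ (proj₁ (proj₁ (proj₂ W))) (proj₂ (proj₂ W)) , proj₂ (proj₁ (proj₂ W)))
      (λ p q → _ , proj₁ (fwd″ p) , q)
      (Good-cong j (λ { ((p , q) , r) → bwd″ p r , q }) (λ { (p , q) → (proj₁ (fwd″ p) , q) , proj₂ (fwd″ p) }) (proj₁ IH))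
      (proj₂ IH)
    where
    open Delve {e = e} g x∈ under l≢h k 1≤H
    gc = cluster-frame {m′ = m} J<B g node″ U uH
    W = another j u≢1 gc (inner , refl)
    w = proj₁ W
    IH = Del-good (<-trans (n<1+n j) J<B) D gc (inner , refl) proj₂ 1≤u (1≤cl 1≤e)

  -- Successors

  -- Comparing x with the maximum of a child tells beforehand whether the search in it succeeds, so
  -- there is one recursive call. Only the turn into the summary leaves work to be done after that
  -- call.
  succᵛ : Cells → ℕ → ℕ → ℕ → ℕ → ℕ
  succᵛ m zero    H e x = 0
  succᵛ m (suc j) H e x =
    if x <ᵇ lo m (suc j) H then lo m (suc j) H
    else if suc x <ᵇ hi m j (x ≫ cl e) then succᵛ m j (x ≫ cl e) (cl e) x
    else if suc (x ≫ cl e) <ᵇ hi m j H then lo m j (succᵛ m j H (fl e) (x ≫ cl e))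
    else pred (hi m (suc j) H)

  succᵛ-good : ∀ {m} J {H e x S} → Good m J H e S → (∀ {y} → S y → y ≫ e ≡ H) → x ≫ e ≡ H →
               suc x < hi m J H → let y = succᵛ m J H e x in
               S y × x < y × (∀ {z} → S z → x < z → y ≤ z)
  succᵛ-good zero g under xH x<h = contradiction (subst (_ <_) (proj₂ g) x<h) λ ()
  succᵛ-good {m} (suc j) {H} {e} {x} {S} g under xH x<h with x <? lo m (suc j) H
  ... | yes x<l rewrite <⇒<ᵇ≡ x<l = lo∈ (proj₁ g) (m<n⇒n≢0 x<h) , x<l , λ p _ → lo≤ (proj₁ g) p
  ... | no x≮l rewrite ≥⇒<ᵇ≡ (≮⇒≥ x≮l) with suc x <? hi m j (x ≫ cl e)
  ...   | yes x<u rewrite <⇒<ᵇ≡ x<u =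
    proj₁ (proj₁ (proj₁ ih)) , proj₁ (proj₂ ih) , least
    where
    gu = proj₂ (proj₂ g) (x ≫ cl e) (above-key {e} xH)
    ih = succᵛ-good j gu proj₂ refl x<u
    y = succᵛ m j (x ≫ cl e) (cl e) x
    least : ∀ {z} → S z → x < z → y ≤ z
    least {z} p x<z with suc z ≟ hi m (suc j) H
    ... | yes q = s≤s⁻¹ (≤-trans (<⇒≤ (proj₂ (proj₂ (proj₁ (proj₁ ih))))) (≤-reflexive (sym q)))
    ... | no q with m≤n⇒m<n∨m≡n (≫-monoˡ (cl e) (<⇒≤ x<z))
    ...   | inj₂ r = proj₂ (proj₂ ih) ((p , ≤-<-trans (≮⇒≥ x≮l) x<z , ≤∧≢⇒< (<hi (proj₁ g) p) q) , sym r) x<z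
    ...   | inj₁ r = <⇒≤ (≫-cancel-< (cl e) (subst (_< z ≫ cl e) (sym (proj₂ (proj₁ ih))) r))
  ...   | no x≮u rewrite ≥⇒<ᵇ≡ (≮⇒≥ x≮u) with suc (x ≫ cl e) <? hi m j H
  ...     | yes u<h rewrite <⇒<ᵇ≡ u<h =
    proj₁ (proj₁ y∈) , ≫-cancel-< (cl e) (subst (x ≫ cl e <_) (sym (proj₂ y∈)) (proj₁ (proj₂ ih))) , least
    where
    u = x ≫ cl e
    gx = proj₂ (proj₂ g) u (above-key {e} xH)
    gs = proj₁ (proj₂ g)
    ih = succᵛ-good j gs (λ { (z , p , refl) → above-key {e} (under (proj₁ p)) }) (above-key {e} xH) u<h
    v = succᵛ m j H (fl e) u
    v∈ = proj₁ ih
    gv = proj₂ (proj₂ g) v (trans (cong (_≫ fl e) (sym (proj₂ (proj₂ v∈)))) (above-key {e} (under (proj₁ (proj₁ (proj₂ v∈))))))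
    y∈ = Good-lo∈ j gv (Good-≢0 j gv (proj₂ v∈))
    y = lo m j v
    least : ∀ {z} → S z → x < z → y ≤ z
    least {z} p x<z with suc z ≟ hi m (suc j) H
    ... | yes q = s≤s⁻¹ (≤-trans (<⇒≤ (proj₂ (proj₂ (proj₁ y∈)))) (≤-reflexive (sym q)))
    ... | no q = go (m≤n⇒m<n∨m≡n (≫-monoˡ (cl e) (<⇒≤ x<z)))
      where
      z∈ : Btw (m (suc j) H) S z
      z∈ = p , ≤-<-trans (≮⇒≥ x≮l) x<z , ≤∧≢⇒< (<hi (proj₁ g) p) q
      go : x ≫ cl e < z ≫ cl e ⊎ x ≫ cl e ≡ z ≫ cl e → y ≤ z
      go (inj₂ r) = contradiction (≤-trans (s≤s x<z) (Good-<hi j gx (z∈ , sym r))) x≮u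
      go (inj₁ r) with m≤n⇒m<n∨m≡n (proj₂ (proj₂ ih) (z , z∈ , refl) r)
      ... | inj₂ v≡ = Good-lo≤ j gv (z∈ , sym v≡)
      ... | inj₁ v< = <⇒≤ (≫-cancel-< (cl e) (subst (_< z ≫ cl e) (sym (proj₂ y∈)) v<))
  -- Neither the cluster of x nor a later one has an inner key beyond x, so the maximum is the only
  -- candidate left.
  ...     | no u≮h rewrite ≥⇒<ᵇ≡ (≮⇒≥ u≮h) =
    hi∈ (proj₁ g) h≢0 , suc<⇒<pred x<h , least
    where
    h≢0 = m<n⇒n≢0 x<h
    u = x ≫ cl e
    gx = proj₂ (proj₂ g) u (above-key {e} xH)
    least : ∀ {z} → S z → x < z → pred (hi m (suc j) H) ≤ z
    least {z} p x<z with suc z ≟ hi m (suc j) H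
    ... | yes q = ≤-reflexive (cong pred (sym q))
    ... | no q = go (m≤n⇒m<n∨m≡n (≫-monoˡ (cl e) (<⇒≤ x<z)))
      where
      z∈ : Btw (m (suc j) H) S z
      z∈ = p , ≤-<-trans (≮⇒≥ x≮l) x<z , ≤∧≢⇒< (<hi (proj₁ g) p) q
      go : x ≫ cl e < z ≫ cl e ⊎ x ≫ cl e ≡ z ≫ cl e → _
      go (inj₂ r) = contradiction (≤-trans (s≤s x<z) (Good-<hi j gx (z∈ , sym r))) x≮u
      go (inj₁ r) = contradiction (≤-trans (s≤s r) (Good-<hi j (proj₁ (proj₂ g)) (z , z∈ , refl))) u≮h

-- Programs for the tree operations

pair-injective : ∀ {w a a′ z z′} → z < w → z′ < w → a * w + z ≡ a′ * w + z′ → a ≡ a′ × z ≡ z′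
pair-injective {w} {a} {a′} {z} {z′} z<w z′<w p with <-cmp a a′
... | tri≈ _ refl _ = refl , +-cancelˡ-≡ (a * w) z z′ p
... | tri< a<a′ _ _ = contradiction p (<⇒≢ (pair-< a<a′ z<w))
  where
  pair-< : ∀ {a a′ z z′} → a < a′ → z < w → a * w + z < a′ * w + z′
  pair-< {a} {a′} {z} {z′} a<a′ z<w = begin-strict
    a * w + z   <⟨ +-monoʳ-< (a * w) z<w ⟩
    a * w + w   ≡⟨ +-comm (a * w) w ⟩
    suc a * w   ≤⟨ *-monoˡ-≤ w a<a′ ⟩
    a′ * w      ≤⟨ m≤m+n (a′ * w) z′ ⟩
    a′ * w + z′ ∎
    where open ≤-Reasoning
... | tri> _ _ a′<a = contradiction (sym p) (<⇒≢ (begin-strict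
    a′ * w + z′ <⟨ +-monoʳ-< (a′ * w) z′<w ⟩
    a′ * w + w  ≡⟨ +-comm (a′ * w) w ⟩
    suc a′ * w  ≤⟨ *-monoˡ-≤ w a′<a ⟩
    a * w       ≤⟨ m≤m+n (a * w) z ⟩
    a * w + z   ∎))
    where open ≤-Reasoning

positive≤ : ∀ x → (if 0 <ᵇ x then 1 else 0) ≤ x
positive≤ zero    = z≤n
positive≤ (suc x) = s≤s z≤n

∸-positive : ∀ x → x ∸ (if 0 <ᵇ x then 1 else 0) ≡ pred x
∸-positive zero    = refl
∸-positive (suc x) = refl

-- Machine subtraction wraps around. Subtracting the truth value of `0 < e` gives a predecessor that
-- is also correct at 0.
succᵉ predᵉ : Expr → Expr
succᵉ e = op add (lit 1) e
predᵉ e = op sub e (op lt (lit 0) e)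

flᵉ clᵉ : Expr → Expr
flᵉ e = op div e (lit 2)
clᵉ e = op div (op add e (lit 1)) (lit 2)

-- The parameters n, k, `2 ^ k`, h + 1, h + 2, ℓ, `2 ^ ℓ` and `width`. They are written during
-- initialization; from then on `params` reads them as constants.
rn rk rK rJ rB rl rL rW : ℕ
rn = 2
rk = 3
rK = 4
rJ = 5
rB = 6
rl = 7
rL = 8
rW = 9

-- In this order: the base address of the tree; the key; level, height and vertex of the current
-- node, and its two entries; the vertex of a child; the address of the node; a result or scratch
-- value; a flag for going on; the path; the address of a child, and its second entry.
β̂ x̂ Ĵ ê Ĥ lô hî û Â ŷ gô P̂ Ĉ ŝ : ℕ
β̂ = 30
x̂ = 31
Ĵ = 32
ê = 33
Ĥ = 34
lô = 35
hî = 36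
û = 37
Â = 38
ŷ = 39
gô = 40
P̂ = 41
Ĉ = 42
ŝ = 43

cellᵉ : ℕ → Expr
cellᵉ v = op add (reg β̂) (op mul (lit 2) (op add (op mul (reg v) (reg rB)) (reg Ĵ)))

load put stop swapᶜ newᶜ : Cmd
load = Â := cellᵉ Ĥ ⨾ lô := mem[ reg Â ] ⨾ hî := mem[ succᵉ (reg Â) ]
put  = mem[ reg Â ]:= reg lô ⨾ mem[ succᵉ (reg Â) ]:= reg hî
stop = Ĵ := lit 0
newᶜ = mem[ reg Â ]:= reg x̂ ⨾ mem[ succᵉ (reg Â) ]:= succᵉ (reg x̂) ⨾ stop
swapᶜ = ite (op lt (reg x̂) (reg lô)) (ŷ := reg lô ⨾ lô := reg x̂ ⨾ x̂ := reg ŷ) skip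
      ⨾ ite (op lt (reg x̂) (reg hî)) skip (ŷ := predᵉ (reg hî) ⨾ hî := succᵉ (reg x̂) ⨾ x̂ := reg ŷ)

-- Descends to the cluster of the key, or to the summary if that cluster has
-- just been created.
insDown insBody insLoop : Cmd
insDown = (Ĵ := op sub (reg Ĵ) (lit 1) ⨾ û := op shr (reg x̂) (clᵉ (reg ê)))
        ⨾ Ĉ := cellᵉ û
        ⨾ ite (op eq mem[ succᵉ (reg Ĉ) ] (lit 0))
            (mem[ reg Ĉ ]:= reg x̂ ⨾ mem[ succᵉ (reg Ĉ) ]:= succᵉ (reg x̂) ⨾ x̂ := reg û ⨾ ê := flᵉ (reg ê))
            (Ĥ := reg û ⨾ ê := clᵉ (reg ê))
insBody = load ⨾ ite (op eq (reg hî) (lit 0)) newᶜ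
            (swapᶜ ⨾ put ⨾ ite (op eq (reg x̂) (reg lô)) stop (ite (op eq (succᵉ (reg x̂)) (reg hî)) stop insDown))
insLoop = while (reg Ĵ) insBody

delChoose delDown delBody delLoop : Cmd
delChoose =
  ite (op eq (reg x̂) (reg lô))
    (ite (op eq (reg ŝ) (lit 0)) (lô := predᵉ (reg hî) ⨾ gô := lit 0)
      (û := mem[ reg Ĉ ] ⨾ Ĉ := cellᵉ û ⨾ lô := mem[ reg Ĉ ] ⨾ x̂ := reg lô))
    (ite (op eq (succᵉ (reg x̂)) (reg hî))
      (ite (op eq (reg ŝ) (lit 0)) (hî := succᵉ (reg lô) ⨾ gô := lit 0)
        (û := predᵉ (reg ŝ) ⨾ Ĉ := cellᵉ û ⨾ ŷ := mem[ succᵉ (reg Ĉ) ] ⨾ x̂ := predᵉ (reg ŷ) ⨾ hî := succᵉ (reg x̂)))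
      skip)
delDown = û := op shr (reg x̂) (clᵉ (reg ê))
        ⨾ Ĉ := cellᵉ û ⨾ lô := mem[ reg Ĉ ] ⨾ hî := mem[ succᵉ (reg Ĉ) ]
        ⨾ ite (op eq (succᵉ (reg lô)) (reg hî))
            (mem[ reg Ĉ ]:= reg lô ⨾ mem[ succᵉ (reg Ĉ) ]:= lit 0 ⨾ x̂ := reg û ⨾ ê := flᵉ (reg ê))
            (Ĥ := reg û ⨾ ê := clᵉ (reg ê))
delBody = load ⨾ ite (op eq (succᵉ (reg lô)) (reg hî))
            (mem[ reg Â ]:= reg lô ⨾ mem[ succᵉ (reg Â) ]:= lit 0 ⨾ stop)
            ((Ĵ := op sub (reg Ĵ) (lit 1) ⨾ Ĉ := cellᵉ Ĥ ⨾ ŝ := mem[ succᵉ (reg Ĉ) ] ⨾ gô := lit 1)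
             ⨾ delChoose ⨾ put ⨾ ite (reg gô) delDown stop)
delLoop = while (reg Ĵ) delBody

-- P̂ records the turns taken on the way down, a bit 1 for each summary.
summaryTurn clusterTurn succBody succLoop ascBody ascLoop : Cmd
summaryTurn =
  (Ĉ := cellᵉ Ĥ ⨾ ŝ := mem[ succᵉ (reg Ĉ) ]) ⨾
  ite (op lt (succᵉ (reg û)) (reg ŝ))
    (x̂ := reg û ⨾ ê := flᵉ (reg ê) ⨾ P̂ := succᵉ (op mul (reg P̂) (lit 2)))
    (ŷ := predᵉ (reg hî) ⨾ gô := lit 0 ⨾ Ĵ := succᵉ (reg Ĵ))
clusterTurn =
  (Ĉ := cellᵉ û ⨾ ŝ := mem[ succᵉ (reg Ĉ) ]) ⨾
  ite (op lt (succᵉ (reg x̂)) (reg ŝ))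
    (Ĥ := reg û ⨾ ê := clᵉ (reg ê) ⨾ P̂ := op mul (reg P̂) (lit 2))
    summaryTurn
succBody =
  load ⨾ ite (op lt (reg x̂) (reg lô)) (ŷ := reg lô ⨾ gô := lit 0)
    ((Ĵ := op sub (reg Ĵ) (lit 1) ⨾ û := op shr (reg x̂) (clᵉ (reg ê))) ⨾ clusterTurn)
succLoop = while (op mul (reg gô) (reg Ĵ)) succBody
ascBody = ite (op mod (reg P̂) (lit 2)) (Ĉ := cellᵉ ŷ ⨾ ŷ := mem[ reg Ĉ ]) skip
        ⨾ P̂ := op div (reg P̂) (lit 2) ⨾ Ĵ := succᵉ (reg Ĵ)
ascLoop = while (op lt (reg Ĵ) (reg rJ)) ascBody

-- Words of one tree: a pair for each vertex code from 0 to `2 ^ (ℓ + 1)` and each of the h + 2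
-- levels.
size : ℕ → ℕ → ℕ
size h ℓ = 2 * (suc (2 ^ ℓ + 2 ^ ℓ) * suc (suc h))

opaque
  -- A zone of `width` cells holds the subset table, the text, a table of n + 2 successors or a
  -- tree. Zone numbers stay below three times `width`, so `limit` bounds all addresses; it serves
  -- as the bound X on registers.
  width limit : ℕ → ℕ → ℕ → ℕ → ℕ
  width n k h ℓ = 2 ^ k + n + size h ℓ + 64
  limit n k h ℓ = 4 * (width n k h ℓ * width n k h ℓ)

  width-def : ∀ n k h ℓ → 2 ^ k + n + size h ℓ + 64 ≡ width n k h ℓ
  width-def n k h ℓ = refl

  limit-def : ∀ n k h ℓ → 4 * (width n k h ℓ * width n k h ℓ) ≡ limit n k h ℓ
  limit-def n k h ℓ = refl

≤width : ∀ {x} n k h ℓ → x ≤ 2 ^ k + n + size h ℓ + 64 → x ≤ width n k h ℓ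
≤width n k h ℓ p = ≤-trans p (≤-reflexive (width-def n k h ℓ))

64≤width : ∀ n k h ℓ → 64 ≤ width n k h ℓ
64≤width n k h ℓ = ≤width n k h ℓ (m≤n+m 64 (2 ^ k + n + size h ℓ))

4width≤limit : ∀ n k h ℓ → 4 * width n k h ℓ ≤ limit n k h ℓ
4width≤limit n k h ℓ = ≤-trans
  (*-monoʳ-≤ 4 (m≤m*n (width n k h ℓ) (width n k h ℓ) {{>-nonZero (≤-trans (s≤s z≤n) (64≤width n k h ℓ))}}))
  (≤-reflexive (limit-def n k h ℓ))

params : ℕ → ℕ → ℕ → ℕ → ℕ → Maybe ℕ
params n k h ℓ 2 = just n
params n k h ℓ 3 = just k
params n k h ℓ 4 = just (2 ^ k)
params n k h ℓ 5 = just (suc h)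
params n k h ℓ 6 = just (suc (suc h))
params n k h ℓ 7 = just ℓ
params n k h ℓ 8 = just (2 ^ ℓ)
params n k h ℓ 9 = just (width n k h ℓ)
params n k h ℓ _ = nothing

odd/2 : ∀ p → suc (p * 2) / 2 ≡ p
odd/2 p = trans (+-distrib-/ 1 (p * 2) {2} (subst (λ t → 1 + t < 2) (sym (m*n%n≡0 p 2)) (s≤s (s≤s z≤n)))) (m*n/n≡m p 2)

-- What is left of `succᵛ` after the descent. The lowest bit of p belongs to the latest turn: if it
-- is 1, then y is a vertex found in a summary and gives way to the minimum of its cluster; if it is
-- 0, then y is already the answer one level up.
climb : Cells → ℕ → ℕ → ℕ → ℕ → ℕ
climb m zero    J p y = y
climb m (suc d) J p y = climb m d (suc J) (p / 2) (if p % 2 ≡ᵇ 0 then y else lo m J y)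

climb-even : ∀ m d J p y → climb m (suc d) J (p * 2) y ≡ climb m d (suc J) p y
climb-even m d J p y rewrite m*n%n≡0 p 2 {{_}} | m*n/n≡m p 2 {{_}} = refl

climb-odd : ∀ m d J p y → climb m (suc d) J (suc (p * 2)) y ≡ climb m d (suc J) p (lo m J y)
climb-odd m d J p y rewrite [m+kn]%n≡m%n 1 p 2 {{_}} | odd/2 p = refl

rootᶜ insertᶜ deleteᶜ successorᶜ : Cmd
rootᶜ = Ĵ := reg rJ ⨾ Ĥ := lit 1 ⨾ ê := reg rl
insertᶜ = rootᶜ ⨾ insLoop
deleteᶜ = rootᶜ ⨾ delLoop
successorᶜ = (rootᶜ ⨾ P̂ := lit 0 ⨾ gô := lit 1 ⨾ ŷ := lit 0) ⨾ succLoop ⨾ ascLoop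

n<2^n : ∀ m → m < 2 ^ m
n<2^n zero    = s≤s z≤n
n<2^n (suc m) = ≤-trans (+-mono-≤ (≤-trans (s≤s z≤n) (n<2^n m)) (n<2^n m))
                  (≤-reflexive (cong (2 ^ m +_) (sym (+-identityʳ (2 ^ m)))))

≫-root : ∀ ℓ {c} → c < 2 ^ ℓ → (2 ^ ℓ + c) ≫ ℓ ≡ 1
≫-root ℓ {c} c< = begin
  (2 ^ ℓ + c) ≫ ℓ         ≡⟨ ≫-def (2 ^ ℓ + c) ℓ ⟩
  (2 ^ ℓ + c) / 2 ^ ℓ     ≡⟨ m/n≡1+[m∸n]/n (m≤m+n (2 ^ ℓ) c) ⟩
  suc ((2 ^ ℓ + c ∸ 2 ^ ℓ) / 2 ^ ℓ) ≡⟨ cong (λ t → suc (t / 2 ^ ℓ)) (m+n∸m≡n (2 ^ ℓ) c) ⟩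
  suc (c / 2 ^ ℓ)         ≡⟨ cong suc (m<n⇒m/n≡0 c<) ⟩
  1                       ∎
  where
  open ≡-Reasoning
  instance _ = m^n≢0 2 ℓ

≫≡1⇒< : ∀ {x} r → x ≫ r ≡ 1 → x < 2 ^ r + 2 ^ r
≫≡1⇒< {x} r p = begin-strict
  x                           ≡⟨ m≡m%n+[m/n]*n x (2 ^ r) ⟩
  x % 2 ^ r + x / 2 ^ r * 2 ^ r ≡⟨ cong (λ t → x % 2 ^ r + t * 2 ^ r) (trans (sym (≫-def x r)) p) ⟩
  x % 2 ^ r + 1 * 2 ^ r       <⟨ +-monoˡ-< (1 * 2 ^ r) (m%n<n x (2 ^ r)) ⟩
  2 ^ r + 1 * 2 ^ r           ≡⟨ cong (2 ^ r +_) (*-identityˡ (2 ^ r)) ⟩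
  2 ^ r + 2 ^ r               ∎
  where
  open ≤-Reasoning
  instance _ = m^n≢0 2 r

Good-empty : ∀ {m} J {H e S} → (∀ {y} → ¬ S y) → (∀ {J′ H′} → Foot J H e J′ H′ → m J′ H′ ≡ (0 , 0)) → Good m J H e S
Good-empty zero {H} {e} none z = (λ _ → none) , cong proj₂ (z (foot-self 0 H e))
Good-empty {m} (suc J) {H} {e} none z =
  node (λ p → contradiction (cong proj₂ (z (foot-self (suc J) H e))) p)
       (λ p → contradiction (cong proj₂ (z (foot-self (suc J) H e))) p)
       (λ p → contradiction p none) (λ p → contradiction p none) ,
  Good-empty J (λ (_ , p , _) → none (proj₁ p)) (z ∘ foot-summary e) ,
  λ u uH → Good-empty J (λ (p , _) → none (proj₁ p)) (z ∘ foot-cluster e uH)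

-- Subsets as binary numbers

bit : ℕ → ℕ → ℕ
bit i S = (S ≫ i) % 2

bit-zero : ∀ S → bit 0 S ≡ S % 2
bit-zero S = cong (_% 2) (≫-0 S)

bit-suc : ∀ i S → bit (suc i) S ≡ bit i (S / 2)
bit-suc i S = cong (_% 2) (trans (sym (≫-≫ S 1 i)) (cong (_≫ i) (≫-1 S)))

odd≡ : ∀ {S} → S % 2 ≡ 1 → S ≡ suc (S / 2 * 2)
odd≡ {S} p = trans (m≡m%n+[m/n]*n S 2) (cong (_+ S / 2 * 2) p)

bit⇒2^≤ : ∀ {i S} → bit i S ≡ 1 → 2 ^ i ≤ S
bit⇒2^≤ {i} {S} p = ≮⇒≥ λ S< → contradiction (trans (sym p) (cong (_% 2) (trans (≫-def S i) (m<n⇒m/n≡0 S<)))) λ ()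
  where instance _ = m^n≢0 2 i

private
  clear-half : ∀ i S → (S ∸ 2 ^ suc i) / 2 ≡ S / 2 ∸ 2 ^ i
  clear-half i S = trans (cong (λ t → (S ∸ t) / 2) (*-comm 2 (2 ^ i))) ([m∸n*o]/o≡m/o∸n S (2 ^ i) 2)

  clear-parity : ∀ i {S} → 2 ^ suc i ≤ S → (S ∸ 2 ^ suc i) % 2 ≡ S % 2
  clear-parity i {S} p = trans (cong (λ t → (S ∸ t) % 2) (*-comm 2 (2 ^ i)))
    (m*n≤o⇒[o∸m*n]%n≡o%n (2 ^ i) (≤-trans (≤-reflexive (*-comm (2 ^ i) 2)) p))

  unit-half : ∀ {S} → S % 2 ≡ 1 → (S ∸ 1) / 2 ≡ S / 2
  unit-half {S} p = trans (cong (λ t → (t ∸ 1) / 2) (odd≡ {S} p)) (m*n/n≡m (S / 2) 2)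

bit-clear : ∀ i {S} → bit i S ≡ 1 → bit i (S ∸ 2 ^ i) ≢ 1
bit-clear zero {S} p q = contradiction
  (trans (sym q) (trans (bit-zero (S ∸ 1)) (trans (cong (λ t → (t ∸ 1) % 2) (odd≡ {S} (trans (sym (bit-zero S)) p))) (m*n%n≡0 (S / 2) 2)))) λ ()
bit-clear (suc i) {S} p q = bit-clear i (trans (sym (bit-suc i S)) p)
  (trans (cong (bit i) (sym (clear-half i S))) (trans (sym (bit-suc i (S ∸ 2 ^ suc i))) q))

-- Bit i is set, so subtracting `2 ^ i` borrows from no other bit. This is how a symbol is removed
-- from a set.
bit-keep : ∀ i j {S} → bit i S ≡ 1 → i ≢ j → bit j (S ∸ 2 ^ i) ≡ bit j S
bit-keep zero zero p i≢j = contradiction refl i≢j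
bit-keep zero (suc j) {S} p i≢j =
  trans (bit-suc j (S ∸ 1)) (trans (cong (bit j) (unit-half {S} (trans (sym (bit-zero S)) p))) (sym (bit-suc j S)))
bit-keep (suc i) zero {S} p i≢j =
  trans (bit-zero (S ∸ 2 ^ suc i)) (trans (clear-parity i (bit⇒2^≤ {suc i} p)) (sym (bit-zero S)))
bit-keep (suc i) (suc j) {S} p i≢j = begin
  bit (suc j) (S ∸ 2 ^ suc i) ≡⟨ bit-suc j (S ∸ 2 ^ suc i) ⟩
  bit j ((S ∸ 2 ^ suc i) / 2) ≡⟨ cong (bit j) (clear-half i S) ⟩
  bit j (S / 2 ∸ 2 ^ i)       ≡⟨ bit-keep i j (trans (sym (bit-suc i S)) p) (i≢j ∘ cong suc) ⟩
  bit j (S / 2)               ≡⟨ sym (bit-suc j S) ⟩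
  bit (suc j) S               ∎
  where open ≡-Reasoning

even-or-odd : ∀ S → S % 2 ≡ 0 ⊎ S % 2 ≡ 1
even-or-odd S with S % 2 | m%n<n S 2
... | 0 | _ = inj₁ refl
... | 1 | _ = inj₂ refl
... | suc (suc _) | s≤s (s≤s ())

some-bit : ∀ k {S} → S < 2 ^ k → S ≢ 0 → ∃ λ i → i < k × bit i S ≡ 1
some-bit zero (s≤s z≤n) S≢0 = contradiction refl S≢0
some-bit (suc k) {S} S< S≢0 with even-or-odd S
... | inj₂ p = 0 , s≤s z≤n , trans (bit-zero S) p
... | inj₁ p with some-bit k {S / 2} (m<n*o⇒m/o<n (<-≤-trans S< (≤-reflexive (*-comm 2 (2 ^ k)))))
                    (λ q → S≢0 (trans (m≡m%n+[m/n]*n S 2) (cong₂ (λ s t → s + t * 2) p q)))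
...   | i , i<k , q = suc i , s≤s i<k , trans (bit-suc i S) q

full-bit : ∀ k {i} → i < k → bit i (2 ^ k ∸ 1) ≡ 1
full-bit (suc k) {i} i<k with 2 ^ k | m^n>0 2 k | full-bit k
... | suc p | _ | ih = go i i<k
  where
  full≡ : 2 * suc p ∸ 1 ≡ suc (p * 2)
  full≡ = trans (cong pred (*-comm 2 (suc p))) refl
  go : ∀ i → i < suc k → bit i (2 * suc p ∸ 1) ≡ 1
  go zero _ = trans (bit-zero (2 * suc p ∸ 1)) (trans (cong (_% 2) full≡) ([m+kn]%n≡m%n 1 p 2))
  go (suc i) (s≤s i<k) = trans (bit-suc i (2 * suc p ∸ 1)) (trans (cong (bit i) (trans (cong (_/ 2) full≡) (odd/2 p))) (ih i<k))

-- Optimal packings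

module Packings (n k : ℕ) (t : ℕ → ℕ) where

  -- The next occurrence of i from p on, where n stands for none.
  record Next (i p q : ℕ) : Set where
    constructor next-at
    field
      q≤n  : q ≤ n
      miss : ∀ {x} → p ≤ x → x < q → t x ≢ i
      hit  : q < n → p ≤ q × t q ≡ i

  -- `start` and `end` are total and constrained on the members of S only, so forgetting a symbol
  -- leaves both functions as they are.
  record Packing (S e : ℕ) : Set where
    field
      start end : ℕ → ℕ
      ends  : ∀ {i} → i < k → bit i S ≡ 1 →
              start i < end i × end i < e × t (start i) ≡ i × t (end i) ≡ i
      apart : ∀ {i j} → i < k → bit i S ≡ 1 → j < k → bit j S ≡ 1 → i ≢ j →
              end i < start j ⊎ end j < start i
  open Packing public

  -- The value n + 1 stands for the absence of a packing.
  record Optimal (S v : ℕ) : Set where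
    constructor optimal
    field
      v≤    : v ≤ suc n
      packs : v ≤ n → Packing S v
      least : ∀ {e} → e ≤ n → Packing S e → v ≤ e
  open Optimal public

  optimal-∅ : Optimal 0 0
  optimal-∅ = optimal z≤n
    (λ _ → record { start = id ; end = id
                  ; ends = λ {i} _ p → contradiction (trans (sym p) (no-bit i)) λ ()
                  ; apart = λ {i} _ p → contradiction (trans (sym p) (no-bit i)) λ () })
    (λ _ _ → z≤n)
    where
    no-bit : ∀ i → bit i 0 ≡ 0
    no-bit i = cong (_% 2) (n≤0⇒n≡0 (≫≤ 0 i))

  Last : ∀ {S e} → Packing S e → ℕ → Set
  Last {S} P i = i < k × bit i S ≡ 1 × (∀ {j} → j < k → bit j S ≡ 1 → end P j ≤ end P i)

  last-exists : ∀ {S e} (P : Packing S e) → S < 2 ^ k → S ≢ 0 → ∃ (Last P)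
  last-exists {S} P S< S≢0 with search k ≤-refl
    where
    search : ∀ m → m ≤ k → (∀ {i} → i < m → bit i S ≢ 1) ⊎
             ∃ λ i → i < k × bit i S ≡ 1 × (∀ {j} → j < m → bit j S ≡ 1 → end P j ≤ end P i)
    search zero m≤ = inj₁ λ ()
    search (suc m) m≤ with bit m S ≟ 1 | search m (<⇒≤ m≤)
    ... | no q | inj₁ none = inj₁ λ { (s≤s i≤m) r → [ (λ i<m → none i<m r) , (λ { refl → q r }) ]′ (m≤n⇒m<n∨m≡n i≤m) }
    ... | no q | inj₂ (i , i< , r , top) = inj₂ (i , i< , r ,
        λ { (s≤s j≤m) s → [ (λ j<m → top j<m s) , (λ { refl → contradiction s q }) ]′ (m≤n⇒m<n∨m≡n j≤m) })
    ... | yes q | inj₁ none = inj₂ (m , m≤ , q ,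
        λ { (s≤s j≤m) s → [ (λ j<m → contradiction s (none j<m)) , (λ { refl → ≤-refl }) ]′ (m≤n⇒m<n∨m≡n j≤m) })
    ... | yes q | inj₂ (i , i< , r , top) with ≤-total (end P m) (end P i)
    ...   | inj₁ m≤i = inj₂ (i , i< , r ,
        λ { (s≤s j≤m) s → [ (λ j<m → top j<m s) , (λ { refl → m≤i }) ]′ (m≤n⇒m<n∨m≡n j≤m) })
    ...   | inj₂ i≤m = inj₂ (m , m≤ , q ,
        λ { (s≤s j≤m) s → [ (λ j<m → ≤-trans (top j<m s) i≤m) , (λ { refl → ≤-refl }) ]′ (m≤n⇒m<n∨m≡n j≤m) })
  ... | inj₂ (i , p) = i , p
  ... | inj₁ none with some-bit k S< S≢0
  ...   | i , i< , p = contradiction p (none i<)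

  module _ {S i u q₁ q₂ : ℕ} (i<k : i < k) (i∈S : bit i S ≡ 1) (O : Optimal (S ∸ 2 ^ i) u)
           (N₁ : Next i u q₁) (N₂ : Next i (suc q₁) q₂) where

    -- Appends the earliest factor of i to an optimal packing of the other symbols. If there is
    -- none, then q₂ is n and `suc q₂` is n + 1, the value for absence.
    extend : suc q₂ ≤ n → Packing S (suc q₂)
    extend q₂<n = record
      { start = start P [ i ↦ q₁ ] ; end = end P [ i ↦ q₂ ] ; ends = ends′ ; apart = apart′ }
      where
      q₁<q₂ = proj₁ (Next.hit N₂ q₂<n)
      hit₁ = Next.hit N₁ (<-trans q₁<q₂ q₂<n)
      P = packs O (≤-trans (proj₁ hit₁) (Next.q≤n N₁))
      member : ∀ {j} → bit j S ≡ 1 → j ≢ i → bit j (S ∸ 2 ^ i) ≡ 1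
      member {j} p j≢i = trans (bit-keep i j {S} i∈S (≢-sym j≢i)) p
      ends′ : ∀ {j} → j < k → bit j S ≡ 1 →
              (start P [ i ↦ q₁ ]) j < (end P [ i ↦ q₂ ]) j × (end P [ i ↦ q₂ ]) j < suc q₂ ×
              t ((start P [ i ↦ q₁ ]) j) ≡ j × t ((end P [ i ↦ q₂ ]) j) ≡ j
      ends′ {j} j<k p with j ≟ i
      ... | yes refl rewrite ≡ᵇ-refl j = q₁<q₂ , ≤-refl , proj₂ hit₁ , proj₂ (Next.hit N₂ q₂<n)
      ... | no j≢i rewrite ≢⇒≡ᵇ j≢i =
        let a , c , d = ends P j<k (member p j≢i) in
        a , <-trans (<-≤-trans c (proj₁ hit₁)) (m≤n⇒m≤1+n q₁<q₂) , d
      apart′ : ∀ {j l} → j < k → bit j S ≡ 1 → l < k → bit l S ≡ 1 → j ≢ l →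
               (end P [ i ↦ q₂ ]) j < (start P [ i ↦ q₁ ]) l ⊎ (end P [ i ↦ q₂ ]) l < (start P [ i ↦ q₁ ]) j
      apart′ {j} {l} j<k p l<k q j≢l with j ≟ i | l ≟ i
      ... | yes refl | yes refl = contradiction refl j≢l
      ... | yes refl | no l≢i rewrite ≡ᵇ-refl j | ≢⇒≡ᵇ l≢i =
        inj₂ (<-≤-trans (proj₁ (proj₂ (ends P l<k (member q l≢i)))) (proj₁ hit₁))
      ... | no j≢i | yes refl rewrite ≡ᵇ-refl l | ≢⇒≡ᵇ j≢i =
        inj₁ (<-≤-trans (proj₁ (proj₂ (ends P j<k (member p j≢i)))) (proj₁ hit₁))
      ... | no j≢i | no l≢i rewrite ≢⇒≡ᵇ j≢i | ≢⇒≡ᵇ l≢i =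
        apart P j<k (member p j≢i) l<k (member q l≢i) j≢l

    -- Removing the rightmost factor leaves a packing that ends before it.
    bound-last : ∀ {e} → e ≤ n → (P : Packing S e) → Last P i → suc q₂ ≤ e
    bound-last {e} e≤n P (_ , _ , top) = ≤-<-trans (≮⇒≥ q₂≯) (proj₁ (proj₂ ei))
      where
      ei = ends P i<k i∈S
      a = start P i
      z = end P i
      z<n = <-≤-trans (proj₁ (proj₂ ei)) e≤n
      member : ∀ {j} → bit j (S ∸ 2 ^ i) ≡ 1 → j ≢ i × bit j S ≡ 1
      member {j} p with j ≟ i
      ... | yes refl = contradiction p (bit-clear j {S} i∈S)
      ... | no j≢i = j≢i , trans (sym (bit-keep i j {S} i∈S (≢-sym j≢i))) p
      rest : Packing (S ∸ 2 ^ i) a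
      rest = record
        { start = start P ; end = end P
        ; ends = λ j<k p → let j≢i , q = member p ; c , d , f = ends P j<k q in
            c , before j<k q j≢i , f
        ; apart = λ j<k p l<k q → apart P j<k (proj₂ (member p)) l<k (proj₂ (member q)) }
        where
        before : ∀ {j} → j < k → bit j S ≡ 1 → j ≢ i → end P j < a
        before j<k p j≢i with apart P j<k p i<k i∈S j≢i
        ... | inj₁ r = r
        ... | inj₂ r = contradiction (<-≤-trans (<-trans r (proj₁ (ends P j<k p))) (top j<k p)) (n≮n _)
      u≤a : u ≤ a
      u≤a = least O (≤-trans (<⇒≤ (proj₁ ei)) (<⇒≤ z<n)) rest
      q₁≤a : q₁ ≤ a
      q₁≤a = ≮⇒≥ λ a<q₁ → Next.miss N₁ u≤a a<q₁ (proj₁ (proj₂ (proj₂ ei)))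
      q₂≯ : ¬ (z < q₂)
      q₂≯ z<q₂ = Next.miss N₂ (≤-trans (s≤s q₁≤a) (proj₁ ei)) z<q₂ (proj₂ (proj₂ (proj₂ ei)))

-- Packings of the full alphabet and disjoint factors

module _ {n k : ℕ} (w : Text k n) {t : ℕ → ℕ} (t≡ : ∀ x → t (toℕ x) ≡ toℕ (lookup w x)) where
  open Packings n k t

  private
    extend-by-0 : (Fin k → ℕ) → ℕ → ℕ
    extend-by-0 f i with i <? k
    ... | yes i<k = f (fromℕ< i<k)
    ... | no _    = 0

    extend-by-0-≡ : ∀ f {i} (i<k : i < k) → extend-by-0 f i ≡ f (fromℕ< i<k)
    extend-by-0-≡ f {i} i<k with i <? k
    ... | yes p = refl
    ... | no p  = contradiction i<k p

  factors⇒packing : DisjointFactors w → Packing (2 ^ k ∸ 1) n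
  factors⇒packing (F , ok , dis) = record { start = a ; end = z ; ends = ends′ ; apart = apart′ }
    where
    a = extend-by-0 (λ i → toℕ (first (F i)))
    z = extend-by-0 (λ i → toℕ (Defs.last (F i)))
    symbol : ∀ {i} (i<k : i < k) x → lookup w x ≡ fromℕ< i<k → t (toℕ x) ≡ i
    symbol i<k x p = trans (t≡ x) (trans (cong toℕ p) (Fin.toℕ-fromℕ< i<k))
    ends′ : ∀ {i} → i < k → bit i (2 ^ k ∸ 1) ≡ 1 → a i < z i × z i < n × t (a i) ≡ i × t (z i) ≡ i
    ends′ {i} i<k _ rewrite extend-by-0-≡ (λ i → toℕ (first (F i))) i<k | extend-by-0-≡ (λ i → toℕ (Defs.last (F i))) i<k =
      let l , p , q = ok (fromℕ< i<k) in
      m∸n≢0⇒n<m (λ r → contradiction (subst (λ t → 2 ≤ suc t) r l) λ { (s≤s ()) }) , Fin.toℕ<n _ , symbol i<k _ p , symbol i<k _ q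
    apart′ : ∀ {i j} → i < k → bit i (2 ^ k ∸ 1) ≡ 1 → j < k → bit j (2 ^ k ∸ 1) ≡ 1 → i ≢ j → z i < a j ⊎ z j < a i
    apart′ {i} {j} i<k _ j<k _ i≢j
      rewrite extend-by-0-≡ (λ i → toℕ (first (F i))) i<k | extend-by-0-≡ (λ i → toℕ (Defs.last (F i))) i<k
            | extend-by-0-≡ (λ i → toℕ (first (F i))) j<k | extend-by-0-≡ (λ i → toℕ (Defs.last (F i))) j<k
      with toℕ (Defs.last (F (fromℕ< i<k))) <? toℕ (first (F (fromℕ< j<k))) | toℕ (Defs.last (F (fromℕ< j<k))) <? toℕ (first (F (fromℕ< i<k)))
    ... | yes p | _ = inj₁ p
    ... | no _ | yes q = inj₂ q
    -- If neither factor ends before the other begins, then the later of the two first positions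
    -- lies in both.
    ... | no p | no q with ≤-total (toℕ (first (F (fromℕ< i<k)))) (toℕ (first (F (fromℕ< j<k))))
    ...   | inj₁ r = contradiction (≤-refl , first≤last (F (fromℕ< j<k)))
              (dis (fromℕ< i<k) (fromℕ< j<k) (i≢j ∘ Fin.fromℕ<-injective _ _ i<k j<k) (first (F (fromℕ< j<k))) (r , ≮⇒≥ p))
    ...   | inj₂ r = contradiction (r , ≮⇒≥ q)
              (dis (fromℕ< i<k) (fromℕ< j<k) (i≢j ∘ Fin.fromℕ<-injective _ _ i<k j<k) (first (F (fromℕ< i<k))) (≤-refl , first≤last (F (fromℕ< i<k))))

  packing⇒factors : ∀ {e} → e ≤ n → Packing (2 ^ k ∸ 1) e → DisjointFactors w
  packing⇒factors {e} e≤n P = F , ok , dis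
    where
    E : ∀ i → _
    E i = ends P (Fin.toℕ<n i) (full-bit k (Fin.toℕ<n i))
    z<n : ∀ i → end P (toℕ i) < n
    z<n i = <-≤-trans (proj₁ (proj₂ (E i))) e≤n
    a<n : ∀ i → start P (toℕ i) < n
    a<n i = <-trans (proj₁ (E i)) (z<n i)
    F : Fin k → Factor n
    F i = record { first = fromℕ< (a<n i) ; last = fromℕ< (z<n i)
                 ; first≤last = subst₂ _≤_ (sym (Fin.toℕ-fromℕ< (a<n i))) (sym (Fin.toℕ-fromℕ< (z<n i))) (<⇒≤ (proj₁ (E i))) }
    symbol : ∀ {x} (x<n : x < n) i → t x ≡ toℕ i → lookup w (fromℕ< x<n) ≡ i
    symbol x<n i p = Fin.toℕ-injective (trans (sym (t≡ (fromℕ< x<n))) (trans (cong t (Fin.toℕ-fromℕ< x<n)) p))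
    ok : ∀ i → 2 ≤ Defs.length (F i) × lookup w (first (F i)) ≡ i × lookup w (Defs.last (F i)) ≡ i
    ok i = s≤s (m<n⇒0<n∸m (subst₂ _<_ (sym (Fin.toℕ-fromℕ< (a<n i))) (sym (Fin.toℕ-fromℕ< (z<n i))) (proj₁ (E i)))) ,
           symbol (a<n i) i (proj₁ (proj₂ (proj₂ (E i)))) , symbol (z<n i) i (proj₂ (proj₂ (proj₂ (E i))))
    dis : ∀ i j → i ≢ j → Disjoint (F i) (F j)
    dis i j i≢j p (a≤p , p≤z) (a≤p′ , p≤z′)
      rewrite Fin.toℕ-fromℕ< (a<n i) | Fin.toℕ-fromℕ< (z<n i) | Fin.toℕ-fromℕ< (a<n j) | Fin.toℕ-fromℕ< (z<n j)
      with apart P (Fin.toℕ<n i) (full-bit k (Fin.toℕ<n i)) (Fin.toℕ<n j) (full-bit k (Fin.toℕ<n j)) (i≢j ∘ Fin.toℕ-injective)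
    ... | inj₁ r = contradiction (<-≤-trans r (≤-trans a≤p′ p≤z)) (n≮n _)
    ... | inj₂ r = contradiction (<-≤-trans r (≤-trans a≤p p≤z′)) (n≮n _)

-- Programs for next occurrences and for the subset recursion

rans rS rbest rsym rp rend rblk rq : ℕ
rans = 13
rS = 18
rbest = 19
rsym = 20
rp = 21
rend = 22
rblk = 23
rq = 24

scanᶜ endᶜ baseᶜ probeᶜ nxtᶜ : Cmd
scanᶜ = while (op mul (op lt (reg rq) (reg rend)) (op eq (op eq mem[ reg rq ] (reg rsym)) (lit 0)))
          (rq := succᵉ (reg rq))
endᶜ = rend := op mul (succᵉ (reg rblk)) (reg rB) ⨾ ite (op lt (reg rn) (reg rend)) (rend := reg rn) skip
baseᶜ = β̂ := op mul (op add (reg rW) (reg rsym)) (reg rW) ⨾ x̂ := op add (reg rL) (reg rblk)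
probeᶜ = baseᶜ ⨾ Ĵ := reg rJ ⨾ Ĥ := lit 1 ⨾ Ĉ := cellᵉ Ĥ ⨾ ŝ := mem[ succᵉ (reg Ĉ) ]
nxtᶜ =
  ite (op lt (reg rp) (reg rn))
    ((rblk := op div (reg rp) (reg rB) ⨾ rq := reg rp) ⨾ endᶜ ⨾ scanᶜ ⨾
     ite (op lt (reg rq) (reg rend)) skip
       (probeᶜ ⨾
        ite (op lt (succᵉ (reg x̂)) (reg ŝ))
          (successorᶜ ⨾ (rblk := op sub (reg ŷ) (reg rL) ⨾ rq := op mul (reg rblk) (reg rB)) ⨾ endᶜ ⨾ scanᶜ)
          (rq := reg rn)))
    (rq := reg rn)

stepᶜ innerᶜ outerᶜ dpᶜ : Cmd → Cmd
stepᶜ nx =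
  ite (op mod (op shr (reg rS) (reg rsym)) (lit 2))
    (rp := mem[ op add (reg rW) (op sub (reg rS) (op shl (lit 1) (reg rsym))) ] ⨾ nx ⨾
     rp := succᵉ (reg rq) ⨾ nx ⨾
     ite (op lt (succᵉ (reg rq)) (reg rbest)) (rbest := succᵉ (reg rq)) skip)
    skip
innerᶜ nx = while (op lt (reg rsym) (reg rk)) (stepᶜ nx ⨾ rsym := succᵉ (reg rsym))
outerᶜ nx = while (op lt (reg rS) (reg rK))
  ((rbest := succᵉ (reg rn) ⨾ rsym := lit 0) ⨾ innerᶜ nx ⨾
   mem[ op add (reg rW) (reg rS) ]:= reg rbest ⨾ rS := succᵉ (reg rS))
dpᶜ nx = (mem[ reg rW ]:= lit 0 ⨾ rS := lit 1) ⨾ outerᶜ nx ⨾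
  rp := mem[ op add (reg rW) (op sub (reg rK) (lit 1)) ] ⨾ rans := op lt (reg rp) (succᵉ (reg rn))

-- Logarithms and the choice of sizes

-- l is the least exponent from s on with a < 2 ^ l.
record Log (s a l : ℕ) : Set where
  constructor log-at
  field
    s≤l  : s ≤ l
    a<   : a < 2 ^ l
    tight : ∀ {j} → s ≤ j → j < l → 2 ^ j ≤ a

log : ∀ s a → ∃ (Log s a)
log s zero = s , log-at ≤-refl (m^n>0 2 s) λ s≤j j<s → contradiction (≤-<-trans s≤j j<s) (n≮n _)
log s (suc a) with log s a
... | l , log-at s≤l a< tight with suc a <? 2 ^ l
...   | yes p = l , log-at s≤l p λ s≤j j<l → m≤n⇒m≤1+n (tight s≤j j<l)
...   | no p = suc l , log-at (m≤n⇒m≤1+n s≤l)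
        (<-≤-trans (s≤s a<) (≤-trans (+-monoˡ-≤ (2 ^ l) (m^n>0 2 l)) (≤-reflexive (cong (2 ^ l +_) (sym (+-identityʳ (2 ^ l)))))))
        λ s≤j j<l → [ (λ j<l → m≤n⇒m≤1+n (tight s≤j j<l)) , (λ { refl → ≮⇒≥ p }) ]′ (m≤n⇒m<n∨m≡n (s≤s⁻¹ j<l))

Log-≤ : ∀ {s a l} → Log s a l → l ≤ s + suc a
Log-≤ {s} {a} {l} (log-at _ _ tight) with l ≤? s
... | yes p = ≤-trans p (m≤m+n s (suc a))
... | no p with l | ≰⇒> p
...   | suc j | s≤s s≤j = ≤-trans (s≤s (≤-trans (<⇒≤ (n<2^n j)) (tight s≤j ≤-refl))) (m≤n+m (suc a) s)

rarg rpow rexp : ℕ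
rarg = 50
rpow = 51
rexp = 52

lgᶜ : Cmd
lgᶜ = while (op lt (reg rpow) (succᵉ (reg rarg))) (rpow := op mul (lit 2) (reg rpow) ⨾ rexp := succᵉ (reg rexp))

-- Starts at register 2, as 0 and 1 carry the input. Afterwards all registers below 64 are small
-- enough for `bound`.
clearᶜ : ℕ → Cmd
clearᶜ zero    = skip
clearᶜ (suc q) = clearᶜ q ⨾ suc (suc q) := lit 0

paramsᶜ : Cmd
paramsᶜ = rL := reg rpow ⨾ rl := reg rexp ⨾
  rW := op add (op add (op add (reg rK) (reg rn))
          (op mul (lit 2) (op mul (succᵉ (op add (reg rL) (reg rL))) (reg rB)))) (lit 64)

measureᶜ levelsᶜ blockCountᶜ setupᶜ : Cmd
measureᶜ = (rn := reg 1 ⨾ rk := reg 0 ⨾ rK := op shl (lit 1) (reg rk) ⨾ rarg := reg rn ⨾ rpow := lit 2 ⨾ rexp := lit 1) ⨾ lgᶜ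
levelsᶜ = (rarg := op sub (reg rexp) (lit 1) ⨾ rpow := lit 1 ⨾ rexp := lit 0) ⨾ lgᶜ
blockCountᶜ = (rJ := succᵉ (reg rexp) ⨾ rB := succᵉ (reg rJ) ⨾ rarg := op div (reg rn) (reg rB) ⨾ rpow := lit 2 ⨾ rexp := lit 1) ⨾ lgᶜ
setupᶜ = measureᶜ ⨾ levelsᶜ ⨾ blockCountᶜ ⨾ paramsᶜ

-- ℓ₀ is the bit length of n, so 2 ^ h is about log n; the text is cut into blocks
-- of length h + 2, and the numbers of the blocks have ℓ bits.
record Sizes (n : ℕ) : Set where
  field
    ℓ₀ h ℓ : ℕ
    log₀ : Log 1 n ℓ₀
    log₁ : Log 0 (ℓ₀ ∸ 1) h
    log₂ : Log 1 (n / suc (suc h)) ℓ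

  1≤ℓ : 1 ≤ ℓ
  1≤ℓ = Log.s≤l log₂

  blocks : n / suc (suc h) < 2 ^ ℓ
  blocks = Log.a< log₂

  ℓ₀≤2^h : ℓ₀ ≤ 2 ^ h
  ℓ₀≤2^h = ≤-trans (≤-reflexive (sym (m+[n∸m]≡n (Log.s≤l log₀)))) (Log.a< log₁)

  -- The number of blocks has no more bits than n itself. Doubled, this is the level condition
  -- `e + e ≤ 2 ^ J` at the root, where J is h + 1.
  ℓ≤ : ℓ ≤ 2 ^ h
  ℓ≤ = ≤-trans (≮⇒≥ λ ℓ₀<ℓ → <⇒≱ (Log.a< log₀) (≤-trans (Log.tight log₂ (Log.s≤l log₀) ℓ₀<ℓ) (m/n≤m n _))) ℓ₀≤2^h

  ℓ₀∸1≤n : ℓ₀ ∸ 1 ≤ n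
  ℓ₀∸1≤n with ℓ₀ | log₀
  ... | zero | _ = z≤n
  ... | suc zero | _ = z≤n
  ... | suc (suc j) | log-at _ _ tight = ≤-trans (n<2^n j) (≤-trans (^-monoʳ-≤ 2 (n≤1+n j)) (tight (s≤s z≤n) ≤-refl))

  -- The last doubling that takes place shows 2 ^ (h - 1) ≤ ℓ₀ - 1 ≤ n.
  2^h≤n : 2 ^ h ≤ 1 ⊔ (n + n)
  2^h≤n with h | log₁
  ... | zero | _ = m≤m⊔n 1 (n + n)
  ... | suc j | log-at _ _ tight = ≤-trans (+-mono-≤ p (≤-trans (≤-reflexive (+-identityʳ (2 ^ j))) p)) (m≤n⊔m 1 (n + n))
    where p = ≤-trans (tight z≤n ≤-refl) ℓ₀∸1≤n

  h≤n : h ≤ n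
  h≤n with h | log₁
  ... | zero | _ = z≤n
  ... | suc j | log-at _ _ tight = ≤-trans (n<2^n j) (≤-trans (tight z≤n ≤-refl) ℓ₀∸1≤n)

  -- By minimality of ℓ, rounding up to a power of two at most doubles the number of blocks, apart
  -- from a constant. This keeps the size of a tree linear in n.
  2^ℓ≤ : 2 ^ ℓ ≤ 2 + (n / suc (suc h) + n / suc (suc h))
  2^ℓ≤ with ℓ | log₂
  ... | zero | _ = s≤s z≤n
  ... | suc zero | _ = s≤s (s≤s z≤n)
  ... | suc (suc j) | log-at _ _ tight =
    ≤-trans (≤-trans (+-mono-≤ p (≤-trans (≤-reflexive (+-identityʳ (2 ^ suc j))) p)) (n≤1+n _)) (n≤1+n _)
    where p = tight {suc j} (s≤s z≤n) ≤-refl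

opaque
  sizes : ∀ n → Sizes n
  sizes n = record
    { log₀ = proj₂ (log 1 n)
    ; log₁ = proj₂ (log 0 (proj₁ (log 1 n) ∸ 1))
    ; log₂ = proj₂ (log 1 (n / suc (suc (proj₁ (log 0 (proj₁ (log 1 n) ∸ 1))))))
    }

-- Computing the parameters

module Setup (n k b : ℕ) (z : Sizes n) (fits : limit n k (Sizes.h z) (Sizes.ℓ z) ^ 8 < 2 ^ b) where
  open Sizes z
  X : ℕ
  X = limit n k h ℓ

  W₀ : ℕ
  W₀ = width n k h ℓ

  W≤X : W₀ ≤ X
  W≤X = ≤-trans (m≤n*m W₀ 4) (4width≤limit n k h ℓ)

  -- No register reads as a constant here, because this phase writes the registers of the
  -- parameters.
  open Machine b X fits (≤-trans (64≤width n k h ℓ) W≤X) (λ _ → nothing) public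

  n+64≤W : n + 64 ≤ W₀
  n+64≤W = ≤width n k h ℓ (+-monoˡ-≤ 64 (≤-trans (m≤n+m n (2 ^ k)) (m≤m+n (2 ^ k + n) (size h ℓ))))

  4+4n≤X : 4 * (n + 1) ≤ X
  4+4n≤X = ≤-trans (*-monoʳ-≤ 4 (≤-trans (+-monoʳ-≤ n (s≤s z≤n)) n+64≤W)) (4width≤limit n k h ℓ)

  lg-run : ∀ d {σ a j l} → j + d ≡ l → a ≤ n → (∀ {i} → j ≤ i → i < l → 2 ^ i ≤ a) → a < 2 ^ l →
           R σ rarg ≡ a → R σ rpow ≡ 2 ^ j → R σ rexp ≡ j →
           Run lgᶜ σ (d * 20 + 10) (λ σ′ → M σ′ ≡ M σ × R σ′ rpow ≡ 2 ^ l × R σ′ rexp ≡ l)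
  lg-run zero {σ} {a} {j} {l} jl a≤n tight a< q₁ q₂ q₃ = weaken (≤ᵇ⇒≤ 6 10 _) id
    (while-step {t = 0} {u = 0} _
      (λ _ → refl , trans q₂ (cong (2 ^_) j≡l) , trans q₃ j≡l)
      (λ p → contradiction (<-≤-trans a< (≤-trans (≤-reflexive (trans (cong (2 ^_) (sym j≡l)) (sym q₂))) (≤-trans (s≤s⁻¹ p) (≤-reflexive q₁)))) (n≮n _)))
    where
    j≡l : j ≡ l
    j≡l = trans (sym (+-identityʳ j)) jl
  lg-run (suc d) {σ} {a} {j} {l} jl a≤n tight a< q₁ q₂ q₃ =
    weaken (≤-reflexive (sym (+-assoc 20 (d * 20) 10))) id
    (while-step {t = 14} _
      (λ p → contradiction (≤-trans (≤-reflexive (cong suc (sym q₁))) p) (<⇒≱ (s≤s (≤-trans (≤-reflexive q₂) 2^j≤a))))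
      λ _ → weaken (≤ᵇ⇒≤ 8 14 _) id (pin rarg q₁ (pin rpow q₂ (pin rexp q₃
        (finish (rpow := op mul (lit 2) (reg rpow) ⨾ rexp := succᵉ (reg rexp))
          ((_ , 2^≤X) , (_ , ≤-trans (s≤s (≤-trans (<⇒≤ (n<2^n j)) 2^j≤a)) (≤-trans (s≤s a≤n) suc-n≤X)))
          (lg-run d (trans (sym (+-suc j d)) jl) a≤n (λ j<i → tight (<⇒≤ j<i)) a< refl refl refl))))))
    where
    2^j≤a : 2 ^ j ≤ a
    2^j≤a = tight ≤-refl (≤-trans (m≤m+n (suc j) d) (≤-reflexive (trans (sym (+-suc j d)) jl)))
    suc-n≤X : suc n ≤ X
    suc-n≤X = ≤-trans (≤-trans (≤-reflexive (+-comm 1 n)) (m≤n*m (n + 1) 4)) 4+4n≤X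
    2^≤X : 2 * 2 ^ j ≤ X
    2^≤X = ≤-trans (*-mono-≤ {2} {4} (s≤s (s≤s z≤n)) (≤-trans 2^j≤a (≤-trans a≤n (m≤m+n n 1)))) 4+4n≤X

  Known : (ℕ → ℕ) → Store → Set
  Known m σ = M σ ≡ m × R σ rn ≡ n × R σ rk ≡ k × R σ rK ≡ 2 ^ k

  measure-run : ∀ {σ} → R σ 0 ≡ k → R σ 1 ≡ n →
                Run measureᶜ σ (14 + ((ℓ₀ ∸ 1) * 20 + 10)) (λ σ′ → Known (M σ) σ′ × R σ′ rexp ≡ ℓ₀)
  measure-run {σ} p₀ p₁ = pin 0 p₀ (pin 1 p₁
    (exec (rn := reg 1 ⨾ rk := reg 0 ⨾ rK := op shl (lit 1) (reg rk) ⨾ rarg := reg rn ⨾ rpow := lit 2 ⨾ rexp := lit 1)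
       (_ , _ , ((_ , _ , 2^k≤X) , _) , _)
      (weaken ≤-refl
        (λ { ((m≡ , _ , e) , f) → (m≡ , f rn (<ᵇ⇒< rn 50 _) , f rk (<ᵇ⇒< rk 50 _) , trans (f rK (<ᵇ⇒< rK 50 _)) (*-identityˡ (2 ^ k))) , e })
        (framed 50 (lg-run (ℓ₀ ∸ 1) (m+[n∸m]≡n (Log.s≤l log₀)) ≤-refl (Log.tight log₀) (Log.a< log₀) refl refl refl)))))
    where
    2^k≤X : 1 * 2 ^ k ≤ X
    2^k≤X = ≤-trans (≤-reflexive (*-identityˡ (2 ^ k)))
      (≤-trans (≤width n k h ℓ (≤-trans (m≤m+n (2 ^ k) n) (≤-trans (m≤m+n (2 ^ k + n) (size h ℓ)) (m≤m+n _ 64)))) W≤X)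

  levels-run : ∀ {σ m} → Known m σ → R σ rexp ≡ ℓ₀ →
               Run levelsᶜ σ (8 + (h * 20 + 10)) (λ σ′ → Known m σ′ × R σ′ rexp ≡ h)
  levels-run {σ} (refl , p₁ , p₂ , p₃) p₄ = pin rexp p₄
    (exec (rarg := op sub (reg rexp) (lit 1) ⨾ rpow := lit 1 ⨾ rexp := lit 0) (((_ , _ , Log.s≤l log₀) , _) , _)
      (weaken ≤-refl
        (λ { ((m≡ , _ , e) , f) → (m≡ , trans (f rn (<ᵇ⇒< rn 50 _)) p₁ , trans (f rk (<ᵇ⇒< rk 50 _)) p₂ , trans (f rK (<ᵇ⇒< rK 50 _)) p₃) , e })
        (framed 50 (lg-run h refl ℓ₀∸1≤n (Log.tight log₁) (Log.a< log₁) refl refl refl))))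

  Counted : (ℕ → ℕ) → Store → Set
  Counted m σ = Known m σ × R σ rJ ≡ suc h × R σ rB ≡ suc (suc h) × R σ rexp ≡ ℓ × R σ rpow ≡ 2 ^ ℓ

  count-run : ∀ {σ m} → Known m σ → R σ rexp ≡ h →
              Run blockCountᶜ σ (16 + ((ℓ ∸ 1) * 20 + 10)) (Counted m)
  count-run {σ} (refl , p₁ , p₂ , p₃) p₄ = pin rn p₁ (pin rexp p₄
    (exec (rJ := succᵉ (reg rexp) ⨾ rB := succᵉ (reg rJ) ⨾ rarg := op div (reg rn) (reg rB) ⨾ rpow := lit 2 ⨾ rexp := lit 1)
       ((_ , ≤-trans (n≤1+n _) h+2≤X) , (_ , h+2≤X) , _)
      (weaken ≤-refl
        (λ { ((m≡ , e₁ , e₂) , f) → (m≡ , f rn (<ᵇ⇒< rn 50 _) , trans (f rk (<ᵇ⇒< rk 50 _)) p₂ , trans (f rK (<ᵇ⇒< rK 50 _)) p₃)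
              , f rJ (<ᵇ⇒< rJ 50 _) , f rB (<ᵇ⇒< rB 50 _) , e₂ , e₁ })
        (framed 50 (lg-run (ℓ ∸ 1) (m+[n∸m]≡n (Log.s≤l log₂)) (m/n≤m n (suc (suc h))) (Log.tight log₂) (Log.a< log₂) refl refl refl)))))
    where
    h+2≤X : 2 + h ≤ X
    h+2≤X = ≤-trans (≤-trans (+-mono-≤ (≤ᵇ⇒≤ 2 64 _) h≤n) (≤-trans (≤-reflexive (+-comm 64 n)) n+64≤W)) W≤X

  Ready : (ℕ → ℕ) → Store → Set
  Ready m σ = Known m σ × R σ rJ ≡ suc h × R σ rB ≡ suc (suc h) × R σ rl ≡ ℓ × R σ rL ≡ 2 ^ ℓ × R σ rW ≡ W₀

  params-run : ∀ {σ m} → Counted m σ → Run paramsᶜ σ 20 (Ready m)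
  params-run {σ} ((refl , p₁ , p₂ , p₃) , p₄ , p₅ , p₆ , p₇) =
    pin rn p₁ (pin rk p₂ (pin rK p₃ (pin rJ p₄ (pin rB p₅ (pin rexp p₆ (pin rpow p₇
      (finish paramsᶜ (_ , _ , (_ , ≤-trans (≤-reflexive (width-def n k h ℓ)) W≤X))
        ((refl , refl , refl , refl) , refl , refl , refl , refl , width-def n k h ℓ))))))))

  setup-steps : ℕ
  setup-steps = n * 60 + 250

  setup-run : ∀ {σ} → R σ 0 ≡ k → R σ 1 ≡ n → Run setupᶜ σ setup-steps (Ready (M σ))
  setup-run {σ} p₀ p₁ = weaken time≤ id
    (measure-run p₀ p₁ ▷ λ (K , e) → levels-run K e ▷ λ (K , e) → count-run K e ▷ params-run)
    where
    ℓ∸1≤n : ℓ ∸ 1 ≤ suc n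
    ℓ∸1≤n = ∸-monoˡ-≤ 1 (≤-trans (Log-≤ log₂) (s≤s (s≤s (m/n≤m n _))))
    time≤ : 14 + ((ℓ₀ ∸ 1) * 20 + 10) + (8 + (h * 20 + 10) + (16 + ((ℓ ∸ 1) * 20 + 10) + 20)) ≤ n * 60 + 250
    time≤ = begin
      14 + ((ℓ₀ ∸ 1) * 20 + 10) + (8 + (h * 20 + 10) + (16 + ((ℓ ∸ 1) * 20 + 10) + 20))
        ≤⟨ +-mono-≤ (+-monoʳ-≤ 14 (+-monoˡ-≤ 10 (*-monoˡ-≤ 20 ℓ₀∸1≤n))) (+-mono-≤ (+-monoʳ-≤ 8 (+-monoˡ-≤ 10 (*-monoˡ-≤ 20 h≤n)))
             (+-monoˡ-≤ 20 (+-monoʳ-≤ 16 (+-monoˡ-≤ 10 (*-monoˡ-≤ 20 ℓ∸1≤n))))) ⟩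
      14 + (n * 20 + 10) + (8 + (n * 20 + 10) + (16 + (suc n * 20 + 10) + 20))
        ≡⟨ solve 1 (λ x → con 14 :+ (x :* con 20 :+ con 10) :+ (con 8 :+ (x :* con 20 :+ con 10) :+ (con 16 :+ ((con 1 :+ x) :* con 20 :+ con 10) :+ con 20)) :≈ x :* con 60 :+ con 108) refl n ⟩
      n * 60 + 108 ≤⟨ +-monoʳ-≤ (n * 60) (≤ᵇ⇒≤ 108 250 _) ⟩
      n * 60 + 250 ∎
      where open ≤-Reasoning

-- Programs for initialization and updates

rγ rnb : ℕ
rγ = 25
rnb = 26

zeroLoop zeroᶜ tableBody tableLoop tableᶜ blockBody blockLoop blocksᶜ buildLoop buildᶜ lookupᶜ : Cmd
zeroLoop = while (op lt (reg rq) (reg rend)) (mem[ op add (reg β̂) (reg rq) ]:= lit 0 ⨾ rq := succᵉ (reg rq))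
zeroᶜ = (β̂ := op mul (op add (reg rW) (reg rsym)) (reg rW) ⨾
         rend := op mul (lit 2) (op mul (succᵉ (op add (reg rL) (reg rL))) (reg rB)) ⨾ rq := lit 0) ⨾ zeroLoop
tableBody = (rp := op sub (reg rp) (lit 1)) ⨾
            (ite (op eq mem[ reg rp ] (reg rsym)) (rq := reg rp) skip) ⨾ mem[ op add (reg rγ) (reg rp) ]:= reg rq
tableLoop = while (reg rp) tableBody
tableᶜ = (rγ := op mul (op add (op add (reg rW) (reg rW)) (reg rsym)) (reg rW) ⨾
          -- Position n + 1 needs an entry as well: the recursion asks for it after a failed search,
          -- and it is the code for the absence of a packing.
          mem[ op add (reg rγ) (reg rn) ]:= reg rn ⨾ mem[ op add (reg rγ) (succᵉ (reg rn)) ]:= reg rn ⨾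
          rq := reg rn ⨾ rp := reg rn) ⨾ tableLoop
blockBody = rq := mem[ op add (reg rγ) (op mul (reg rblk) (reg rB)) ] ⨾
            -- The value n stands for no occurrence but may lie within the range of the last block,
            -- hence the first test.
            ite (op mul (op lt (reg rq) (reg rn)) (op lt (reg rq) (op mul (succᵉ (reg rblk)) (reg rB))))
              (baseᶜ ⨾ insertᶜ) skip ⨾
            rblk := succᵉ (reg rblk)
blockLoop = while (op lt (reg rblk) (reg rnb)) blockBody
blocksᶜ = (rnb := succᵉ (op div (reg rn) (reg rB)) ⨾ rblk := lit 0) ⨾ blockLoop
buildLoop = while (op lt (reg rsym) (reg rk)) (zeroᶜ ⨾ tableᶜ ⨾ blocksᶜ ⨾ rsym := succᵉ (reg rsym))
buildᶜ = rsym := lit 0 ⨾ buildLoop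
lookupᶜ = rq := mem[ op add (op mul (op add (op add (reg rW) (reg rW)) (reg rsym)) (reg rW)) (reg rp) ]

rpos rnew rold rhome : ℕ
rpos  = 14
rnew  = 15
rold  = 16
rhome = 17

-- The new symbol enters while the old text is still in place, and the old symbol leaves when the
-- new text is. Each scan then sees the text that decides membership, and replacing a symbol by
-- itself is no special case.
checkᶜ enterᶜ leaveᶜ editᶜ : Cmd
checkᶜ = (rblk := reg rhome ⨾ rq := op mul (reg rhome) (reg rB)) ⨾ endᶜ ⨾ scanᶜ
enterᶜ = checkᶜ ⨾ ite (op lt (reg rq) (reg rend)) skip (baseᶜ ⨾ insertᶜ)
leaveᶜ = checkᶜ ⨾ ite (op lt (reg rq) (reg rend)) skip (baseᶜ ⨾ deleteᶜ)
editᶜ = (rpos := reg 0 ⨾ rnew := reg 1 ⨾ rold := mem[ reg rpos ] ⨾ rhome := op div (reg rpos) (reg rB) ⨾ rsym := reg rnew) ⨾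
        enterᶜ ⨾ (mem[ reg rpos ]:= reg rnew ⨾ rsym := reg rold) ⨾ leaveᶜ

-- Trees in memory

module Layout (n k h ℓ b : ℕ) (fits : limit n k h ℓ ^ 8 < 2 ^ b) (2^h≤ : 2 ^ suc h ≤ limit n k h ℓ)
              (1≤ℓ : 1 ≤ ℓ) (ℓ≤ : ℓ ≤ 2 ^ h) (blocks : n / suc (suc h) < 2 ^ ℓ) where

  B Jr L L₂ Z W X : ℕ
  B = suc (suc h)
  Jr = suc h
  L = 2 ^ ℓ
  L₂ = L + L
  Z = size h ℓ
  W = width n k h ℓ
  X = limit n k h ℓ

  64≤W : 64 ≤ W
  64≤W = 64≤width n k h ℓ

  Z≤W : Z ≤ W
  Z≤W = ≤width n k h ℓ (≤-trans (m≤n+m Z (2 ^ k + n)) (m≤m+n (2 ^ k + n + Z) 64))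

  W≤X : W ≤ X
  W≤X = ≤-trans (m≤n*m W 4) (4width≤limit n k h ℓ)

  64≤X : 64 ≤ X
  64≤X = ≤-trans 64≤W W≤X

  open Machine b X fits 64≤X (params n k h ℓ) public
  open Trees B public

  cell : ℕ → ℕ → ℕ → ℕ
  cell β J H = β + 2 * (H * B + J)

  view : (ℕ → ℕ) → ℕ → Cells
  view m β J H = m (cell β J H) , m (suc (cell β J H))

  L₂≤X : 2 + L₂ ≤ X
  L₂≤X = ≤-trans (≤-trans (+-monoʳ-≤ 2 (m≤n⇒m≤1+n ≤-refl)) h′) (≤-trans Z≤64 W≤X)
    where
    h′ : 2 + suc L₂ ≤ Z + 64
    h′ = ≤-trans (+-monoˡ-≤ (suc L₂) (s≤s (s≤s (z≤n {62})))) (≤-trans (+-monoʳ-≤ 64 (≤-trans (m≤m*n (suc L₂) B) (m≤n*m (suc L₂ * B) 2))) (≤-reflexive (+-comm 64 Z)))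
    Z≤64 : Z + 64 ≤ W
    Z≤64 = ≤width n k h ℓ (+-monoˡ-≤ 64 (m≤n+m Z (2 ^ k + n)))

  offset< : ∀ {J H} → J < B → H ≤ L₂ → suc (2 * (H * B + J)) < Z
  offset< {J} {H} J<B H≤ = begin-strict
    suc (2 * (H * B + J))   <⟨ n<1+n _ ⟩
    2 + 2 * (H * B + J)     ≡⟨ sym (*-suc 2 (H * B + J)) ⟩
    2 * suc (H * B + J)     ≤⟨ *-monoʳ-≤ 2 (+-monoʳ-< (H * B) J<B) ⟩
    2 * (H * B + B)         ≡⟨ cong (2 *_) (+-comm (H * B) B) ⟩
    2 * (suc H * B)         ≤⟨ *-monoʳ-≤ 2 (*-monoˡ-≤ B (s≤s H≤)) ⟩
    Z                       ∎
    where open ≤-Reasoning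

  cell≤X : ∀ {β J H} → β + Z ≤ X → J < B → H ≤ L₂ → cell β J H ≤ X
  cell≤X {β} β≤ J<B H≤ = ≤-trans (+-monoʳ-≤ β (<⇒≤ (<-trans (n<1+n _) (offset< J<B H≤)))) β≤

  cell-injective : ∀ {J J′ H H′} → J < B → J′ < B → H * B + J ≡ H′ * B + J′ → J ≡ J′ × H ≡ H′
  cell-injective {J} {J′} {H} {H′} J< J′< p = let q , r = pair-injective {B} {H} {H′} {J} {J′} J< J′< p in r , q

  -- `Good` leaves the minimum of an empty node unspecified, but the programs load it all the same.
  -- This keeps it small enough for a register.
  Bounded : (ℕ → ℕ) → ℕ → Set
  Bounded m β = ∀ J H → J < B → H ≤ L₂ → lo (view m β) J H ≤ L₂ × hi (view m β) J H ≤ suc L₂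

  Off : ℕ → (ℕ → ℕ) → (ℕ → ℕ) → Set
  Off β m m′ = ∀ a → (∀ z → z < Z → a ≢ β + z) → m′ a ≡ m a

  store₂ : (ℕ → ℕ) → ℕ → ℕ → ℕ → (ℕ → ℕ)
  store₂ m a p q = m [ a ↦ p ] [ suc a ↦ q ]

  module _ (m : ℕ → ℕ) (β : ℕ) {J H : ℕ} (p q : ℕ) (J<B : J < B) (H≤ : H ≤ L₂) where
    private
      a = cell β J H
      m′ = store₂ m a p q

    store₂-upd : Upd (view m β) (view m′ β) J H (p , q)
    store₂-upd = upd
      (cong₂ _,_ (trans (↦-there (m [ a ↦ p ]) {suc a} q (<⇒≢ (n<1+n a))) (↦-here m a p))
                 (↦-here (m [ a ↦ p ]) (suc a) q))
      λ {J′} {H′} J′< ne → cong₂ _,_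
        (trans (↦-there (m [ a ↦ p ]) {suc a} q (λ r → even≢odd (H′ * B + J′) (H * B + J) (+-cancelˡ-≡ β _ _ (trans r (sym (+-suc β _))))))
               (↦-there m {a} p (λ r → ne (ne′ J′< r))))
        (trans (↦-there (m [ a ↦ p ]) {suc a} q (λ r → ne (ne′ J′< (suc-injective r))))
               (↦-there m {a} p (λ r → even≢odd (H * B + J) (H′ * B + J′) (+-cancelˡ-≡ β _ _ (trans (sym r) (sym (+-suc β _)))))))
      where
      ne′ : ∀ {J′ H′} → J′ < B → cell β J′ H′ ≡ a → J′ ≡ J × H′ ≡ H
      ne′ {J′} {H′} J′< r = cell-injective J′< J<B (*-cancelˡ-≡ (H′ * B + J′) (H * B + J) 2 (+-cancelˡ-≡ β _ _ r))

    store₂-bounded : p ≤ L₂ → q ≤ suc L₂ → Bounded m β → Bounded m′ β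
    store₂-bounded p≤ q≤ bd J′ H′ J′< H′≤ with J′ ≟ J | H′ ≟ H
    ... | yes refl | yes refl = subst (_≤ L₂) (sym (cong proj₁ (at store₂-upd))) p≤ , subst (_≤ suc L₂) (sym (cong proj₂ (at store₂-upd))) q≤
    ... | no ne | _ = subst (_≤ L₂) (sym (cong proj₁ e)) (proj₁ (bd J′ H′ J′< H′≤)) , subst (_≤ suc L₂) (sym (cong proj₂ e)) (proj₂ (bd J′ H′ J′< H′≤))
      where e = else store₂-upd {J′} {H′} J′< (ne ∘ proj₁)
    ... | yes _ | no ne = subst (_≤ L₂) (sym (cong proj₁ e)) (proj₁ (bd J′ H′ J′< H′≤)) , subst (_≤ suc L₂) (sym (cong proj₂ e)) (proj₂ (bd J′ H′ J′< H′≤))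
      where e = else store₂-upd {J′} {H′} J′< (ne ∘ proj₂)

    store₂-off : Off β m m′
    store₂-off c ne =
      trans (↦-there (m [ a ↦ p ]) {suc a} q (λ r → ne (suc (2 * (H * B + J))) (offset< J<B H≤) (trans r (sym (+-suc β _)))))
            (↦-there m {a} p (ne (2 * (H * B + J)) (<-trans (n<1+n _) (offset< J<B H≤))))

  Off-trans : ∀ {β m m′ m″} → Off β m m′ → Off β m′ m″ → Off β m m″
  Off-trans p q a ne = trans (q a ne) (p a ne)

  -- The cost of concrete loop-free code is a closed numeral, so a rounded bound for it is checked
  -- by computation.
  within : ∀ {c σ t Q} t′ {_ : T (t ≤ᵇ t′)} → Run c σ t Q → Run c σ t′ Q
  within {t = t} t′ {p} = weaken (≤ᵇ⇒≤ t t′ p) id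

  record Node-at (σ : Store) (β J H e x : ℕ) : Set where
    constructor node-at
    field
      β≡ : R σ β̂ ≡ β
      J≡ : R σ Ĵ ≡ J
      H≡ : R σ Ĥ ≡ H
      e≡ : R σ ê ≡ e
      x≡ : R σ x̂ ≡ x
      β≤ : β + Z ≤ X
      J< : J < B
      H≤ : H ≤ L₂
      e≤ : e ≤ L₂
      x≤ : x ≤ L₂
      cells≤ : Bounded (M σ) β

  -- Loops that follow the traces

  module Descent (Op : Cells → ℕ → ℕ → ℕ → ℕ → Cells → Set) where

    Done : ℕ → ℕ → ℕ → ℕ → ℕ → (ℕ → ℕ) → Store → Set
    Done β J H e x m σ = Op (view m β) J H e x (view (M σ) β) × Bounded (M σ) β × Off β m (M σ)

    data Step (β j H e x : ℕ) (m : ℕ → ℕ) (σ : Store) : Set where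
      halt : R σ Ĵ ≡ 0 → Done β (suc j) H e x m σ → Step β j H e x m σ
      next : ∀ {H′ e′ x′} → Node-at σ β j H′ e′ x′ → Off β m (M σ) →
             (∀ {m′} → Op (view (M σ) β) j H′ e′ x′ m′ → Op (view m β) (suc j) H e x m′) →
             Step β j H e x m σ

    -- Each round either completes the trace and sets the level to 0, or contributes one constructor
    -- and lowers the level by one. The level therefore bounds the number of rounds.
    loop : ∀ {body} t → (∀ {m H e x} → Op m 0 H e x m) →
           (∀ {σ β j H e x} → Node-at σ β (suc j) H e x → Run body σ t (Step β j H e x (M σ))) →
           ∀ J {σ β H e x} → Node-at σ β J H e x →
           Run (while (reg Ĵ) body) σ (J * (2 + t) + 2) (Done β J H e x (M σ))
    loop t leaf body zero N = while-step {t = 0} {u = 0} _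
      (λ _ → leaf , Node-at.cells≤ N , λ _ _ → refl) (λ J≢0 → contradiction (Node-at.J≡ N) J≢0)
    loop {c} t leaf body (suc j) {σ} {β} {H} {e} {x} N =
      weaken (≤-reflexive (sym (+-assoc (2 + t) (j * (2 + t)) 2))) id
        (while-step {t = t} _ (λ p → contradiction (trans (sym (Node-at.J≡ N)) p) λ ())
          λ _ → weaken ≤-refl rest (body N))
      where
      rest : ∀ {σ′} → Step β j H e x (M σ) σ′ →
             Run (while (reg Ĵ) c) σ′ (j * (2 + t) + 2) (Done β (suc j) H e x (M σ))
      rest (halt J≡0 d) = weaken (m≤n+m 2 (j * (2 + t))) id
        (while-step {t = 0} {u = 0} _ (λ _ → d) (λ J≢0 → contradiction J≡0 J≢0))
      rest (next N′ off k) = weaken ≤-refl (λ (p , q , r) → k p , q , Off-trans off r) (loop t leaf body j N′)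

  pinned : Store → ℕ → ℕ → ℕ → ℕ → ℕ → Store
  pinned σ β J H e x = setR x̂ x (setR ê e (setR Ĥ H (setR Ĵ J (setR β̂ β σ))))

  pin-node : ∀ {c σ t Q β J H e x} → Node-at σ β J H e x → Run c (pinned σ β J H e x) t Q → Run c σ t Q
  pin-node N r = pin β̂ β≡ (pin Ĵ J≡ (pin Ĥ H≡ (pin ê e≡ (pin x̂ x≡ r))))
    where open Node-at N

  key≤X : ∀ {x} → x ≤ L₂ → x ≤ X
  key≤X x≤ = ≤-trans (m≤n⇒m≤1+n (m≤n⇒m≤1+n x≤)) L₂≤X

  suc-key≤X : ∀ {x} → x ≤ suc L₂ → x ≤ X
  suc-key≤X x≤ = ≤-trans (m≤n⇒m≤1+n x≤) L₂≤X

  B≤X : B ≤ X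
  B≤X = ≤-trans (≤-trans (m≤n*m B (suc L₂)) (m≤n*m (suc L₂ * B) 2)) (≤-trans Z≤W W≤X)

  module InsRun where
    open Descent Ins public

    Swapped-to : (m : ℕ → ℕ) (a β J H e l h x : ℕ) → Store → Set
    Swapped-to m a β J H e l h x σ =
      Swap l h x (R σ lô) (R σ hî) (R σ x̂) × R σ lô ≤ L₂ × R σ hî ≤ suc L₂ × R σ x̂ ≤ L₂
      × (R σ β̂ ≡ β × R σ Ĵ ≡ J × R σ Ĥ ≡ H × R σ ê ≡ e × R σ Â ≡ a) × M σ ≡ m

    swap-run : ∀ {σ l h′ x} → R σ lô ≡ l → R σ hî ≡ h′ → R σ x̂ ≡ x → l ≤ L₂ → h′ ≤ suc L₂ → x ≤ L₂ →
               Run swapᶜ σ (time swapᶜ) (Swapped-to (M σ) (R σ Â) (R σ β̂) (R σ Ĵ) (R σ Ĥ) (R σ ê) l h′ x)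
    swap-run {σ} {l} {h′} {x} p q r l≤ h≤ x≤ = pin lô p (pin hî q (pin x̂ r (straight swapᶜ
      ( _
      , (λ x<l → _ , _ , _ , _ , _ , _ , _
          , (λ l<h → swap-lo x<l l<h , x≤ , h≤ , l≤ , regs≡ , refl)
          , (λ h≤l → (_ , _ , positive≤ h′) , _ , _ , key≤X′ l≤ , _ , _
              , subst (Swap l h′ x x (suc l)) (sym (∸-positive h′)) (swap-bad x<l h≤l)
              , x≤ , s≤s l≤ , ≤-trans (≤-reflexive (∸-positive h′)) (pred-mono-≤ h≤) , regs≡ , refl))
      , (λ l≤x → _
          , (λ x<h → swap-in l≤x x<h , l≤ , h≤ , x≤ , regs≡ , refl)
          , (λ h≤x → (_ , _ , positive≤ h′) , _ , _ , key≤X′ x≤ , _ , _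
              , subst (Swap l h′ x l (suc x)) (sym (∸-positive h′)) (swap-hi l≤x h≤x)
              , l≤ , s≤s x≤ , ≤-trans (≤-reflexive (∸-positive h′)) (pred-mono-≤ h≤) , regs≡ , refl))))))
      where
      key≤X′ : ∀ {x} → x ≤ L₂ → suc x ≤ X
      key≤X′ x≤ = suc-key≤X (s≤s x≤)
      regs≡ : R σ β̂ ≡ R σ β̂ × R σ Ĵ ≡ R σ Ĵ × R σ Ĥ ≡ R σ Ĥ × R σ ê ≡ R σ ê × R σ Â ≡ R σ Â
      regs≡ = refl , refl , refl , refl , refl

    down-run : ∀ {σ m β j H e x l h′ y} → β + Z ≤ X → suc j < B → H ≤ L₂ → e ≤ L₂ → Bounded m β →
               hi (view m β) (suc j) H ≢ 0 →
               Swap (lo (view m β) (suc j) H) (hi (view m β) (suc j) H) x l h′ y → l ≤ L₂ → h′ ≤ suc L₂ → y ≤ L₂ →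
               R σ β̂ ≡ β → R σ Ĵ ≡ suc j → R σ Ĥ ≡ H → R σ ê ≡ e → R σ Â ≡ cell β (suc j) H →
               R σ lô ≡ l → R σ hî ≡ h′ → R σ x̂ ≡ y → M σ ≡ m →
               Run (put ⨾ ite (op eq (reg x̂) (reg lô)) stop (ite (op eq (succᵉ (reg x̂)) (reg hî)) stop insDown))
                 σ 160 (Step β j H e x m)
    down-run {σ} {m} {β} {j} {H} {e} {x} {l} {h′} {y} β≤ J< H≤ e≤ cells≤ h≢0 sw l≤ h≤ y≤ p₁ p₂ p₃ p₄ p₅ p₆ p₇ p₈ refl =
      within 160 (pin β̂ p₁ (pin Ĵ p₂ (pin Ĥ p₃ (pin ê p₄ (pin Â p₅ (pin lô p₆ (pin hî p₇ (pin x̂ p₈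
        (exec put _
         (if-step _
           (λ y≡l → finish stop _ (halt refl (ins-stop h≢0 sw (inj₁ y≡l) upd₁ , bnd₁ , off₁)))
           (λ y≢l → if-step _
             (λ sy≡h → finish stop _ (halt refl (ins-stop h≢0 sw (inj₂ sy≡h) upd₁ , bnd₁ , off₁)))
             (λ sy≢h → exec (Ĵ := op sub (reg Ĵ) (lit 1) ⨾ û := op shr (reg x̂) (clᵉ (reg ê)))
                         (((_ , _ , s≤s z≤n) , _) , _)
               (pin û (cong (y ≫_) (cl-def e))
                 (exec (Ĉ := cellᵉ û) (_ , cell≤X {β} {j} {u} β≤ j< u≤)
                  (if-step _
                    (λ hu≡0 → finish (mem[ reg Ĉ ]:= reg x̂ ⨾ mem[ succᵉ (reg Ĉ) ]:= succᵉ (reg x̂) ⨾ x̂ := reg û ⨾ ê := flᵉ (reg ê)) _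
                       (next (node-at refl refl refl (fl-def e) refl β≤ j< H≤ (≤-trans (fl≤ e) e≤) u≤
                              (store₂-bounded m₁ β {j} {u} y (suc y) j< u≤ y≤ (s≤s y≤) bnd₁))
                            (Off-trans {β} {m} off₁ (store₂-off m₁ β {j} {u} y (suc y) j< u≤))
                            (ins-summary h≢0 sw y≢l sy≢h upd₁ hu≡0 (store₂-upd m₁ β {j} {u} y (suc y) j< u≤))))
                    (λ hu≢0 → finish (Ĥ := reg û ⨾ ê := clᵉ (reg ê)) (_ , _ , ≤-trans (≤-reflexive (+-comm e 1)) (suc-key≤X (s≤s e≤)))
                      (next (node-at refl refl refl (cl-def e) refl β≤ j< u≤ (≤-trans (cl≤ e) e≤) y≤ bnd₁) off₁
                              (ins-cluster h≢0 sw y≢l sy≢h upd₁ hu≢0))))))))))))))))))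
      where
      u = y ≫ cl e
      j< = <-trans (n<1+n j) J<
      u≤ = ≤-trans (≫≤ y (cl e)) y≤
      m₁ = store₂ m (cell β (suc j) H) l h′
      upd₁ = store₂-upd m β {suc j} {H} l h′ J< H≤
      bnd₁ = store₂-bounded m β {suc j} {H} l h′ J< H≤ l≤ h≤ cells≤
      off₁ = store₂-off m β {suc j} {H} l h′ J< H≤

    body-run : ∀ {σ β j H e x} → Node-at σ β (suc j) H e x → Run insBody σ 300 (Step β j H e x (M σ))
    body-run {σ} {β} {j} {H} {e} {x} N = within 300 (pin-node N
      (exec load ((_ , cell≤X {β} {suc j} {H} β≤ J< H≤) , (_ , key≤X l≤) , (_ , suc-key≤X h≤))
        (if-step _
          (λ h≡0 → finish newᶜ _
            (halt refl (ins-new h≡0 (store₂-upd (M σ) β {suc j} {H} x (suc x) J< H≤)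
                       , store₂-bounded (M σ) β {suc j} {H} x (suc x) J< H≤ x≤ (s≤s x≤) cells≤
                       , store₂-off (M σ) β {suc j} {H} x (suc x) J< H≤)))
          (λ h≢0 → swap-run refl refl refl l≤ h≤ x≤ ▷
            λ { (sw , l≤′ , h≤′ , x≤′ , (p₁ , p₂ , p₃ , p₄ , p₅) , p₆) →
              down-run β≤ J< H≤ e≤ cells≤ h≢0 sw l≤′ h≤′ x≤′ p₁ p₂ p₃ p₄ p₅ refl refl refl p₆ }))))
      where
      open Node-at N
      l≤ = proj₁ (cells≤ (suc j) H J< H≤)
      h≤ = proj₂ (cells≤ (suc j) H J< H≤)

    insert-run : ∀ J {σ β H e x} → Node-at σ β J H e x → Run insLoop σ (J * 302 + 2) (Done β J H e x (M σ))
    insert-run = loop 300 ins-leaf body-run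

  module DelRun where
    open Descent Del public

    data Chosen (m : Cells) (j H l h x : ℕ) : ℕ → ℕ → ℕ → ℕ → Set where
      halt-lo : x ≡ l → hi m j H ≡ 0 → Chosen m j H l h x 0 (pred h) h x
      halt-hi : x ≢ l → suc x ≡ h → hi m j H ≡ 0 → Chosen m j H l h x 0 l (suc l) x
      proceed : ∀ {l′ h′ x′} → Pick m j H l h x l′ h′ x′ → Chosen m j H l h x 1 l′ h′ x′

    Chosen-to : (m : ℕ → ℕ) (a β j H e l h x : ℕ) → Store → Set
    Chosen-to m a β j H e l h x σ =
      Chosen (view m β) j H l h x (R σ gô) (R σ lô) (R σ hî) (R σ x̂)
      × R σ lô ≤ L₂ × R σ hî ≤ suc L₂ × R σ x̂ ≤ L₂
      × (R σ β̂ ≡ β × R σ Ĵ ≡ j × R σ Ĥ ≡ H × R σ ê ≡ e × R σ Â ≡ a) × M σ ≡ m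

    choose-run : ∀ {σ a β j H e l h′ x} → β + Z ≤ X → j < B → H ≤ L₂ → Bounded (M σ) β →
                 l ≤ L₂ → h′ ≤ suc L₂ → x ≤ L₂ →
                 R σ β̂ ≡ β → R σ Ĵ ≡ j → R σ Ĥ ≡ H → R σ ê ≡ e → R σ Â ≡ a →
                 R σ lô ≡ l → R σ hî ≡ h′ → R σ x̂ ≡ x →
                 R σ Ĉ ≡ cell β j H → R σ ŝ ≡ hi (view (M σ) β) j H → R σ gô ≡ 1 →
                 Run delChoose σ (time delChoose) (Chosen-to (M σ) a β j H e l h′ x)
    choose-run {σ} {a} {β} {j} {H} {e} {l} {h′} {x} β≤ j< H≤ cells≤ l≤ h≤ x≤ p₁ p₂ p₃ p₄ p₅ p₆ p₇ p₈ p₉ q₁ q₂ =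
      pin β̂ p₁ (pin Ĵ p₂ (pin Ĥ p₃ (pin ê p₄ (pin Â p₅ (pin lô p₆ (pin hî p₇ (pin x̂ p₈ (pin Ĉ p₉ (pin ŝ q₁ (pin gô q₂
        (straight delChoose
          ( _
          , (λ x≡l → _
              , (λ s≡0 → (_ , _ , positive≤ h′) , _ , _ , _
                  , subst (λ t → Chosen m j H l h′ x 0 t h′ x) (sym (∸-positive h′)) (halt-lo x≡l s≡0)
                  , ≤-trans (≤-reflexive (∸-positive h′)) (pred-mono-≤ h≤) , h≤ , x≤ , (refl , refl , refl , refl , refl) , refl)
              , (λ s≢0 → _ , key≤X slo≤ , _ , cell≤X {β} {j} {slo} β≤ j< slo≤ , _
                  , key≤X (proj₁ (cells≤ j slo j< slo≤)) , _ , _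
                  , proceed (pick-lo x≡l s≢0)
                  , proj₁ (cells≤ j slo j< slo≤) , h≤ , proj₁ (cells≤ j slo j< slo≤)
                  , (refl , refl , refl , refl , refl) , refl))
          , (λ x≢l → _
              , (λ x≡h → _
                  , (λ s≡0 → _ , suc-key≤X (s≤s l≤) , _ , _
                      , halt-hi x≢l x≡h s≡0 , l≤ , s≤s l≤ , x≤ , (refl , refl , refl , refl , refl) , refl)
                  , (λ s≢0 → (_ , _ , positive≤ s) , _ , _
                      , subst (λ t → cell β j t ≤ X) (sym (∸-positive s)) (cell≤X {β} {j} {pred s} β≤ j< ps≤)
                      , _ , subst (λ t → hi m j t ≤ X) (sym (∸-positive s)) (suc-key≤X chi≤)
                      , (_ , _ , positive≤ _) , _ , _
                      , suc-key≤X (s≤s y≤)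
                      , subst (λ t → Chosen m j H l h′ x 1 l (suc (hi m j t ∸ (if 0 <ᵇ hi m j t then 1 else 0))) (hi m j t ∸ (if 0 <ᵇ hi m j t then 1 else 0)))
                          (sym (∸-positive s))
                          (subst (λ t → Chosen m j H l h′ x 1 l (suc t) t) (sym (∸-positive chi)) (proceed (pick-hi x≢l x≡h s≢0)))
                      , l≤ , s≤s y≤ , y≤ , (refl , refl , refl , refl , refl) , refl))
              , (λ x≢h → proceed (pick-in x≢l x≢h) , l≤ , h≤ , x≤ , (refl , refl , refl , refl , refl) , refl))))))))))))))
      where
      m = view (M σ) β
      slo = lo m j H
      s = hi m j H
      slo≤ = proj₁ (cells≤ j H j< H≤)
      ps≤ : pred s ≤ L₂
      ps≤ = pred-mono-≤ (proj₂ (cells≤ j H j< H≤))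
      chi = hi m j (pred s)
      chi≤ : chi ≤ suc L₂
      chi≤ = proj₂ (cells≤ j (pred s) j< ps≤)
      y≤ : hi m j (s ∸ (if 0 <ᵇ s then 1 else 0)) ∸ (if 0 <ᵇ hi m j (s ∸ (if 0 <ᵇ s then 1 else 0)) then 1 else 0) ≤ L₂
      y≤ = ≤-trans (≤-reflexive (∸-positive (hi m j (s ∸ (if 0 <ᵇ s then 1 else 0))))) (subst (λ t → pred (hi m j t) ≤ L₂) (sym (∸-positive s)) (pred-mono-≤ chi≤))

    down-run : ∀ {σ m β j H e x l h′ y g} → β + Z ≤ X → suc j < B → H ≤ L₂ → e ≤ L₂ → Bounded m β →
               suc (lo (view m β) (suc j) H) ≢ hi (view m β) (suc j) H →
               Chosen (view m β) j H (lo (view m β) (suc j) H) (hi (view m β) (suc j) H) x g l h′ y →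
               l ≤ L₂ → h′ ≤ suc L₂ → y ≤ L₂ →
               R σ β̂ ≡ β → R σ Ĵ ≡ j → R σ Ĥ ≡ H → R σ ê ≡ e → R σ Â ≡ cell β (suc j) H →
               R σ gô ≡ g → R σ lô ≡ l → R σ hî ≡ h′ → R σ x̂ ≡ y → M σ ≡ m →
               Run (put ⨾ ite (reg gô) delDown stop) σ 160 (Step β j H e x m)
    down-run {σ} {m} {β} {j} {H} {e} {x} {l} {h′} {y} {g} β≤ J< H≤ e≤ cells≤ ≢1 ch l≤ h≤ y≤ p₁ p₂ p₃ p₄ p₅ p₆ p₇ p₈ p₉ refl =
      within 160 (pin β̂ p₁ (pin Ĵ p₂ (pin Ĥ p₃ (pin ê p₄ (pin Â p₅ (pin gô p₆ (pin lô p₇ (pin hî p₈ (pin x̂ p₉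
        (exec put _
          (if-step _
            (λ g≢0 → exec (û := op shr (reg x̂) (clᵉ (reg ê))) _
              (pin û (cong (y ≫_) (cl-def e))
                (exec (Ĉ := cellᵉ û) (_ , cell≤X {β} {j} {u} β≤ j< u≤)
                (exec (lô := mem[ reg Ĉ ]) (_ , key≤X ul≤)
                (exec (hî := mem[ succᵉ (reg Ĉ) ]) (_ , suc-key≤X uh≤)
                  (if-step _
                    (λ one → finish (mem[ reg Ĉ ]:= reg lô ⨾ mem[ succᵉ (reg Ĉ) ]:= lit 0 ⨾ x̂ := reg û ⨾ ê := flᵉ (reg ê)) _
                       (next (node-at refl refl refl (fl-def e) refl β≤ j< H≤ (≤-trans (fl≤ e) e≤) u≤
                              (store₂-bounded m₁ β {j} {u} ul 0 j< u≤ ul≤ z≤n bnd₁))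
                            (Off-trans {β} {m} off₁ (store₂-off m₁ β {j} {u} ul 0 j< u≤))
                            (del-summary ≢1 (picked-of ch g≢0) upd₁ one (store₂-upd m₁ β {j} {u} ul 0 j< u≤))))
                    (λ ≢one → finish (Ĥ := reg û ⨾ ê := clᵉ (reg ê)) (_ , _ , ≤-trans (≤-reflexive (+-comm e 1)) (suc-key≤X (s≤s e≤)))
                      (next (node-at refl refl refl (cl-def e) refl β≤ j< u≤ (≤-trans (cl≤ e) e≤) y≤ bnd₁) off₁
                              (del-cluster ≢1 (picked-of ch g≢0) upd₁ ≢one)))))))))
            (λ g≡0 → finish stop _ (halt refl (halted ch g≡0 upd₁ , bnd₁ , off₁))))))))))))))
      where
      u = y ≫ cl e
      j< = <-trans (n<1+n j) J<
      u≤ = ≤-trans (≫≤ y (cl e)) y≤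
      m₁ = store₂ m (cell β (suc j) H) l h′
      upd₁ = store₂-upd m β {suc j} {H} l h′ J< H≤
      bnd₁ = store₂-bounded m β {suc j} {H} l h′ J< H≤ l≤ h≤ cells≤
      off₁ = store₂-off m β {suc j} {H} l h′ J< H≤
      ul = lo (view m₁ β) j u
      ul≤ : ul ≤ L₂
      ul≤ = proj₁ (bnd₁ j u j< u≤)
      uh≤ : hi (view m₁ β) j u ≤ suc L₂
      uh≤ = proj₂ (bnd₁ j u j< u≤)
      picked-of : ∀ {m j H l h x g l′ h′ x′} → Chosen m j H l h x g l′ h′ x′ → g ≢ 0 → Pick m j H l h x l′ h′ x′
      picked-of (halt-lo _ _) g≢0 = contradiction refl g≢0
      picked-of (halt-hi _ _ _) g≢0 = contradiction refl g≢0
      picked-of (proceed p) _ = p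
      halted : ∀ {g l h′ y m′} → Chosen (view m β) j H (lo (view m β) (suc j) H) (hi (view m β) (suc j) H) x g l h′ y → g ≡ 0 →
               Upd (view m β) m′ (suc j) H (l , h′) → Del (view m β) (suc j) H e x m′
      halted (halt-lo p q) _ U = del-lo ≢1 p q U
      halted (halt-hi p q r) _ U = del-hi ≢1 p q r U

    body-run : ∀ {σ β j H e x} → Node-at σ β (suc j) H e x → Run delBody σ 300 (Step β j H e x (M σ))
    body-run {σ} {β} {j} {H} {e} {x} N = within 300 (pin-node N
      (exec load ((_ , cell≤X {β} {suc j} {H} β≤ J< H≤) , (_ , key≤X l≤) , (_ , suc-key≤X h≤))
        (if-step _
          (λ one → finish (mem[ reg Â ]:= reg lô ⨾ mem[ succᵉ (reg Â) ]:= lit 0 ⨾ stop) _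
            (halt refl (del-one one (store₂-upd (M σ) β {suc j} {H} (lo m (suc j) H) 0 J< H≤)
                       , store₂-bounded (M σ) β {suc j} {H} (lo m (suc j) H) 0 J< H≤ l≤ z≤n cells≤
                       , store₂-off (M σ) β {suc j} {H} (lo m (suc j) H) 0 J< H≤)))
          (λ ≢1 → exec (Ĵ := op sub (reg Ĵ) (lit 1) ⨾ Ĉ := cellᵉ Ĥ ⨾ ŝ := mem[ succᵉ (reg Ĉ) ] ⨾ gô := lit 1)
                    (((_ , _ , s≤s z≤n) , _) , (_ , cell≤X {β} {j} {H} β≤ j< H≤) , (_ , suc-key≤X (proj₂ (cells≤ j H j< H≤))) , _)
            (choose-run {a = cell β (suc j) H} β≤ j< H≤ cells≤ l≤ h≤ x≤ refl refl refl refl refl refl refl refl refl refl refl ▷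
              λ { (ch , l≤′ , h≤′ , x≤′ , (p₁ , p₂ , p₃ , p₄ , p₅) , p₆) →
                down-run β≤ J< H≤ e≤ cells≤ ≢1 ch l≤′ h≤′ x≤′ p₁ p₂ p₃ p₄ p₅ refl refl refl refl p₆ })))))
      where
      open Node-at N
      m = view (M σ) β
      j< = <-trans (n<1+n j) J<
      l≤ = proj₁ (cells≤ (suc j) H J< H≤)
      h≤ = proj₂ (cells≤ (suc j) H J< H≤)

    delete-run : ∀ J {σ β H e x} → Node-at σ β J H e x → Run delLoop σ (J * 302 + 2) (Done β J H e x (M σ))
    delete-run = loop 300 del-leaf body-run

  module SuccRun where

    succᵛ-lo : ∀ m j H e x → x < lo m (suc j) H → succᵛ m (suc j) H e x ≡ lo m (suc j) H
    succᵛ-lo m j H e x p rewrite <⇒<ᵇ≡ p = refl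

    succᵛ-cluster : ∀ m j H e x → lo m (suc j) H ≤ x → suc x < hi m j (x ≫ cl e) →
                    succᵛ m (suc j) H e x ≡ succᵛ m j (x ≫ cl e) (cl e) x
    succᵛ-cluster m j H e x p q rewrite ≥⇒<ᵇ≡ p | <⇒<ᵇ≡ q = refl

    succᵛ-summary : ∀ m j H e x → lo m (suc j) H ≤ x → hi m j (x ≫ cl e) ≤ suc x → suc (x ≫ cl e) < hi m j H →
                    succᵛ m (suc j) H e x ≡ lo m j (succᵛ m j H (fl e) (x ≫ cl e))
    succᵛ-summary m j H e x p q r rewrite ≥⇒<ᵇ≡ p | ≥⇒<ᵇ≡ q | <⇒<ᵇ≡ r = refl

    succᵛ-hi : ∀ m j H e x → lo m (suc j) H ≤ x → hi m j (x ≫ cl e) ≤ suc x → hi m j H ≤ suc (x ≫ cl e) →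
               succᵛ m (suc j) H e x ≡ pred (hi m (suc j) H)
    succᵛ-hi m j H e x p q r rewrite ≥⇒<ᵇ≡ p | ≥⇒<ᵇ≡ q | ≥⇒<ᵇ≡ r = refl

    -- With J levels to go, the path p leaves room for J more bits below `2 ^ Jr`, so the path word
    -- always fits into a register.
    Turns : ℕ → ℕ → Set
    Turns p J = suc p * 2 ^ J ≤ 2 ^ Jr

    turn : ∀ {p q j} → suc q ≤ suc p * 2 → Turns p (suc j) → Turns q j
    turn {p} {q} {j} q≤ t = ≤-trans (*-monoˡ-≤ (2 ^ j) q≤) (≤-trans (≤-reflexive (*-assoc (suc p) 2 (2 ^ j))) t)

    turn≤X : ∀ {p j} → Turns p (suc j) → suc (p * 2) ≤ X
    turn≤X {p} {j} t = begin
      suc (p * 2)       ≤⟨ n≤1+n _ ⟩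
      suc p * 2         ≤⟨ *-monoʳ-≤ (suc p) (m≤m*n 2 (2 ^ j) {{m^n≢0 2 j}}) ⟩
      suc p * 2 ^ suc j ≤⟨ t ⟩
      2 ^ Jr            ≤⟨ 2^h≤ ⟩
      X                 ∎
      where open ≤-Reasoning

    -- How deep the descent gets is known only at run time. The invariant therefore names the final
    -- outcome: unwinding from the present state gives what unwinding the whole search would give.
    record Landed (β d J p y : ℕ) (m : ℕ → ℕ) (σ : Store) : Set where
      constructor landed
      field
        {J′ d′} : ℕ
        β≡ : R σ β̂ ≡ β
        J≡ : R σ Ĵ ≡ J′
        M≡ : M σ ≡ m
        J+d : J′ + d′ ≡ Jr
        y≤  : R σ ŷ ≤ L₂
        climb≡ : climb (view m β) d′ J′ (R σ P̂) (R σ ŷ) ≡ climb (view m β) d J p y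

    data Step (β d j p y : ℕ) (m : ℕ → ℕ) (σ : Store) : Set where
      halt : R σ gô ≡ 0 → Landed β d (suc j) p y m σ → Step β d j p y m σ
      next : ∀ {H e x q} → Node-at σ β j H e x → R σ P̂ ≡ q → R σ gô ≡ 1 → R σ ŷ ≡ 0 → M σ ≡ m →
             Turns q j →
             climb (view m β) (suc d) j q (succᵛ (view m β) j H e x) ≡ climb (view m β) d (suc j) p y →
             Step β d j p y m σ

    record Turning (σ : Store) (β j H e x p : ℕ) (m : ℕ → ℕ) : Set where
      constructor turning
      field
        β≡ : R σ β̂ ≡ β
        J≡ : R σ Ĵ ≡ j
        H≡ : R σ Ĥ ≡ H
        e≡ : R σ ê ≡ e
        x≡ : R σ x̂ ≡ x
        u≡ : R σ û ≡ x ≫ cl e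
        p≡ : R σ P̂ ≡ p
        g≡ : R σ gô ≡ 1
        y≡ : R σ ŷ ≡ 0
        h≡ : R σ hî ≡ hi (view m β) (suc j) H
        M≡ : M σ ≡ m

    module _ {β d j H e x p : ℕ} {m : ℕ → ℕ} (β≤ : β + Z ≤ X) (J< : suc j < B) (H≤ : H ≤ L₂) (e≤ : e ≤ L₂) (x≤ : x ≤ L₂)
             (cells≤ : Bounded m β) (jd : suc j + d ≡ Jr) (t : Turns p (suc j))
             (l≤x : lo (view m β) (suc j) H ≤ x) where
      private
        v = view m β
        u = x ≫ cl e
        j< : j < B
        j< = <-trans (n<1+n j) J<
        u≤ : u ≤ L₂
        u≤ = ≤-trans (≫≤ x (cl e)) x≤

      Turned : Store → Set
      Turned = Step β d j p (succᵛ v (suc j) H e x) m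

      summary-run : ∀ {σ} → Turning σ β j H e x p m → hi v j u ≤ suc x → Run summaryTurn σ 60 Turned
      summary-run {mk ρ _} (turning q₁ q₂ q₃ q₄ q₅ q₆ q₇ q₈ q₉ q₁₀ refl) u≤x =
        within 60 (pin β̂ q₁ (pin Ĵ q₂ (pin Ĥ q₃ (pin ê q₄ (pin û q₆ (pin P̂ q₇ (pin hî q₁₀
          (exec (Ĉ := cellᵉ Ĥ ⨾ ŝ := mem[ succᵉ (reg Ĉ) ])
             ((_ , cell≤X {β} {j} {H} β≤ j< H≤) , (_ , suc-key≤X (proj₂ (cells≤ j H j< H≤))))
            (if-step _
              (λ u<s → finish (x̂ := reg û ⨾ ê := flᵉ (reg ê) ⨾ P̂ := succᵉ (op mul (reg P̂) (lit 2)))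
                (_ , _ , (_ , turn≤X {p} {j} t))
                (next (node-at refl refl refl (fl-def e) refl β≤ j< H≤ (≤-trans (fl≤ e) e≤) u≤ cells≤) refl q₈ q₉ refl
                  (turn {p} {suc (p * 2)} {j} ≤-refl t)
                  (trans (climb-odd v d j p _) (cong (climb v d (suc j) p) (sym (succᵛ-summary v j H e x l≤x u≤x u<s))))))
              (λ s≤u → finish (ŷ := predᵉ (reg hî) ⨾ gô := lit 0 ⨾ Ĵ := succᵉ (reg Ĵ))
                (((_ , _ , positive≤ (hi v (suc j) H)) , _) , _ , (_ , ≤-trans (<⇒≤ J<) B≤X))
                (halt refl (landed {d′ = d} refl refl refl jd
                  (≤-trans (≤-reflexive (∸-positive (hi v (suc j) H))) (pred-mono-≤ (proj₂ (cells≤ (suc j) H J< H≤))))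
                  (cong (climb v d (suc j) p) (trans (∸-positive (hi v (suc j) H)) (sym (succᵛ-hi v j H e x l≤x u≤x s≤u))))))))))))))))

      cluster-run : ∀ {σ} → Turning σ β j H e x p m → Run clusterTurn σ 100 Turned
      cluster-run {mk ρ _} (turning q₁ q₂ q₃ q₄ q₅ q₆ q₇ q₈ q₉ q₁₀ refl) =
        within 100 (pin β̂ q₁ (pin Ĵ q₂ (pin ê q₄ (pin x̂ q₅ (pin û q₆ (pin P̂ q₇
          (exec (Ĉ := cellᵉ û ⨾ ŝ := mem[ succᵉ (reg Ĉ) ])
             ((_ , cell≤X {β} {j} {u} β≤ j< u≤) , (_ , suc-key≤X (proj₂ (cells≤ j u j< u≤))))
            (if-step _
              (λ x<u → finish (Ĥ := reg û ⨾ ê := clᵉ (reg ê) ⨾ P̂ := op mul (reg P̂) (lit 2))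
                (_ , (_ , ≤-trans (≤-reflexive (+-comm e 1)) (suc-key≤X (s≤s e≤))) , (_ , ≤-trans (n≤1+n _) (turn≤X {p} {j} t)))
                (next (node-at refl refl refl (cl-def e) refl β≤ j< u≤ (≤-trans (cl≤ e) e≤) x≤ cells≤) refl q₈ q₉ refl
                  (turn {p} {p * 2} {j} (n≤1+n _) t)
                  (trans (climb-even v d j p _) (cong (climb v d (suc j) p) (sym (succᵛ-cluster v j H e x l≤x x<u))))))
              (λ u≤x → summary-run (turning refl refl q₃ refl refl refl refl q₈ q₉ q₁₀ refl) u≤x)))))))))

    body-run : ∀ {σ β d j H e x p} → Node-at σ β (suc j) H e x → R σ P̂ ≡ p → R σ gô ≡ 1 → R σ ŷ ≡ 0 →
               suc j + d ≡ Jr → Turns p (suc j) →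
               Run succBody σ 300 (Step β d j p (succᵛ (view (M σ) β) (suc j) H e x) (M σ))
    body-run {σ} {β} {d} {j} {H} {e} {x} {p} N p≡ g≡ y≡ jd t = within 300 (pin-node N
      (exec load ((_ , cell≤X {β} {suc j} {H} β≤ J< H≤) , (_ , key≤X l≤) , (_ , suc-key≤X h≤))
        (if-step _
          (λ x<l → finish (ŷ := reg lô ⨾ gô := lit 0) _
            (halt refl (landed {d′ = d} refl refl refl jd l≤
              (trans (cong (λ q → climb m d (suc j) q (lo m (suc j) H)) p≡) (cong (climb m d (suc j) p) (sym (succᵛ-lo m j H e x x<l)))))))
          (λ l≤x → exec (Ĵ := op sub (reg Ĵ) (lit 1) ⨾ û := op shr (reg x̂) (clᵉ (reg ê))) (((_ , _ , s≤s z≤n) , _) , _)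
            (cluster-run β≤ J< H≤ e≤ x≤ cells≤ jd t l≤x
              (turning refl refl refl refl refl (cong (x ≫_) (cl-def e)) p≡ g≡ y≡ refl refl))))))
      where
      open Node-at N
      m = view (M σ) β
      l≤ = proj₁ (cells≤ (suc j) H J< H≤)
      h≤ = proj₂ (cells≤ (suc j) H J< H≤)

    descend-run : ∀ J {σ β d H e x p} → Node-at σ β J H e x → R σ P̂ ≡ p → R σ gô ≡ 1 → R σ ŷ ≡ 0 →
                  J + d ≡ Jr → Turns p J →
                  Run succLoop σ (J * 304 + 4) (Landed β d J p (succᵛ (view (M σ) β) J H e x) (M σ))
    descend-run zero {σ} {β} {d} {p = p} N refl g≡ y≡ jd t = while-step {t = 0} {u = 0} _
      -- The initial value 0 of `ŷ` agrees with the value of `succᵛ` at level 0.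
      (λ _ → landed (Node-at.β≡ N) (Node-at.J≡ N) refl jd (subst (_≤ L₂) (sym y≡) z≤n)
        (cong (climb (view (M σ) β) d 0 (R σ P̂)) y≡))
      (λ (_ , J≢0) → contradiction (Node-at.J≡ N) J≢0)
    descend-run (suc j) {σ} {β} {d} {H} {e} {x} {p} N p≡ g≡ y≡ jd t =
      weaken (≤-reflexive (sym (+-assoc 304 (j * 304) 4))) id
        (while-step {t = 300} _
          (λ { (inj₁ g≡0) → contradiction (trans (sym g≡) g≡0) λ () ; (inj₂ J≡0) → contradiction (trans (sym (Node-at.J≡ N)) J≡0) λ () })
          λ _ → weaken ≤-refl rest (body-run N p≡ g≡ y≡ jd t))
      where
      rest : ∀ {σ′} → Step β d j p (succᵛ (view (M σ) β) (suc j) H e x) (M σ) σ′ →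
             Run succLoop σ′ (j * 304 + 4) (Landed β d (suc j) p (succᵛ (view (M σ) β) (suc j) H e x) (M σ))
      rest (halt g≡0 D) = weaken (m≤n+m 4 (j * 304)) id
        (while-step {t = 0} {u = 0} _ (λ _ → D) (λ (g≢0 , _) → contradiction g≡0 g≢0))
      rest {mk _ _} (next N′ p≡′ g≡′ y≡′ refl t′ c≡) = weaken ≤-refl
        (λ (landed q₁ q₂ q₃ q₄ q₅ q₆) → landed q₁ q₂ q₃ q₄ q₅ (trans q₆ c≡))
        (descend-run j N′ p≡′ g≡′ y≡′ (trans (+-suc j d) jd) t′)

    ascend-run : ∀ d {σ β J p y} → β + Z ≤ X → Bounded (M σ) β → R σ β̂ ≡ β → R σ Ĵ ≡ J → R σ P̂ ≡ p → R σ ŷ ≡ y →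
                 y ≤ L₂ → J + d ≡ Jr →
                 Run ascLoop σ (d * 50 + 4) (λ σ′ → R σ′ ŷ ≡ climb (view (M σ) β) d J p y × M σ′ ≡ M σ)
    ascend-run zero {J = J} β≤ bnd β≡ J≡ p≡ y≡ y≤ jd = while-step {t = 0} {u = 0} _
      (λ _ → y≡ , refl)
      (λ J< → contradiction (trans J≡ (trans (sym (+-identityʳ J)) jd)) (<⇒≢ J<))
    ascend-run (suc d) {σ} {β} {J} {p} {y} β≤ bnd β≡ J≡ p≡ y≡ y≤ jd =
      weaken (≤-reflexive (sym (+-assoc 50 (d * 50) 4))) id
        (while-step {t = 46} _
          (λ J≥ → contradiction (≤-trans J≥ (≤-reflexive J≡)) (<⇒≱ J<))
          λ _ → within 46 (pin β̂ β≡ (pin Ĵ J≡ (pin P̂ p≡ (pin ŷ y≡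
            (if-step {Q = λ σ′ → R σ′ β̂ ≡ β × R σ′ Ĵ ≡ J × R σ′ P̂ ≡ p × R σ′ ŷ ≡ y′ × M σ′ ≡ M σ} _
              (λ odd → finish (Ĉ := cellᵉ ŷ ⨾ ŷ := mem[ reg Ĉ ]) ((_ , cell≤X {β} {J} {y} β≤ J<B y≤) , (_ , key≤X (proj₁ (bnd J y J<B y≤))))
                (refl , refl , refl , pick-odd odd , refl))
              (λ even → finish skip _ (refl , refl , refl , pick-even even , refl))
            ▷ λ { {mk ρ _} (q₁ , q₂ , q₃ , q₄ , refl) → pin β̂ q₁ (pin Ĵ q₂ (pin P̂ q₃ (pin ŷ q₄
                (finish (P̂ := op div (reg P̂) (lit 2) ⨾ Ĵ := succᵉ (reg Ĵ))
                  (_ , (_ , ≤-trans (m≤n⇒m≤1+n J<) B≤X))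
                  (ascend-run d β≤ bnd refl refl refl refl y′≤ (trans (sym (+-suc J d)) jd)))))) }))))))
      where
      J< : J < Jr
      J< = ≤-trans (≤-trans (m≤m+n (suc J) d) (≤-reflexive (sym (+-suc J d)))) (≤-reflexive jd)
      J<B : J < B
      J<B = m≤n⇒m≤1+n J<
      y′ = if p % 2 ≡ᵇ 0 then y else lo (view (M σ) β) J y
      pick-odd : p % 2 ≢ 0 → lo (view (M σ) β) J y ≡ y′
      pick-odd q rewrite ≢⇒≡ᵇ q = refl
      pick-even : p % 2 ≡ 0 → y ≡ y′
      pick-even q rewrite q = refl
      y′≤ : y′ ≤ L₂
      y′≤ with p % 2 ≡ᵇ 0
      ... | true  = y≤
      ... | false = proj₁ (bnd J y J<B y≤)

  -- Sets of block numbers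

  -- Block c is the vertex `L + c` of the trie, ℓ levels below the root 1.
  Coded : Keys → Keys
  Coded Q y = ∃ λ c → Q c × y ≡ L + c

  record Set-at (m : ℕ → ℕ) (β : ℕ) (Q : Keys) : Set where
    constructor set-at
    field
      good  : Good (view m β) Jr 1 ℓ (Coded Q)
      bnd   : Bounded m β
      range : ∀ {c} → Q c → c < L
  open Set-at public

  private
    under : ∀ {Q : Keys} → (∀ {c} → Q c → c < L) → ∀ {y} → Coded Q y → y ≫ ℓ ≡ 1
    under r (c , p , refl) = ≫-root ℓ (r p)

    1≤L : 1 ≤ L
    1≤L = ≤-trans (s≤s z≤n) (n<2^n ℓ)

    root : ∀ {σ β c} → β + Z ≤ X → R σ β̂ ≡ β → R σ x̂ ≡ L + c → R σ Ĵ ≡ Jr → R σ Ĥ ≡ 1 → R σ ê ≡ ℓ →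
           c < L → Bounded (M σ) β → Node-at σ β Jr 1 ℓ (L + c)
    root β≤ p q r s t c< bd = node-at p r s t q β≤ ≤-refl (≤-trans 1≤L (m≤m+n L L)) (≤-trans (<⇒≤ (n<2^n ℓ)) (m≤m+n L L)) (+-monoʳ-≤ L (<⇒≤ c<)) bd

    foot≤ : ∀ {H′} r → r ≤ pred ℓ → H′ ≫ r ≡ 1 → H′ ≤ L₂
    foot≤ r q s = <⇒≤ (<-≤-trans (≫≡1⇒< r s) (+-mono-≤ p p))
      where
      p : 2 ^ r ≤ L
      p = ^-monoʳ-≤ 2 {r} {ℓ} (≤-trans q pred[n]≤n)

    level : ℓ + ℓ ≤ 2 ^ Jr
    level = +-mono-≤ ℓ≤ (≤-trans ℓ≤ (≤-reflexive (sym (+-identityʳ (2 ^ h)))))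

  Set-cong : ∀ {m β Q Q′} → (∀ {c} → Q c → Q′ c) → (∀ {c} → Q′ c → Q c) → Set-at m β Q → Set-at m β Q′
  Set-cong f g (set-at a c d) = set-at
    (Good-cong Jr (λ (c , p , q) → c , f p , q) (λ (c , p , q) → c , g p , q) a) c (d ∘ g)

  Set-frame : ∀ {m m′ β Q} → (∀ z → z < Z → m′ (β + z) ≡ m (β + z)) → Set-at m β Q → Set-at m′ β Q
  Set-frame {m} {m′} {β} f (set-at a bd d) = set-at
    (Good-frame Jr a λ { {J′} {H′} (p , r , q , s) → same J′ H′ (s≤s p) (foot≤ r q s) })
    (λ J H J< H≤ → subst₂ (λ s t → s ≤ L₂ × t ≤ suc L₂) (sym (cong proj₁ (same J H J< H≤))) (sym (cong proj₂ (same J H J< H≤))) (bd J H J< H≤))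
    d
    where
    same : ∀ J H → J < B → H ≤ L₂ → view m′ β J H ≡ view m β J H
    same J H J< H≤ = cong₂ _,_ (f (2 * (H * B + J)) (<-trans (n<1+n _) (offset< J< H≤)))
      (subst (λ t → m′ t ≡ m t) (+-suc β _) (f (suc (2 * (H * B + J))) (offset< J< H≤)))

  Set-empty : ∀ {m β Q} → (∀ {c} → ¬ Q c) → (∀ z → z < Z → m (β + z) ≡ 0) → Set-at m β Q
  Set-empty {m} {β} {Q} none f = set-at
    (Good-empty Jr (λ (_ , p , _) → none p) λ { {J′} {H′} (p , r , q , s) → zeros J′ H′ (s≤s p) (foot≤ r q s) })
    (λ J H J< H≤ → subst₂ (λ s t → s ≤ L₂ × t ≤ suc L₂) (sym (cong proj₁ (zeros J H J< H≤))) (sym (cong proj₂ (zeros J H J< H≤))) (z≤n , z≤n))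
    (λ p → contradiction p none)
    where
    zeros : ∀ J H → J < B → H ≤ L₂ → view m β J H ≡ (0 , 0)
    zeros J H J< H≤ = cong₂ _,_ (f (2 * (H * B + J)) (<-trans (n<1+n _) (offset< J< H≤)))
      (subst (λ t → m t ≡ 0) (+-suc β _) (f (suc (2 * (H * B + J))) (offset< J< H≤)))

  private
    code-injective : ∀ {Q c} → Coded Q (L + c) → Q c
    code-injective {Q} (c′ , p , q) = subst Q (sym (+-cancelˡ-≡ L _ _ q)) p

    -- The constant c is paid by the one copy of t that `suc J` has in excess of J; B is `suc Jr`.
    linear : ∀ J t a c {_ : T (a ≤ᵇ t)} {_ : T (c ≤ᵇ t)} → J * a + c ≤ suc J * t
    linear J t a c {p} {q} =
      ≤-trans (+-mono-≤ (*-monoʳ-≤ J (≤ᵇ⇒≤ a t p)) (≤ᵇ⇒≤ c t q)) (≤-reflexive (+-comm (J * t) t))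

  insert-run : ∀ {σ β Q c} → β + Z ≤ X → R σ β̂ ≡ β → R σ x̂ ≡ L + c → c < L → ¬ Q c → Set-at (M σ) β Q →
               Run insertᶜ σ (B * 320) (λ σ′ → Set-at (M σ′) β (Q ∪ c) × Off β (M σ) (M σ′))
  insert-run {σ} {β} {Q} {c} β≤ p q c< c∉ (set-at g bd r) =
    weaken (≤-trans (≤-reflexive (trans (+-comm 6 (Jr * 302 + 2)) (+-assoc (Jr * 302) 2 6))) (linear Jr 320 302 8)) id
      (exec rootᶜ _ (weaken ≤-refl (λ {σ′} → post {σ′}) (InsRun.insert-run Jr (root β≤ p q refl refl refl c< bd))))
    where
    post : ∀ {σ′} → InsRun.Done β Jr 1 ℓ (L + c) (M σ) σ′ → Set-at (M σ′) β (Q ∪ c) × Off β (M σ) (M σ′)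
    post (I , bd′ , off) =
      set-at (Good-cong Jr (λ { (inj₁ (c , p , q)) → c , inj₁ p , q ; (inj₂ p) → c , inj₂ refl , p })
                           (λ { (c , inj₁ p , q) → inj₁ (c , p , q) ; (c , inj₂ refl , q) → inj₂ q })
               (proj₁ (Ins-good ≤-refl I g (c∉ ∘ code-injective) (under r) (≫-root ℓ c<) ≤-refl 1≤ℓ level)))
        bd′ (λ { (inj₁ p) → r p ; (inj₂ refl) → c< }) , off

  delete-run : ∀ {σ β Q c} → β + Z ≤ X → R σ β̂ ≡ β → R σ x̂ ≡ L + c → Q c → Set-at (M σ) β Q →
               Run deleteᶜ σ (B * 320) (λ σ′ → Set-at (M σ′) β (Q ∖ c) × Off β (M σ) (M σ′))
  delete-run {σ} {β} {Q} {c} β≤ p q c∈ (set-at g bd r) =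
    weaken (≤-trans (≤-reflexive (trans (+-comm 6 (Jr * 302 + 2)) (+-assoc (Jr * 302) 2 6))) (linear Jr 320 302 8)) id
      (exec rootᶜ _ (weaken ≤-refl (λ {σ′} → post {σ′}) (DelRun.delete-run Jr (root β≤ p q refl refl refl (r c∈) bd))))
    where
    post : ∀ {σ′} → DelRun.Done β Jr 1 ℓ (L + c) (M σ) σ′ → Set-at (M σ′) β (Q ∖ c) × Off β (M σ) (M σ′)
    post (D , bd′ , off) =
      set-at (Good-cong Jr (λ { ((c , p , refl) , q) → c , (p , λ { refl → q refl }) , refl })
                           (λ { (c , (p , s) , refl) → (c , p , refl) , λ t → s (+-cancelˡ-≡ L _ _ t) })
               (proj₁ (Del-good ≤-refl D g (c , c∈ , refl) (under r) ≤-refl 1≤ℓ)))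
        bd′ (r ∘ proj₁) , off

  successor-run : ∀ {σ β Q c} → β + Z ≤ X → R σ β̂ ≡ β → R σ x̂ ≡ L + c → c < L → Set-at (M σ) β Q →
                  suc (L + c) < hi (view (M σ) β) Jr 1 →
                  Run successorᶜ σ (B * 400) (λ σ′ → M σ′ ≡ M σ × ∃ λ c′ →
                    R σ′ ŷ ≡ L + c′ × Q c′ × c < c′ × (∀ {d} → Q d → c < d → c′ ≤ d))
  successor-run {σ} {β} {Q} {c} β≤ p q c< (set-at g bd r) <h =
    weaken t≤ id (exec (rootᶜ ⨾ P̂ := lit 0 ⨾ gô := lit 1 ⨾ ŷ := lit 0) _
      (SuccRun.descend-run Jr {d = 0} (root β≤ p q refl refl refl c< bd) refl refl refl (+-identityʳ Jr)
        (≤-reflexive (*-identityˡ (2 ^ Jr))) ▷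
       λ { {mk ρ _} (SuccRun.landed {J′} {d′} q₁ q₂ refl q₄ q₅ q₆) →
         weaken (+-monoˡ-≤ 4 (*-monoˡ-≤ 50 (≤-trans (m≤n+m d′ J′) (≤-reflexive q₄))))
           (λ { (s , t) → t , post (trans s q₆) })
           (SuccRun.ascend-run d′ {p = R (mk ρ (M σ)) P̂} {y = R (mk ρ (M σ)) ŷ} β≤ bd q₁ q₂ refl refl q₅ q₄) }))
    where
    post : ∀ {y} → y ≡ succᵛ (view (M σ) β) Jr 1 ℓ (L + c) →
           ∃ λ c′ → y ≡ L + c′ × Q c′ × c < c′ × (∀ {d} → Q d → c < d → c′ ≤ d)
    post refl with succᵛ-good Jr g (under r) (≫-root ℓ c<) <h
    ... | (c′ , p , q) , s , t = c′ , q , p , +-cancelˡ-< L c c′ (subst (L + c <_) q s) ,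
      λ {d} p′ c<d → +-cancelˡ-≤ L c′ d (subst (_≤ L + d) q (t (d , p′ , refl) (+-monoʳ-< L c<d)))
    t≤ : 12 + ((Jr * 304 + 4) + (Jr * 50 + 4)) ≤ B * 400
    t≤ = ≤-trans (≤-reflexive (solve 1 (λ J → con 12 :+ ((J :* con 304 :+ con 4) :+ (J :* con 50 :+ con 4)) :≈ J :* con 354 :+ con 20) refl Jr)) (linear Jr 400 354 20)

  -- Next occurrences in the text

  2^k≤W : 2 ^ k ≤ W
  2^k≤W = ≤width n k h ℓ (≤-trans (m≤m+n (2 ^ k) n) (≤-trans (m≤m+n (2 ^ k + n) Z) (m≤m+n (2 ^ k + n + Z) 64)))

  k<W : k < W
  k<W = <-≤-trans (n<2^n k) 2^k≤W

  n+Z≤W : n + Z ≤ W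
  n+Z≤W = ≤width n k h ℓ (≤-trans (+-monoˡ-≤ Z (m≤n+m n (2 ^ k))) (m≤m+n (2 ^ k + n + Z) 64))

  n+64≤W : n + 64 ≤ W
  n+64≤W = ≤width n k h ℓ (+-monoˡ-≤ 64 (≤-trans (m≤n+m n (2 ^ k)) (m≤m+n (2 ^ k + n) Z)))

  B≤Z : B ≤ Z
  B≤Z = ≤-trans (m≤n*m B (suc L₂)) (m≤n*m (suc L₂ * B) 2)

  block≤X : ∀ {c} → c * B ≤ n → suc c * B ≤ X
  block≤X {c} p = ≤-trans (+-mono-≤ B≤Z p) (≤-trans (≤-reflexive (+-comm Z n)) (≤-trans n+Z≤W W≤X))

  3W*W≤X : ∀ {a z} → a < W + W + W → z ≤ W → a * W + z ≤ X
  3W*W≤X {a} {z} a< z≤ = begin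
    a * W + z           ≤⟨ +-monoʳ-≤ (a * W) z≤ ⟩
    a * W + W           ≡⟨ +-comm (a * W) W ⟩
    suc a * W           ≤⟨ *-monoˡ-≤ W a< ⟩
    (W + W + W) * W     ≤⟨ m≤m+n _ (W * W) ⟩
    (W + W + W) * W + W * W ≡⟨ solve 1 (λ w → (w :+ w :+ w) :* w :+ w :* w :≈ con 4 :* (w :* w)) refl W ⟩
    4 * (W * W)         ≡⟨ limit-def n k h ℓ ⟩
    X                   ∎
    where open ≤-Reasoning

  base : ℕ → ℕ
  base i = (W + i) * W

  base+Z≤X : ∀ {i} → i < k → base i + Z ≤ X
  base+Z≤X i<k = 3W*W≤X (≤-trans (+-monoʳ-< W (<-trans i<k k<W)) (m≤m+n (W + W) W)) Z≤W

  n≤X : n ≤ X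
  n≤X = ≤-trans (≤-trans (m≤m+n n Z) n+Z≤W) W≤X

  suc-n≤X : suc n ≤ X
  suc-n≤X = ≤-trans (≤-trans (≤-trans (≤-reflexive (+-comm 1 n)) (+-monoʳ-≤ n (s≤s z≤n))) n+64≤W) W≤X

  -- Describes the minimum of `suc c * B` and n by membership, so that later arguments need not
  -- single out the last, possibly shorter block.
  record BlockEnd (c E : ℕ) : Set where
    constructor block-end
    field
      E≤n : E ≤ n
      in-block  : ∀ {x} → x < n → x / B ≤ c → x < E
      of-block  : ∀ {x} → x < E → x / B ≤ c
  open BlockEnd public

  end-run : ∀ {σ c} → R σ rblk ≡ c → c * B ≤ n → Run endᶜ σ 20 (λ σ′ → M σ′ ≡ M σ × BlockEnd c (R σ′ rend)
            × R σ′ rsym ≡ R σ rsym × R σ′ rp ≡ R σ rp × R σ′ rq ≡ R σ rq × R σ′ rblk ≡ c)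
  end-run {σ} {c} p c≤ = within 20 (pin rblk p
    (exec (rend := op mul (succᵉ (reg rblk)) (reg rB)) (_ , block≤X {c} c≤)
      (if-step _
        (λ n<E → finish (rend := reg rn) _ (refl , block-end ≤-refl (λ x<n _ → x<n) (λ x<n → below (<-trans x<n n<E)) , refl , refl , refl , refl))
        (λ E≤n → finish skip _ (refl , block-end E≤n (λ _ q → above′ q) below , refl , refl , refl , refl)))))
    where
    below : ∀ {x} → x < suc c * B → x / B ≤ c
    below {x} x< = s≤s⁻¹ (m<n*o⇒m/o<n {x} {suc c} {B} x<)
    above′ : ∀ {x} → x / B ≤ c → x < suc c * B
    above′ {x} q = ≰⇒> λ c≤x → <⇒≱ (s≤s q) (≤-trans (≤-reflexive (sym (m*n/n≡m (suc c) B))) (/-monoˡ-≤ B c≤x))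

  -- B is positive, so additive constants are charged to multiples of B.
  budget : ∀ a c t {_ : T (a + c ≤ᵇ t)} → B * a + c ≤ B * t
  budget a c t {p} = begin
    B * a + c     ≤⟨ +-monoʳ-≤ (B * a) (m≤n*m c B) ⟩
    B * a + B * c ≡⟨ sym (*-distribˡ-+ B a c) ⟩
    B * (a + c)   ≤⟨ *-monoʳ-≤ B (≤ᵇ⇒≤ (a + c) t p) ⟩
    B * t         ∎
    where open ≤-Reasoning

  block≤⇒≤/ : ∀ {c x} → c * B ≤ x → c ≤ x / B
  block≤⇒≤/ {c} p = ≤-trans (≤-reflexive (sym (m*n/n≡m c B))) (/-monoˡ-≤ B p)

  ≤/⇒block≤ : ∀ {c x} → c ≤ x / B → c * B ≤ x
  ≤/⇒block≤ {c} {x} p = ≤-trans (*-monoˡ-≤ B p) (m/n*n≤m x B)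

  module Text-search (t : ℕ → ℕ) where
    open Packings n k t

    Text-at : (ℕ → ℕ) → Set
    Text-at m = ∀ {x} → x < n → m x ≡ t x

    Has : ℕ → Keys
    Has i c = ∃ λ x → x < n × t x ≡ i × x / B ≡ c

    Trees-at : (ℕ → ℕ) → Set
    Trees-at m = ∀ {i} → i < k → Set-at m (base i) (Has i)

    record Found (i p E q : ℕ) : Set where
      constructor found
      field
        p≤q  : p ≤ q
        q≤E  : q ≤ E
        miss : ∀ {x} → p ≤ x → x < q → t x ≢ i
        hit  : q < E → t q ≡ i

    scan-run : ∀ d {σ i p E} → R σ rq ≡ p → R σ rend ≡ E → R σ rsym ≡ i → p + d ≡ E → E ≤ n → Text-at (M σ) →
               Run scanᶜ σ (d * 20 + 16) (λ σ′ → M σ′ ≡ M σ × Found i p E (R σ′ rq))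
    scan-run d {σ} {i} {p} {E} refl refl refl pd E≤n txt = go d pd
      where
      stay : E ≤ p ⊎ M σ p ≡ i → M σ ≡ M σ × Found i p E p
      stay q = refl , found ≤-refl (≤-trans (m≤m+n p d) (≤-reflexive pd)) (λ p≤x x<p → contradiction (≤-<-trans p≤x x<p) (n≮n _))
        λ p<E → [ (λ E≤p → contradiction (<-≤-trans p<E E≤p) (n≮n _)) , (λ s → trans (sym (txt (<-≤-trans p<E E≤n))) s) ]′ q
      go : ∀ d → p + d ≡ E → Run scanᶜ σ (d * 20 + 16) (λ σ′ → M σ′ ≡ M σ × Found i p E (R σ′ rq))
      go zero pd = within 16 (while-step {t = 0} {u = 0} _ stay
        (λ (p<E , _) → contradiction (trans (sym (+-identityʳ p)) pd) (<⇒≢ p<E)))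
      go (suc d) pd = weaken (≤-reflexive (sym (+-assoc 20 (d * 20) 16))) id
        (while-step {t = 9} _ stay λ (p<E , ne) →
          within 9 (finish (rq := succᵉ (reg rq)) (_ , ≤-trans p<E (≤-trans E≤n n≤X))
            (weaken ≤-refl
              (λ (q , found a c f g) → q , found (≤-trans (n≤1+n p) a) c
                 (λ {x} p≤x x<q → [ (λ p<x → f p<x x<q) , (λ { refl r → ne (trans (txt (<-≤-trans p<E E≤n)) r) }) ]′ (m≤n⇒m<n∨m≡n p≤x)) g)
              (scan-run d refl refl refl (trans (sym (+-suc p d)) pd) E≤n txt))))

    scan-block : ∀ {σ i c p E} → R σ rq ≡ p → R σ rend ≡ E → R σ rsym ≡ i → c * B ≤ p → p ≤ E → BlockEnd c E → Text-at (M σ) →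
                 Run scanᶜ σ (B * 40) (λ σ′ → (M σ′ ≡ M σ × Found i p E (R σ′ rq)) × ∀ r → r < 24 → R σ′ r ≡ R σ r)
    scan-block {c = c} {p} {E} a f g c≤p p≤E be txt =
      weaken (≤-trans (+-mono-≤ (*-monoˡ-≤ 20 d≤B) (≤-trans (≤ᵇ⇒≤ 16 20 _) (m≤n*m 20 B))) (≤-reflexive (sym (*-distribˡ-+ B 20 20)))) id
        (framed 24 (scan-run (E ∸ p) a f g (m+[n∸m]≡n p≤E) (E≤n be) txt))
      where
      d≤B : E ∸ p ≤ B
      d≤B = begin
        E ∸ p               ≤⟨ ∸-monoʳ-≤ E c≤p ⟩
        E ∸ c * B           ≤⟨ ∸-monoˡ-≤ (c * B) E≤ ⟩
        suc c * B ∸ c * B   ≡⟨ m+n∸n≡m B (c * B) ⟩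
        B                   ∎
        where
        open ≤-Reasoning
        E≤ : E ≤ suc c * B
        E≤ = ≮⇒≥ λ <E → 1+n≰n (≤-trans (≤-reflexive (sym (m*n/n≡m (suc c) B))) (of-block be <E))

    farᶜ : Cmd
    farᶜ = probeᶜ ⨾
           ite (op lt (succᵉ (reg x̂)) (reg ŝ))
             (successorᶜ ⨾ (rblk := op sub (reg ŷ) (reg rL) ⨾ rq := op mul (reg rblk) (reg rB)) ⨾ endᶜ ⨾ scanᶜ)
             (rq := reg rn)

    far-run : ∀ {σ i p E} → R σ rsym ≡ i → R σ rblk ≡ p / B → p < n → i < k → Text-at (M σ) → Trees-at (M σ) →
              BlockEnd (p / B) E → (∀ {x} → p ≤ x → x < E → t x ≢ i) →
              Run farᶜ σ (B * 520) (λ σ′ → M σ′ ≡ M σ × Next i p (R σ′ rq))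
    far-run {σ} {i} {p} {E} q₁ q₂ p<n i<k txt trees be none =
      weaken (≤-trans (≤-reflexive (solve 1 (λ x → con 29 :+ (con 6 :+ x :* con 480) :≈ x :* con 480 :+ con 35) refl B)) (budget 480 35 520)) id
       (pin rsym q₁ (pin rblk q₂
        (exec probeᶜ (((_ , β≤X) , (_ , c+L≤X)) , _ , _ , (_ , cell≤X {base i} {Jr} {1} (base+Z≤X i<k) ≤-refl 1≤L₂) , (_ , suc-key≤X (proj₂ (bnd S Jr 1 ≤-refl 1≤L₂))))
          (branch {t = B * 480} _
            (λ <h → weaken (≤-trans (≤-reflexive (solve 1 (λ x → x :* con 400 :+ (con 8 :+ (con 20 :+ x :* con 40)) :≈ x :* con 440 :+ con 28) refl B)) (budget 440 28 480)) id
              (framed 30 (successor-run (base+Z≤X i<k) refl refl c<L S <h) ▷ λ { {mk ρ _} ((refl , c′ , y≡ , has′@(x₀ , x₀<n , tx₀ , x₀/B) , c<c′ , least) , f) →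
                pin ŷ y≡ (pin rsym (f rsym (<ᵇ⇒< rsym 30 _))
                (exec (rblk := op sub (reg ŷ) (reg rL) ⨾ rq := op mul (reg rblk) (reg rB))
                   (((_ , _ , m≤m+n L c′) , _) , (_ , subst (λ z → z * B ≤ X) (sym (m+n∸m≡n L c′)) (≤-trans (block≤ has′) n≤X)))
                  (end-run {c = c′} (m+n∸m≡n L c′) (block≤ has′) ▷ λ { {mk ρ′ _} (refl , be′ , e₁ , _ , e₃ , _) →
                    weaken ≤-refl (λ { ((refl , F) , _) → refl , next-found has′ c<c′ least be′ F })
                      (scan-block (trans e₃ (cong (_* B) (m+n∸m≡n L c′))) refl e₁ ≤-refl (<⇒≤ (block< has′ be′)) be′ txt) }))) }))
            (λ h≤ → weaken (≤-trans (≤ᵇ⇒≤ 2 480 _) (m≤n*m 480 B)) id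
              (finish (rq := reg rn) _ (refl , next-at ≤-refl (absent h≤) (contradiction refl ∘ <⇒≢))))))))
      where
      S = trees i<k
      c = p / B
      c<L : c < L
      c<L = ≤-<-trans (/-monoˡ-≤ B (<⇒≤ p<n)) blocks
      β≤X : base i ≤ X
      β≤X = ≤-trans (m≤m+n (base i) Z) (base+Z≤X i<k)
      c+L≤X : L + c ≤ X
      c+L≤X = key≤X (+-monoʳ-≤ L (<⇒≤ c<L))
      1≤L₂ : 1 ≤ L₂
      1≤L₂ = ≤-trans (≤-trans (s≤s z≤n) c<L) (m≤m+n L L)
      block≤ : ∀ {c′} → Has i c′ → c′ * B ≤ n
      block≤ (x , x<n , _ , refl) = ≤-trans (m/n*n≤m x B) (<⇒≤ x<n)
      block< : ∀ {c′ E} → Has i c′ → BlockEnd c′ E → c′ * B < E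
      block< (x , x<n , _ , refl) be = ≤-<-trans (m/n*n≤m x B) (in-block be x<n ≤-refl)
      beyond : ∀ {x} → p ≤ x → x < n → t x ≡ i → c < x / B
      beyond p≤x x<n tx = ≰⇒> λ x/B≤ → none p≤x (in-block be x<n x/B≤) tx
      -- The root stores its maximum plus one, so the hypothesis says that no block after c contains
      -- i.
      absent : hi (view (M σ) (base i)) Jr 1 ≤ suc (L + c) → ∀ {x} → p ≤ x → x < n → t x ≢ i
      absent h≤ {x} p≤x x<n tx = <⇒≱ (beyond p≤x x<n tx)
        (+-cancelˡ-≤ L _ _ (s≤s⁻¹ (≤-trans (Good-<hi Jr (good S) (x / B , (x , x<n , tx , refl) , refl)) h≤)))
      next-found : ∀ {c′ E′ q} → Has i c′ → c < c′ → (∀ {d} → Has i d → c < d → c′ ≤ d) → BlockEnd c′ E′ →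
               Found i (c′ * B) E′ q → Next i p q
      next-found {c′} {E′} {q} (x₀ , x₀<n , tx₀ , refl) c<c′ least be′ (found a e f g) = next-at (≤-trans e (E≤n be′)) miss
        λ _ → ≮⇒≥ (λ q<p → <⇒≱ c<c′ (block≤⇒≤/ (≤-trans a (<⇒≤ q<p)))) , g q<E′
        where
        -- The tree promises an occurrence somewhere in the block, and a scan from the start of the
        -- block cannot miss it.
        q<E′ : q < E′
        q<E′ = ≤∧≢⇒< e λ { refl → f (m/n*n≤m x₀ B) (in-block be′ x₀<n ≤-refl) tx₀ }
        miss : ∀ {x} → p ≤ x → x < q → t x ≢ i
        miss {x} p≤x x<q tx = f (≤/⇒block≤ (least (x , x<n , tx , refl) (beyond p≤x x<n tx))) x<q tx
          where x<n = <-≤-trans x<q (≤-trans e (E≤n be′))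

    nxt-run : ∀ {σ i p} → R σ rsym ≡ i → R σ rp ≡ p → i < k → Text-at (M σ) → Trees-at (M σ) →
              Run nxtᶜ σ (B * 600) (λ σ′ → M σ′ ≡ M σ × Next i p (R σ′ rq))
    nxt-run {σ} {i} {p} q₁ q₂ i<k txt trees =
      weaken (≤-trans (≤-reflexive (+-comm 4 (B * 596))) (budget 596 4 600)) id (pin rsym q₁ (pin rp q₂
      (branch {t = B * 596} _
        (λ p<n → weaken (≤-trans (≤-reflexive (solve 1 (λ x → con 6 :+ (con 20 :+ (x :* con 40 :+ (con 4 :+ x :* con 520))) :≈ x :* con 560 :+ con 30) refl B)) (budget 560 30 596)) id
          (exec (rblk := op div (reg rp) (reg rB) ⨾ rq := reg rp) _
            (end-run {c = p / B} refl (≤-trans (m/n*n≤m p B) (<⇒≤ p<n)) ▷ λ { {mk ρ₁ _} (refl , be , e₁ , _ , e₃ , e₄) →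
             scan-block {p = p} e₃ refl e₁ (m/n*n≤m p B) (<⇒≤ (in-block be p<n ≤-refl)) be txt ▷ λ { {mk ρ₂ _} ((refl , found a e f g) , fr′) →
             branch {t = B * 520} _
               (λ q<E → weaken (≤-trans (≤ᵇ⇒≤ 1 520 _) (m≤n*m 520 B)) id
                 (finish skip _ (refl , next-at (≤-trans e (E≤n be)) f λ _ → a , g (subst (_ <_) (fr′ rend (<ᵇ⇒< rend 24 _)) q<E))))
               (λ E≤q → far-run (trans (fr′ rsym (<ᵇ⇒< rsym 24 _)) e₁) (trans (fr′ rblk (<ᵇ⇒< rblk 24 _)) e₄) p<n i<k txt trees be
                 (λ p≤x x<E → f p≤x (<-≤-trans (subst (_ <_) (sym (fr′ rend (<ᵇ⇒< rend 24 _))) x<E) E≤q))) } })))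
        (λ n≤p → weaken (≤-trans (≤ᵇ⇒≤ 2 596 _) (m≤n*m 596 B)) id
          (finish (rq := reg rn) _ (refl , next-at ≤-refl (λ p≤x x<n _ → contradiction (<-≤-trans x<n n≤p) (≤⇒≯ p≤x)) (contradiction refl ∘ <⇒≢)))))))

  -- The subset recursion

  -- Verified once for an abstract routine `nx` of time T, since initialization and updates find
  -- next occurrences differently. `Inv` is what the routine requires of the memory, and `stable`
  -- says that writing the subset table preserves it.
  module Subsets (t : ℕ → ℕ) (nx : Cmd) (nx-above : Above 22 nx) (T : ℕ) (Inv : (ℕ → ℕ) → Set)
    (stable : ∀ {m S v} → S < 2 ^ k → Inv m → Inv (m [ W + S ↦ v ]))
    (nx-run : ∀ {σ i p} → R σ rsym ≡ i → R σ rp ≡ p → i < k → p ≤ suc n → Inv (M σ) →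
              Run nx σ T (λ σ′ → M σ′ ≡ M σ × Packings.Next n k t i p (R σ′ rq))) where
    open Packings n k t

    -- The state of the inner loop: v competes only with packings whose rightmost factor belongs to
    -- a symbol below i. At i = k these are all packings, provided that S is nonempty.
    record Partial (S i v : ℕ) : Set where
      constructor partial
      field
        v≤     : v ≤ suc n
        packs′ : v ≤ n → Packing S v
        least′ : ∀ {e j} → e ≤ n → (P : Packing S e) → j < i → Last P j → v ≤ e

    Solved : (ℕ → ℕ) → ℕ → Set
    Solved m S = ∀ S′ → S′ < S → Optimal S′ (m (W + S′))

    Off-table : (ℕ → ℕ) → (ℕ → ℕ) → Set
    Off-table m m′ = ∀ a → (∀ S → S < 2 ^ k → a ≢ W + S) → m′ a ≡ m a

    private
      2^k≤X : 2 ^ k ≤ X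
      2^k≤X = ≤-trans 2^k≤W W≤X

      framed-nx : ∀ {σ t Q} → Run nx σ t Q → Run nx σ t (λ σ′ → Q σ′ × ∀ r → r < 22 → R σ′ r ≡ R σ r)
      framed-nx = framed 22 {w = nx-above}

    step-run : ∀ {σ S i v} → R σ rS ≡ S → R σ rsym ≡ i → R σ rbest ≡ v → i < k → S < 2 ^ k →
               Partial S i v → Solved (M σ) S → Inv (M σ) →
               Run (stepᶜ nx ⨾ rsym := succᵉ (reg rsym)) σ (T + T + 60) (λ σ′ → M σ′ ≡ M σ × R σ′ rS ≡ S
                 × R σ′ rsym ≡ suc i × ∃ λ v′ → R σ′ rbest ≡ v′ × Partial S (suc i) v′)
    step-run {σ} {S} {i} {v} q₁ q₂ q₃ i<k S< (partial v≤ pk ls) sol inv =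
      weaken (≤-trans (≤-reflexive (solve 1 (λ x → con 6 :+ (con 9 :+ (x :+ (con 4 :+ (x :+ con 10)))) :+ con 4 :≈ x :+ x :+ con 33) refl T)) (+-monoʳ-≤ (T + T) (≤ᵇ⇒≤ 33 60 _))) id
      (pin rS q₁ (pin rsym q₂ (pin rbest q₃
        (branch {t = 9 + (T + (4 + (T + 10)))} {Q = λ σ′ → M σ′ ≡ M σ × R σ′ rS ≡ S × R σ′ rsym ≡ i × ∃ λ v′ → R σ′ rbest ≡ v′ × Partial S (suc i) v′} _
          (λ b≢0 → let i∈S = bit≡1 b≢0 ; O = sol _ (below i∈S) in
            exec (rp := mem[ op add (reg rW) (op sub (reg rS) (op shl (lit 1) (reg rsym))) ])
              ((_ , (_ , (_ , _ , shl≤) , ≤-trans (≤-reflexive (*-identityˡ (2 ^ i))) (bit⇒2^≤ {i} i∈S)) , _) ,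
               subst (λ z → M σ (W + (S ∸ z)) ≤ X) (sym (*-identityˡ (2 ^ i))) (≤-trans (Optimal.v≤ O) suc-n≤X))
              (framed-nx (nx-run {i = i} {p = M σ (W + (S ∸ 2 ^ i))} refl (cong (λ z → M σ (W + (S ∸ z))) (*-identityˡ (2 ^ i))) i<k (Optimal.v≤ O) inv) ▷
               λ { {mk ρ₁ _} ((refl , N₁) , f₁) →
                 pin rS (f₁ rS (<ᵇ⇒< rS 22 _)) (pin rsym (f₁ rsym (<ᵇ⇒< rsym 22 _)) (pin rbest (f₁ rbest (<ᵇ⇒< rbest 22 _))
                 (exec (rp := succᵉ (reg rq)) (_ , ≤-trans (s≤s (Next.q≤n N₁)) suc-n≤X)
                 (framed-nx (nx-run {i = i} {p = suc (ρ₁ rq)} refl refl i<k (s≤s (Next.q≤n N₁)) inv) ▷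
                  λ { {mk ρ₂ _} ((refl , N₂) , f₂) →
                    pin rS (f₂ rS (<ᵇ⇒< rS 22 _)) (pin rsym (f₂ rsym (<ᵇ⇒< rsym 22 _)) (pin rbest (f₂ rbest (<ᵇ⇒< rbest 22 _))
                    (branch {t = 4} _
                      (λ q<v → finish (rbest := succᵉ (reg rq)) (_ , ≤-trans (s≤s (Next.q≤n N₂)) suc-n≤X)
                        (refl , refl , refl , _ , refl , partial (s≤s (Next.q≤n N₂)) (extend i<k i∈S O N₁ N₂)
                          (λ e≤n P j<si L → [ (λ j<i → ≤-trans (<⇒≤ q<v) (ls e≤n P j<i L)) , (λ { refl → bound-last i<k i∈S O N₁ N₂ e≤n P L }) ]′ (m≤n⇒m<n∨m≡n (s≤s⁻¹ j<si)))))
                      (λ v≤q → weaken (≤ᵇ⇒≤ 1 4 _) id (finish skip _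
                        (refl , refl , refl , _ , refl , partial v≤ pk
                          (λ e≤n P j<si L → [ (λ j<i → ls e≤n P j<i L) , (λ { refl → ≤-trans v≤q (bound-last i<k i∈S O N₁ N₂ e≤n P L) }) ]′ (m≤n⇒m<n∨m≡n (s≤s⁻¹ j<si))))))))) })))) }))
          (λ b≡0 → weaken (s≤s z≤n) id (finish skip _
            (refl , refl , refl , _ , refl , partial v≤ pk
               (λ e≤n P j<si L → [ (λ j<i → ls e≤n P j<i L) , (λ { refl → contradiction (trans (sym (proj₁ (proj₂ L))) b≡0) λ () }) ]′ (m≤n⇒m<n∨m≡n (s≤s⁻¹ j<si))))))
         ▷ λ { {mk ρ _} (refl , e₁ , e₂ , v′ , e₃ , P) → pin rsym e₂
              (finish (rsym := succᵉ (reg rsym)) (_ , ≤-trans (s≤s (<⇒≤ i<k)) (≤-trans k<W W≤X)) (refl , e₁ , refl , v′ , e₃ , P)) }))))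
      where
      shl≤ : 1 * 2 ^ i ≤ X
      shl≤ = ≤-trans (≤-reflexive (*-identityˡ (2 ^ i))) (≤-trans (^-monoʳ-≤ 2 (<⇒≤ i<k)) 2^k≤X)
      bit≡1 : bit i S ≢ 0 → bit i S ≡ 1
      bit≡1 ne = [ (λ p → contradiction p ne) , id ]′ (even-or-odd (S ≫ i))
      -- Removing a symbol lowers the number of the set, so the table can be filled in numerical
      -- order.
      below : bit i S ≡ 1 → S ∸ 2 ^ i < S
      below p = ∸-monoʳ-< {S} {2 ^ i} {0} (m^n>0 2 i) (bit⇒2^≤ {i} p)

    inner-run : ∀ d {σ S i v} → i + d ≡ k → R σ rS ≡ S → R σ rsym ≡ i → R σ rbest ≡ v → S < 2 ^ k →
                Partial S i v → Solved (M σ) S → Inv (M σ) →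
                Run (innerᶜ nx) σ (d * (T + T + 64) + 8) (λ σ′ → M σ′ ≡ M σ × R σ′ rS ≡ S
                  × ∃ λ v′ → R σ′ rbest ≡ v′ × Partial S k v′)
    inner-run zero {i = i} id≡k q₁ q₂ q₃ S< P sol inv = within 8 (while-step {t = 0} {u = 0} _
      (λ _ → refl , q₁ , _ , q₃ , subst (λ i → Partial _ i _) (trans (sym (+-identityʳ i)) id≡k) P)
      λ i<k → contradiction (trans q₂ (trans (sym (+-identityʳ i)) id≡k)) (<⇒≢ i<k))
    inner-run (suc d) {σ} {S} {i} id≡k q₁ q₂ q₃ S< P sol inv =
      weaken (≤-reflexive (solve 2 (λ x y → con 4 :+ (x :+ con 60) :+ (y :+ con 8) :≈ x :+ con 64 :+ y :+ con 8) refl (T + T) (d * (T + T + 64)))) id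
      (while-step {t = T + T + 60} _ (λ k≤i → contradiction (≤-trans k≤i (≤-reflexive q₂)) (<⇒≱ i<k))
        λ _ → weaken ≤-refl
          (λ { {mk ρ _} (refl , e₁ , e₂ , v′ , e₃ , P′) → inner-run d (trans (sym (+-suc i d)) id≡k) e₁ e₂ e₃ S< P′ sol inv })
          (step-run q₁ q₂ q₃ i<k S< P sol inv))
      where
      i<k : i < k
      i<k = ≤-trans (m≤m+n (suc i) d) (≤-reflexive (trans (sym (+-suc i d)) id≡k))

    private
      partial-0 : ∀ {S} → Partial S 0 (suc n)
      partial-0 = partial ≤-refl (λ p → contradiction p 1+n≰n) (λ _ _ ())

      finished : ∀ {S v} → S < 2 ^ k → S ≢ 0 → Partial S k v → Optimal S v
      finished S< S≢0 (partial v≤ pk ls) = optimal v≤ pk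
        λ e≤n P → let i , L = last-exists P S< S≢0 in ls e≤n P (proj₁ L) L

      extend-table : ∀ m S v → Solved m S → Optimal S v → Solved (m [ W + S ↦ v ]) (suc S)
      extend-table m S v sol O S′ (s≤s S′≤S) = [ old , new ]′ (m≤n⇒m<n∨m≡n S′≤S)
        where
        old : S′ < S → Optimal S′ ((m [ W + S ↦ v ]) (W + S′))
        old S′<S = subst (Optimal S′) (sym (↦-there m {W + S} v {W + S′} (λ e → <⇒≢ S′<S (+-cancelˡ-≡ W S′ S e)))) (sol S′ S′<S)
        new : S′ ≡ S → Optimal S′ ((m [ W + S ↦ v ]) (W + S′))
        new refl = subst (Optimal S) (sym (↦-here m (W + S) v)) O

    outer-run : ∀ d {σ S} → S + d ≡ 2 ^ k → R σ rS ≡ S → 1 ≤ S → Solved (M σ) S → Inv (M σ) →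
                Run (outerᶜ nx) σ (d * (k * (T + T + 64) + 40) + 8)
                  (λ σ′ → Solved (M σ′) (2 ^ k) × Inv (M σ′) × Off-table (M σ) (M σ′))
    outer-run zero {σ} {S} sd q₁ 1≤S sol inv = within 8 (while-step {t = 0} {u = 0} _
      (λ _ → subst (Solved (M σ)) (trans (sym (+-identityʳ S)) sd) sol , inv , λ _ _ → refl)
      λ S<K → contradiction (trans q₁ (trans (sym (+-identityʳ S)) sd)) (<⇒≢ S<K))
    outer-run (suc d) {σ} {S} sd q₁ 1≤S sol inv =
      weaken (≤-trans (≤-reflexive (solve 2 (λ x y → con 4 :+ (con 6 :+ (x :+ con 8 :+ con 9)) :+ (y :+ con 8) :≈ x :+ con 27 :+ y :+ con 8) refl (k * (T + T + 64)) (d * (k * (T + T + 64) + 40))))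
                 (+-monoˡ-≤ 8 (+-monoˡ-≤ (d * (k * (T + T + 64) + 40)) (+-monoʳ-≤ (k * (T + T + 64)) (≤ᵇ⇒≤ 27 40 _))))) id
      (while-step {t = 6 + (k * (T + T + 64) + 8 + 9)} _ (λ K≤S → contradiction (≤-trans K≤S (≤-reflexive q₁)) (<⇒≱ S<))
        λ _ → pin rS q₁ (exec (rbest := succᵉ (reg rn) ⨾ rsym := lit 0) ((_ , suc-n≤X) , _)
          (inner-run k refl refl refl refl S< partial-0 sol inv ▷
            λ { {mk ρ _} (refl , e₁ , v , e₂ , P) → pin rS e₁ (pin rbest e₂
              (finish (mem[ op add (reg rW) (reg rS) ]:= reg rbest ⨾ rS := succᵉ (reg rS))
                (_ , (_ , ≤-trans S< 2^k≤X))
                (weaken ≤-refl (λ (p , q , r) → p , q , λ a ne → trans (r a ne) (↦-there (M σ) v (ne S S<)))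
                  (outer-run d (trans (sym (+-suc S d)) sd) refl (s≤s z≤n) (extend-table (M σ) S v sol (finished S< S≢0 P)) (stable S< inv))))) })))
      where
      S< : S < 2 ^ k
      S< = ≤-trans (m≤m+n (suc S) d) (≤-reflexive (trans (sym (+-suc S d)) sd))
      S≢0 : S ≢ 0
      S≢0 refl = contradiction 1≤S λ ()

    dp-run : ∀ {σ} → Inv (M σ) →
             Run (dpᶜ nx) σ (2 ^ k * (k * (T + T + 64) + 80))
               (λ σ′ → (∃ λ v → Optimal (2 ^ k ∸ 1) v × R σ′ rans ≡ (if v <ᵇ suc n then 1 else 0))
                     × Inv (M σ′) × Off-table (M σ) (M σ′))
    dp-run {σ} inv = weaken time≤ id
      (exec (mem[ reg rW ]:= lit 0 ⨾ rS := lit 1) _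
        -- The entry of the empty set is written before the loop. For k = 0 the loop makes no round,
        -- and this entry is also that of the full alphabet.
        (outer-run (2 ^ k ∸ 1) (m+[n∸m]≡n (m^n>0 2 k)) refl ≤-refl sol (stable′ inv) ▷
          λ (sol′ , inv′ , off) → let O = sol′ (2 ^ k ∸ 1) (∸-monoʳ-< {2 ^ k} {1} {0} (s≤s z≤n) (m^n>0 2 k)) in
            finish (rp := mem[ op add (reg rW) (op sub (reg rK) (lit 1)) ] ⨾ rans := op lt (reg rp) (succᵉ (reg rn)))
              (((_ , (_ , _ , m^n>0 2 k) , _) , ≤-trans (Optimal.v≤ O) suc-n≤X) , _)
              ((_ , O , refl) , inv′ , λ a ne → trans (off a ne) (↦-there (M σ) 0 (λ e → ne 0 (m^n>0 2 k) (trans e (sym (+-identityʳ W))))))))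
      where
      time≤ : 5 + ((2 ^ k ∸ 1) * (k * (T + T + 64) + 40) + 8 + 13) ≤ 2 ^ k * (k * (T + T + 64) + 80)
      time≤ = begin
        5 + ((2 ^ k ∸ 1) * c + 8 + 13) ≤⟨ +-monoʳ-≤ 5 (+-monoˡ-≤ 13 (+-monoˡ-≤ 8 (*-monoˡ-≤ c (m∸n≤m (2 ^ k) 1)))) ⟩
        5 + (2 ^ k * c + 8 + 13)       ≡⟨ solve 1 (λ x → con 5 :+ (x :+ con 8 :+ con 13) :≈ x :+ con 26) refl (2 ^ k * c) ⟩
        2 ^ k * c + 26                 ≤⟨ +-monoʳ-≤ (2 ^ k * c) (≤-trans (≤ᵇ⇒≤ 26 40 _) (m≤n*m 40 (2 ^ k) {{m^n≢0 2 k}})) ⟩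
        2 ^ k * c + 2 ^ k * 40         ≡⟨ sym (*-distribˡ-+ (2 ^ k) c 40) ⟩
        2 ^ k * (c + 40)               ≡⟨ cong (2 ^ k *_) (+-assoc (k * (T + T + 64)) 40 40) ⟩
        2 ^ k * (k * (T + T + 64) + 80) ∎
        where
        open ≤-Reasoning
        c = k * (T + T + 64) + 40
      stable′ : ∀ {m} → Inv m → Inv (m [ W ↦ 0 ])
      stable′ {m} i = subst (λ a → Inv (m [ a ↦ 0 ])) (+-identityʳ W) (stable (m^n>0 2 k) i)
      sol : Solved (M σ [ W ↦ 0 ]) 1
      sol zero _ = subst (Optimal 0) (sym (trans (cong (M σ [ W ↦ 0 ]) (+-identityʳ W)) (↦-here (M σ) W 0))) optimal-∅
      sol (suc _) (s≤s ())

  -- Zones of memory, and the construction of trees and tables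

  -- Memory is divided into zones of W cells: the text in zone 0, the table of
  -- the subset recursion in zone 1, the tree of symbol i in zone W + i, and
  -- its table of next occurrences in zone W + W + i.
  record Only (a : ℕ) (m m′ : ℕ → ℕ) : Set where
    constructor only
    field
      unchanged : ∀ a′ z → z < W → a′ ≢ a → m′ (a′ * W + z) ≡ m (a′ * W + z)
  open Only

  Only-refl : ∀ {a m} → Only a m m
  Only-refl = only λ _ _ _ _ → refl

  Only-trans : ∀ {a m m′ m″} → Only a m m′ → Only a m′ m″ → Only a m m″
  Only-trans p q = only λ a′ z z< ne → trans (unchanged q a′ z z< ne) (unchanged p a′ z z< ne)

  only-store : ∀ {a} m z v → z < W → Only a m (m [ a * W + z ↦ v ])
  only-store {a} m z v z< = only λ a′ z′ z′< ne →
    ↦-there m {a * W + z} v {a′ * W + z′} (ne ∘ proj₁ ∘ pair-injective {W} {a′} {a} {z′} {z} z′< z<)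

  Off⇒Only : ∀ {i m m′} → Off (base i) m m′ → Only (W + i) m m′
  Off⇒Only {i} off = only λ a′ z z< ne → off (a′ * W + z) λ z′ z′< e →
    ne (proj₁ (pair-injective {W} {a′} {W + i} {z} {z′} z< (<-≤-trans z′< Z≤W) e))

  suc-n<W : suc n < W
  suc-n<W = ≤-trans (≤-trans (≤-reflexive (+-comm 2 n)) (+-monoʳ-≤ n (≤ᵇ⇒≤ 2 64 _))) n+64≤W

  tree≢ : ∀ {i} j → i < k → W + i ≢ W + W + j
  tree≢ {i} j i<k e = <⇒≢ (<-≤-trans (+-monoʳ-< W (<-trans i<k k<W)) (m≤m+n (W + W) j)) e

  zone≢ : ∀ {c} i → c < 64 → c ≢ W + i
  zone≢ i c< = <⇒≢ (<-≤-trans c< (≤-trans 64≤W (m≤m+n W i)))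

  zone≢′ : ∀ {c} i → c < 64 → c ≢ W + W + i
  zone≢′ i c< e = zone≢ (W + i) c< (trans e (+-assoc W W i))

  row : ℕ → ℕ
  row i = (W + W + i) * W

  row≤X : ∀ {i z} → i < k → z ≤ W → row i + z ≤ X
  row≤X i<k = 3W*W≤X (+-monoʳ-< (W + W) (<-trans i<k k<W))

  row≤X′ : ∀ {i} → i < k → row i ≤ X
  row≤X′ {i} i<k = ≤-trans (m≤m+n (row i) 0) (row≤X i<k z≤n)

  there : ∀ m a v {z z′} → z′ ≢ z → (m [ a + z ↦ v ]) (a + z′) ≡ m (a + z′)
  there m a v {z} {z′} ne = ↦-there m {a + z} v {a + z′} (ne ∘ +-cancelˡ-≡ a z′ z)

  module Tables (t : ℕ → ℕ) where
    open Packings n k t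
    open Text-search t

    Table-at : (ℕ → ℕ) → ℕ → Set
    Table-at m i = ∀ p → p ≤ suc n → Next i p (m (row i + p))

    text-only : ∀ {a m m′} → a ≢ 0 → Only a m m′ → Text-at m → Text-at m′
    text-only a≢0 o txt {x} x<n = trans (unchanged o 0 x (<-trans x<n (<-trans (n<1+n n) suc-n<W)) (≢-sym a≢0)) (txt x<n)

    tree-only : ∀ {a m m′ i Q} → a ≢ W + i → Only a m m′ → Set-at m (base i) Q → Set-at m′ (base i) Q
    tree-only {i = i} ne o = Set-frame λ z z< → unchanged o (W + i) z (<-≤-trans z< Z≤W) (≢-sym ne)

    table-only : ∀ {a m m′ i} → a ≢ W + W + i → Only a m m′ → Table-at m i → Table-at m′ i
    table-only {i = i} ne o tab p p≤ = subst (Next i p) (sym (unchanged o (W + W + i) p (≤-<-trans p≤ suc-n<W) (≢-sym ne))) (tab p p≤)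

    zero-run : ∀ {σ i} → R σ rsym ≡ i → i < k →
               Run zeroᶜ σ (Z * 20 + 30) (λ σ′ → (∀ z → z < Z → M σ′ (base i + z) ≡ 0) × Only (W + i) (M σ) (M σ′))
    zero-run {σ} {i} q₁ i<k = weaken time≤ id (pin rsym q₁
      (exec (β̂ := op mul (op add (reg rW) (reg rsym)) (reg rW) ⨾
             rend := op mul (lit 2) (op mul (succᵉ (op add (reg rL) (reg rL))) (reg rB)) ⨾ rq := lit 0)
         ((_ , ≤-trans (m≤m+n (base i) Z) (base+Z≤X i<k)) , (_ , ≤-trans Z≤W W≤X) , _)
         (loop Z refl refl refl refl λ _ ())))
      where
      loop : ∀ d {σ z} → z + d ≡ Z → R σ β̂ ≡ base i → R σ rend ≡ Z → R σ rq ≡ z →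
             (∀ z′ → z′ < z → M σ (base i + z′) ≡ 0) →
             Run zeroLoop σ (d * 20 + 10) (λ σ′ → (∀ z → z < Z → M σ′ (base i + z) ≡ 0) × Only (W + i) (M σ) (M σ′))
      loop zero {σ} {z} zd e₁ e₂ e₃ zs = weaken (≤ᵇ⇒≤ 4 10 _) id (while-step {t = 0} {u = 0} _
        (λ _ → (λ z′ z′< → zs z′ (<-≤-trans z′< (≤-reflexive (trans (sym zd) (+-identityʳ z))))) , Only-refl)
        (λ p → contradiction (trans e₃ (trans (trans (sym (+-identityʳ z)) zd) (sym e₂))) (<⇒≢ p)))
      loop (suc d) {σ} {z} zd e₁ e₂ e₃ zs = weaken (≤-reflexive (sym (+-assoc 20 (d * 20) 10))) id
        (while-step {t = 16} _ (λ p → contradiction (≤-trans (≤-reflexive (sym e₂)) (≤-trans p (≤-reflexive e₃))) (<⇒≱ z<Z))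
         λ _ → weaken (≤ᵇ⇒≤ 9 16 _) id (pin β̂ e₁ (pin rend e₂ (pin rq e₃
           (finish (mem[ op add (reg β̂) (reg rq) ]:= lit 0 ⨾ rq := succᵉ (reg rq)) (_ , (_ , ≤-trans z<Z (≤-trans Z≤W W≤X)))
             (weaken ≤-refl (λ (p , o) → p , Only-trans (only-store (M σ) z 0 (<-≤-trans z<Z Z≤W)) o)
               (loop d (trans (sym (+-suc z d)) zd) refl refl refl zs′)))))))
        where
        z<Z : z < Z
        z<Z = ≤-trans (m≤m+n (suc z) d) (≤-reflexive (trans (sym (+-suc z d)) zd))
        zs′ : ∀ z′ → z′ < suc z → (M σ [ base i + z ↦ 0 ]) (base i + z′) ≡ 0
        zs′ z′ (s≤s z′≤) = [ (λ z′<z → trans (there (M σ) (base i) 0 (<⇒≢ z′<z)) (zs z′ z′<z)) , (λ { refl → ↦-here (M σ) (base i + z) 0 }) ]′ (m≤n⇒m<n∨m≡n z′≤)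
      time≤ : 18 + (Z * 20 + 10) ≤ Z * 20 + 30
      time≤ = ≤-trans (≤-reflexive (trans (+-comm 18 (Z * 20 + 10)) (+-assoc (Z * 20) 10 18))) (+-monoʳ-≤ (Z * 20) (≤ᵇ⇒≤ 28 30 _))

    next-n : ∀ {i p} → n ≤ p → Next i p n
    next-n n≤p = next-at ≤-refl (λ p≤x x<n _ → contradiction (<-≤-trans x<n n≤p) (≤⇒≯ p≤x)) (contradiction refl ∘ <⇒≢)

    next-here : ∀ {i p} → p < n → t p ≡ i → Next i p p
    next-here p<n tp = next-at (<⇒≤ p<n) (λ p≤x x<p → contradiction x<p (≤⇒≯ p≤x)) (λ _ → ≤-refl , tp)

    next-skip : ∀ {i p q} → t p ≢ i → Next i (suc p) q → Next i p q
    next-skip tp (next-at q≤n ms ht) = next-at q≤n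
      (λ p≤x x<q → [ (λ p<x → ms p<x x<q) , (λ { refl → tp }) ]′ (m≤n⇒m<n∨m≡n p≤x))
      (λ q<n → ≤-trans (n≤1+n _) (proj₁ (ht q<n)) , proj₂ (ht q<n))

    table-run : ∀ {σ i} → R σ rsym ≡ i → i < k → Text-at (M σ) →
                Run tableᶜ σ (n * 20 + 40) (λ σ′ → R σ′ rγ ≡ row i × Table-at (M σ′) i × Only (W + W + i) (M σ) (M σ′))
    table-run {σ} {i} q₁ i<k txt = weaken time≤ id (pin rsym q₁
      (exec (rγ := op mul (op add (op add (reg rW) (reg rW)) (reg rsym)) (reg rW) ⨾
          mem[ op add (reg rγ) (reg rn) ]:= reg rn ⨾ mem[ op add (reg rγ) (succᵉ (reg rn)) ]:= reg rn ⨾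
          rq := reg rn ⨾ rp := reg rn) ((_ , row≤X′ i<k) , _)
        (weaken ≤-refl (λ (e , p , o) → e , p , Only-trans only₀ o)
          (loop n ≤-refl refl refl refl refl (next-n ≤-refl) tab₀ (text-only (≢-sym (zone≢′ i (s≤s z≤n))) only₀ txt)))))
      where
      m₀ = M σ [ row i + n ↦ n ] [ row i + suc n ↦ n ]
      only₀ : Only (W + W + i) (M σ) m₀
      only₀ = Only-trans (only-store (M σ) n n (<-trans (n<1+n n) suc-n<W)) (only-store (M σ [ row i + n ↦ n ]) (suc n) n suc-n<W)
      tab₀ : ∀ p → n ≤ p → p ≤ suc n → Next i p (m₀ (row i + p))
      tab₀ p n≤p p≤ = [ (λ p<sn → here₀ (≤-antisym (s≤s⁻¹ p<sn) n≤p)) , here₁ ]′ (m≤n⇒m<n∨m≡n p≤)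
        where
        here₀ : p ≡ n → Next i p (m₀ (row i + p))
        here₀ refl = subst (Next i n) (sym (trans (there (M σ [ row i + n ↦ n ]) (row i) n (<⇒≢ (n<1+n n))) (↦-here (M σ) (row i + n) n))) (next-n ≤-refl)
        here₁ : p ≡ suc n → Next i p (m₀ (row i + p))
        here₁ refl = subst (Next i (suc n)) (sym (↦-here (M σ [ row i + n ↦ n ]) (row i + suc n) n)) (next-n (n≤1+n n))
      loop : ∀ p {σ q} → p ≤ n → R σ rsym ≡ i → R σ rγ ≡ row i → R σ rp ≡ p → R σ rq ≡ q → Next i p q →
             (∀ p′ → p ≤ p′ → p′ ≤ suc n → Next i p′ (M σ (row i + p′))) → Text-at (M σ) →
             Run tableLoop σ (p * 20 + 10) (λ σ′ → R σ′ rγ ≡ row i × Table-at (M σ′) i × Only (W + W + i) (M σ) (M σ′))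
      loop zero p≤n e₁ e₂ e₃ e₄ N tab txt = weaken (≤ᵇ⇒≤ 2 10 _) id (while-step {t = 0} {u = 0} _
        (λ _ → e₂ , (λ p → tab p z≤n) , Only-refl) (λ p≢0 → contradiction e₃ p≢0))
      loop (suc p) {σ} {q} p≤n e₁ e₂ e₃ e₄ N tab txt = weaken (≤-reflexive (sym (+-assoc 20 (p * 20) 10))) id
        (while-step {t = 18} _ (λ p≡0 → contradiction (trans (sym e₃) p≡0) λ ())
         λ _ → weaken (≤ᵇ⇒≤ 16 18 _) id (pin rsym e₁ (pin rγ e₂ (pin rp e₃ (pin rq e₄
           (exec (rp := op sub (reg rp) (lit 1)) ((_ , _ , s≤s z≤n) , _)
           (branch {t = 2} {Q = λ σ′ → M σ′ ≡ M σ × R σ′ rsym ≡ i × R σ′ rγ ≡ row i × R σ′ rp ≡ p × Next i p (R σ′ rq)} _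
              (λ tp → finish (rq := reg rp) _ (refl , refl , refl , refl , next-here p≤n (trans (sym (txt p≤n)) tp)))
              (λ tp → weaken (≤ᵇ⇒≤ 1 2 _) id (finish skip _ (refl , refl , refl , refl , next-skip (tp ∘ trans (txt p≤n)) N)))
            ▷ λ { {mk ρ _} (refl , g₁ , g₂ , g₃ , N′) → pin rsym g₁ (pin rγ g₂ (pin rp g₃
                (finish (mem[ op add (reg rγ) (reg rp) ]:= reg rq) _
                  (weaken ≤-refl (λ (e , p , o) → e , p , Only-trans (only₁ (ρ rq)) o)
                    (loop p (<⇒≤ p≤n) refl refl refl refl N′ (tab′ N′) (text-only (≢-sym (zone≢′ i (s≤s z≤n))) (only₁ (ρ rq)) txt)))))) })))))))
        where
        p<W : p < W
        p<W = <-trans p≤n (<-trans (n<1+n n) suc-n<W)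
        only₁ : ∀ v → Only (W + W + i) (M σ) (M σ [ row i + p ↦ v ])
        only₁ v = only-store (M σ) p v p<W
        tab′ : ∀ {v} → Next i p v → ∀ p′ → p ≤ p′ → p′ ≤ suc n → Next i p′ ((M σ [ row i + p ↦ v ]) (row i + p′))
        tab′ {v} N p′ p≤p′ p′≤ = [ old , new ]′ (m≤n⇒m<n∨m≡n p≤p′)
          where
          old : p < p′ → Next i p′ ((M σ [ row i + p ↦ v ]) (row i + p′))
          old p<p′ = subst (Next i p′) (sym (there (M σ) (row i) v (≢-sym (<⇒≢ p<p′)))) (tab p′ p<p′ p′≤)
          new : p ≡ p′ → Next i p′ ((M σ [ row i + p ↦ v ]) (row i + p′))
          new refl = subst (Next i p) (sym (↦-here (M σ) (row i + p) v)) N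
      time≤ : 24 + (n * 20 + 10) ≤ n * 20 + 40
      time≤ = ≤-trans (≤-reflexive (trans (+-comm 24 (n * 20 + 10)) (+-assoc (n * 20) 10 24))) (+-monoʳ-≤ (n * 20) (≤ᵇ⇒≤ 34 40 _))

    Upto : ℕ → ℕ → Keys
    Upto i c d = Has i d × d < c

    blocks-run : ∀ {σ i} → R σ rsym ≡ i → R σ rγ ≡ row i → i < k → Table-at (M σ) i → Set-at (M σ) (base i) (λ _ → ⊥) →
                 Run blocksᶜ σ (suc (n / B) * (B * 320 + 50) + 20) (λ σ′ → Set-at (M σ′) (base i) (Has i) × Only (W + i) (M σ) (M σ′))
    blocks-run {σ} {i} q₁ q₂ i<k tab S₀ = weaken time≤ id (pin rsym q₁ (pin rγ q₂
      (exec (rnb := succᵉ (op div (reg rn) (reg rB)) ⨾ rblk := lit 0) ((_ , ≤-trans (s≤s (m/n≤m n B)) suc-n≤X) , _)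
        (weaken ≤-refl (λ (S , o) → Set-cong proj₁ (λ (x , x<n , tx , e) → (x , x<n , tx , e) , ≤-trans (≤-reflexive (cong suc (sym e))) (s≤s (/-monoˡ-≤ B (<⇒≤ x<n)))) S , o)
          (loop nb refl refl refl refl refl (Set-cong (λ ()) (λ ()) S₀) tab)))))
      where
      nb = suc (n / B)
      loop : ∀ d {σ c} → c + d ≡ nb → R σ rsym ≡ i → R σ rγ ≡ row i → R σ rnb ≡ nb → R σ rblk ≡ c →
             Set-at (M σ) (base i) (Upto i c) → Table-at (M σ) i →
             Run blockLoop σ (d * (B * 320 + 50) + 10) (λ σ′ → Set-at (M σ′) (base i) (Upto i nb) × Only (W + i) (M σ) (M σ′))
      loop zero {σ} {c} cd e₁ e₂ e₃ e₄ S tab = weaken (≤ᵇ⇒≤ 4 10 _) id (while-step {t = 0} {u = 0} _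
        (λ _ → subst (λ c → Set-at (M σ) (base i) (Upto i c)) (trans (sym (+-identityʳ c)) cd) S , Only-refl)
        (λ p → contradiction (trans e₄ (trans (trans (sym (+-identityʳ c)) cd) (sym e₃))) (<⇒≢ p)))
      loop (suc d) {σ} {c} cd e₁ e₂ e₃ e₄ S tab =
        weaken (≤-trans (≤-reflexive (solve 2 (λ x y → con 4 :+ (con 7 :+ (con 12 :+ (con 10 :+ x) :+ con 4)) :+ (y :+ con 10) :≈ x :+ con 37 :+ y :+ con 10) refl (B * 320) (d * (B * 320 + 50))))
                 (+-monoˡ-≤ 10 (+-monoˡ-≤ (d * (B * 320 + 50)) (+-monoʳ-≤ (B * 320) (≤ᵇ⇒≤ 37 50 _))))) id
        (while-step {t = 7 + (12 + (10 + B * 320) + 4)} _ (λ p → contradiction (≤-trans (≤-reflexive (sym e₃)) (≤-trans p (≤-reflexive e₄))) (<⇒≱ c<nb))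
         λ _ → pin rsym e₁ (pin rγ e₂ (pin rnb e₃ (pin rblk e₄
           (exec (rq := mem[ op add (reg rγ) (op mul (reg rblk) (reg rB)) ]) (_ , ≤-trans (Next.q≤n N) n≤X)
           (branch {t = 10 + B * 320} {Q = λ σ′ → Set-at (M σ′) (base i) (Upto i (suc c)) × Only (W + i) (M σ) (M σ′)
                                        × R σ′ rsym ≡ i × R σ′ rγ ≡ row i × R σ′ rnb ≡ nb × R σ′ rblk ≡ c} _
             (λ (q<n , q<c) → let c∈ = has q<n q<c in exec baseᶜ ((_ , β≤X) , (_ , key≤X (+-monoʳ-≤ L (<⇒≤ c<L))))
               (weaken ≤-refl
                 (λ { {σ′} ((S′ , off) , f) → Set-cong (λ { (inj₁ (p , q)) → p , m≤n⇒m≤1+n q ; (inj₂ refl) → c∈ , ≤-refl })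
                          (λ (p , q) → [ (λ q → inj₁ (p , q)) , inj₂ ]′ (m≤n⇒m<n∨m≡n (s≤s⁻¹ q))) S′
                        , Off⇒Only {i} off , f rsym (<ᵇ⇒< rsym 30 _) , f rγ (<ᵇ⇒< rγ 30 _) , f rnb (<ᵇ⇒< rnb 30 _) , f rblk (<ᵇ⇒< rblk 30 _) })
                 (framed 30 (insert-run (base+Z≤X i<k) refl refl c<L (λ p → <⇒≢ (proj₂ p) refl) S))))
             (λ none → weaken (m≤m+n 1 (9 + B * 320)) id (finish skip _
               (Set-cong (λ (p , q) → p , m≤n⇒m≤1+n q)
                  (λ (p , q) → [ (λ q → p , q) , (λ { refl → contradiction none (hasn't p) }) ]′ (m≤n⇒m<n∨m≡n (s≤s⁻¹ q))) S
               , Only-refl , refl , refl , refl , refl)))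
            ▷ λ { {mk ρ m′} (S′ , o , g₁ , g₂ , g₃ , g₄) → pin rblk g₄
                (finish (rblk := succᵉ (reg rblk)) (_ , ≤-trans c<nb (≤-trans (s≤s (m/n≤m n B)) suc-n≤X))
                  (weaken ≤-refl (λ (p , o′) → p , Only-trans o o′)
                    (loop d (trans (sym (+-suc c d)) cd) g₁ g₂ g₃ refl S′ (table-only (tree≢ i i<k) o tab)))) }))))))
        where
        c<nb : c < nb
        c<nb = ≤-trans (m≤m+n (suc c) d) (≤-reflexive (trans (sym (+-suc c d)) cd))
        c<L : c < L
        c<L = ≤-<-trans (s≤s⁻¹ c<nb) blocks
        β≤X : base i ≤ X
        β≤X = ≤-trans (m≤m+n (base i) Z) (base+Z≤X i<k)
        c*B≤n : c * B ≤ n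
        c*B≤n = ≤/⇒block≤ (s≤s⁻¹ c<nb)
        q = M σ (row i + c * B)
        N : Next i (c * B) q
        N = tab (c * B) (m≤n⇒m≤1+n c*B≤n)
        has : q < n → q < suc c * B → Has i c
        has q<n q<c = q , q<n , proj₂ (Next.hit N q<n) ,
          ≤-antisym (s≤s⁻¹ (m<n*o⇒m/o<n {q} {suc c} {B} q<c)) (block≤⇒≤/ (proj₁ (Next.hit N q<n)))
        hasn't : Has i c → ¬ (n ≤ q ⊎ suc c * B ≤ q)
        hasn't (x , x<n , tx , x/B) none = [ (λ n≤q → <⇒≱ (≤-<-trans q≤x x<n) n≤q) , (λ c≤q → <⇒≱ (≤-<-trans q≤x x<) c≤q) ]′ none
          where
          q≤x : q ≤ x
          q≤x = ≮⇒≥ λ x<q → Next.miss N (≤/⇒block≤ (≤-reflexive (sym x/B))) x<q tx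
          x< : x < suc c * B
          x< = ≰⇒> λ c≤x → <⇒≱ (s≤s (≤-reflexive x/B)) (block≤⇒≤/ c≤x)
      time≤ : 8 + (nb * (B * 320 + 50) + 10) ≤ nb * (B * 320 + 50) + 20
      time≤ = ≤-trans (≤-reflexive (trans (+-comm 8 (nb * (B * 320 + 50) + 10)) (+-assoc (nb * (B * 320 + 50)) 10 8))) (+-monoʳ-≤ (nb * (B * 320 + 50)) (≤ᵇ⇒≤ 18 20 _))

  record Built (t m : ℕ → ℕ) (i : ℕ) : Set where
    constructor built
    open Text-search t
    open Tables t
    field
      text-ok  : Text-at m
      trees-ok : ∀ {j} → j < i → Set-at m (base j) (Has j)
      table-ok : ∀ {j} → j < i → Table-at m j

  symbol-time : ℕ
  symbol-time = Z * 20 + n * 20 + suc (n / B) * (B * 320 + 50) + 100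

  build-run : ∀ {σ t} → Text-search.Text-at t (M σ) → Run buildᶜ σ (k * symbol-time + 10) (λ σ′ → Built t (M σ′) k)
  build-run {σ} {t} txt = weaken (≤-trans (≤-reflexive (trans (+-comm 2 (k * symbol-time + 4)) (+-assoc (k * symbol-time) 4 2))) (+-monoʳ-≤ (k * symbol-time) (≤ᵇ⇒≤ 6 10 _))) id
    (exec (rsym := lit 0) _ (loop k refl refl (built txt (λ ()) (λ ()))))
    where
    open Text-search t
    open Tables t
    loop : ∀ d {σ i} → i + d ≡ k → R σ rsym ≡ i → Built t (M σ) i →
           Run buildLoop σ (d * symbol-time + 4) (λ σ′ → Built t (M σ′) k)
    loop zero {σ} {i} id≡k e P = while-step {t = 0} {u = 0} _
      (λ _ → subst (Built t (M σ)) (trans (sym (+-identityʳ i)) id≡k) P)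
      (λ i<k → contradiction (trans e (trans (sym (+-identityʳ i)) id≡k)) (<⇒≢ i<k))
    loop (suc d) {σ} {i} id≡k e (built txt trees tabs) =
      weaken (≤-trans (≤-reflexive (solve 4 (λ x y z w → con 4 :+ (x :+ con 30 :+ (y :+ con 40 :+ (z :+ con 20 :+ con 4))) :+ (w :+ con 4) :≈ x :+ y :+ z :+ con 98 :+ w :+ con 4) refl (Z * 20) (n * 20) (suc (n / B) * (B * 320 + 50)) (d * symbol-time)))
               (+-monoˡ-≤ 4 (+-monoˡ-≤ (d * symbol-time) (+-monoʳ-≤ (Z * 20 + n * 20 + suc (n / B) * (B * 320 + 50)) (≤ᵇ⇒≤ 98 100 _))))) id
      (while-step {t = Z * 20 + 30 + (n * 20 + 40 + (suc (n / B) * (B * 320 + 50) + 20 + 4))} _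
        (λ p → contradiction (≤-trans p (≤-reflexive e)) (<⇒≱ i<k))
        λ _ → pin rsym e
          (framed 21 (zero-run refl i<k) ▷ λ { {mk ρ₁ m₁} ((zs , o₁) , f₁) → pin rsym (f₁ rsym (<ᵇ⇒< rsym 21 _))
          (framed 21 (table-run refl i<k (text-only (≢-sym (zone≢ i (s≤s z≤n))) o₁ txt)) ▷ λ { {mk ρ₂ m₂} ((γ≡ , tab , o₂) , f₂) → pin rsym (f₂ rsym (<ᵇ⇒< rsym 21 _))
          (framed 21 (blocks-run {i = i} refl γ≡ i<k tab (tree-only {m = m₁} {m₂} {i} (tree≢ i i<k ∘ sym) o₂ (Set-empty (λ ()) zs))) ▷ λ { {mk ρ₃ m₃} ((S , o₃) , f₃) → pin rsym (f₃ rsym (<ᵇ⇒< rsym 21 _))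
          (finish (rsym := succᵉ (reg rsym)) (_ , ≤-trans i<k (≤-trans (<⇒≤ k<W) W≤X))
            (loop d (trans (sym (+-suc i d)) id≡k) refl (next-built o₁ o₂ o₃ S tab))) }) }) }))
      where
      i<k : i < k
      i<k = ≤-trans (m≤m+n (suc i) d) (≤-reflexive (trans (sym (+-suc i d)) id≡k))
      next-built : ∀ {m₁ m₂ m₃} → Only (W + i) (M σ) m₁ → Only (W + W + i) m₁ m₂ → Only (W + i) m₂ m₃ →
                   Set-at m₃ (base i) (Has i) → Table-at m₂ i → Built t m₃ (suc i)
      next-built {m₁} {m₂} {m₃} o₁ o₂ o₃ S tab = built
        (text-only (≢-sym (zone≢ i (s≤s z≤n))) o₃ (text-only (≢-sym (zone≢′ i (s≤s z≤n))) o₂ (text-only (≢-sym (zone≢ i (s≤s z≤n))) o₁ txt)))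
        (λ j<si → [ (λ j<i → tree-only (ne j<i) o₃ (tree-only (tree≢ i (<-trans j<i i<k) ∘ sym) o₂ (tree-only (ne j<i) o₁ (trees j<i)))) , (λ { refl → S }) ]′ (m≤n⇒m<n∨m≡n (s≤s⁻¹ j<si)))
        (λ j<si → [ (λ j<i → table-only (tree≢ _ i<k) o₃ (table-only (λ e → <⇒≢ j<i (sym (+-cancelˡ-≡ (W + W) _ _ e))) o₂ (table-only (tree≢ _ i<k) o₁ (tabs j<i)))) , (λ { refl → table-only (tree≢ i i<k) o₃ tab }) ]′ (m≤n⇒m<n∨m≡n (s≤s⁻¹ j<si)))
        where
        ne : ∀ {j} → j < i → W + i ≢ W + j
        ne j<i e = <⇒≢ j<i (sym (+-cancelˡ-≡ W _ _ e))

  only-table : ∀ m S v → S < 2 ^ k → Only 1 m (m [ W + S ↦ v ])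
  only-table m S v S< = subst (λ a → Only 1 m (m [ a ↦ v ])) (cong (_+ S) (*-identityˡ W)) (only-store m S v (<-≤-trans S< 2^k≤W))

  record Current (t : ℕ → ℕ) (σ : Store) : Set where
    constructor current
    open Text-search t
    field
      text-ok  : Text-at (M σ)
      trees-ok : Trees-at (M σ)
      best     : ℕ
      best-ok  : Packings.Optimal n k t (2 ^ k ∸ 1) best
      answer   : R σ rans ≡ (if best <ᵇ suc n then 1 else 0)

  -- A lookup takes time at most T = 12, and 88 is T + T + 64.
  solve-tables-run : ∀ {σ t} → Built t (M σ) k → Run (dpᶜ lookupᶜ) σ (2 ^ k * (k * 88 + 80)) (Current t)
  solve-tables-run {σ} {t} P = weaken ≤-refl (λ { ((v , O , a) , Q , _) → current (Built.text-ok Q) (Built.trees-ok Q) v O a })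
    (Subsets.dp-run t lookupᶜ _ 12 (λ m → Built t m k) stable lookup-run P)
    where
    open Text-search t
    open Tables t
    stable : ∀ {m S v} → S < 2 ^ k → Built t m k → Built t (m [ W + S ↦ v ]) k
    stable {m} {S} {v} S< (built p q r) = built
      (text-only (λ ()) (only-table m S v S<) p)
      (λ j<k → tree-only (zone≢ _ (s≤s (s≤s z≤n))) (only-table m S v S<) (q j<k))
      (λ j<k → table-only (zone≢′ _ (s≤s (s≤s z≤n))) (only-table m S v S<) (r j<k))
    lookup-run : ∀ {σ i p} → R σ rsym ≡ i → R σ rp ≡ p → i < k → p ≤ suc n → Built t (M σ) k →
                 Run lookupᶜ σ 12 (λ σ′ → M σ′ ≡ M σ × Packings.Next n k t i p (R σ′ rq))
    lookup-run {i = i} {p} q₁ q₂ i<k p≤ P = within 12 (pin rsym q₁ (pin rp q₂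
      (finish lookupᶜ (_ , ≤-trans (Packings.Next.q≤n N) n≤X) (refl , N))))
      where N = Built.table-ok P i<k p p≤

  solve-trees-run : ∀ {σ t} → Text-search.Text-at t (M σ) → Text-search.Trees-at t (M σ) →
                    Run (dpᶜ nxtᶜ) σ (2 ^ k * (k * (B * 600 + B * 600 + 64) + 80)) (Current t)
  solve-trees-run {σ} {t} txt trees = weaken ≤-refl (λ { ((v , O , a) , (p , q) , _) → current p (q _) v O a })
    (Subsets.dp-run t nxtᶜ _ (B * 600) (λ m → Text-at m × (∀ j → j < k → Set-at m (base j) (Has j))) stable
      (λ q₁ q₂ i<k _ (p , q) → nxt-run q₁ q₂ i<k p (λ {j} → q j)) (txt , λ j → trees {j}))
    where
    open Text-search t
    open Tables t
    stable : ∀ {m S v} → S < 2 ^ k → Text-at m × (∀ j → j < k → Set-at m (base j) (Has j)) →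
             Text-at (m [ W + S ↦ v ]) × (∀ j → j < k → Set-at (m [ W + S ↦ v ]) (base j) (Has j))
    stable {m} {S} {v} S< (p , q) =
      text-only (λ ()) (only-table m S v S<) p ,
      λ j j<k → tree-only (zone≢ _ (s≤s (s≤s z≤n))) (only-table m S v S<) (q j j<k)

  -- Updating the trees

  c<L : ∀ {c} → c * B < n → c < L
  c<L p = ≤-<-trans (block≤⇒≤/ (<⇒≤ p)) blocks

  enter-time : B * 40 + 30 + (4 + (10 + B * 320)) ≤ B * 404
  enter-time = ≤-trans (≤-reflexive (solve 1 (λ x → x :* con 40 :+ con 30 :+ (con 4 :+ (con 10 :+ x :* con 320)) :≈ x :* con 360 :+ con 44) refl B)) (budget 360 44 404)

  module Presence (t : ℕ → ℕ) where
    open Text-search t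

    check-run : ∀ {σ i c} → R σ rsym ≡ i → R σ rhome ≡ c → c * B < n → Text-at (M σ) →
                Run checkᶜ σ (B * 40 + 30) (λ σ′ → (M σ′ ≡ M σ × R σ′ rblk ≡ c
                  × (R σ′ rq < R σ′ rend → Has i c) × (R σ′ rend ≤ R σ′ rq → ¬ Has i c)) × ∀ r → r < 22 → R σ′ r ≡ R σ r)
    check-run {σ} {i} {c} q₁ q₂ c<n txt = weaken (≤-trans (≤-reflexive (+-comm (6 + 20) (B * 40))) (+-monoʳ-≤ (B * 40) (≤ᵇ⇒≤ 26 30 _))) id
      (framed 22 (pin rsym q₁ (pin rhome q₂
        (weaken (≤-reflexive (+-assoc 6 20 (B * 40))) id
        (exec (rblk := reg rhome ⨾ rq := op mul (reg rhome) (reg rB)) (_ , (_ , ≤-trans (<⇒≤ c<n) n≤X))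
        (end-run {c = c} refl (<⇒≤ c<n) ▷ λ { {mk ρ₁ _} (refl , be , e₁ , _ , e₃ , e₄) →
          weaken ≤-refl (λ { {mk ρ₂ _} ((refl , found a e f g) , fr) → refl , trans (fr rblk (<ᵇ⇒< rblk 24 _)) e₄ ,
              (λ q<E → let q<E′ = subst (_ <_) (fr rend (<ᵇ⇒< rend 24 _)) q<E in
                 _ , <-≤-trans q<E′ (E≤n be) , g q<E′ , ≤-antisym (of-block be q<E′) (block≤⇒≤/ a)) ,
              (λ { E≤q (x , x<n , tx , x/B) → f (≤/⇒block≤ (≤-reflexive (sym x/B)))
                     (<-≤-trans (in-block be x<n (≤-reflexive x/B)) (≤-trans (≤-reflexive (sym (fr rend (<ᵇ⇒< rend 24 _)))) E≤q)) tx }) })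
            (scan-block e₃ refl e₁ ≤-refl (<⇒≤ (in-block be c<n (≤-reflexive (m*n/n≡m c B)))) be txt) }))))))

    enter-run : ∀ {σ i c} → R σ rsym ≡ i → R σ rhome ≡ c → c * B < n → i < k → Text-at (M σ) →
                Set-at (M σ) (base i) (Has i) →
                Run enterᶜ σ (B * 404) (λ σ′ → (Set-at (M σ′) (base i) (Has i ∪ c) × Only (W + i) (M σ) (M σ′))
                  × ∀ r → r < 22 → R σ′ r ≡ R σ r)
    enter-run {σ} {i} {c} q₁ q₂ c<n i<k txt S = weaken enter-time id
      (framed 22 (check-run q₁ q₂ c<n txt ▷ λ { {mk ρ _} ((refl , b≡ , yes′ , no′) , f) →
        pin rsym (trans (f rsym (<ᵇ⇒< rsym 22 _)) q₁) (pin rblk b≡ (branch {t = 10 + B * 320} _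
          (λ q<E → weaken (m≤m+n 1 (9 + B * 320)) id (finish skip _
            (Set-cong inj₁ (λ { (inj₁ h) → h ; (inj₂ refl) → yes′ q<E }) S , Only-refl)))
          (λ E≤q → exec baseᶜ ((_ , β≤X) , (_ , key≤X (+-monoʳ-≤ L (<⇒≤ (c<L c<n)))))
            (weaken ≤-refl (λ (S′ , off) → S′ , Off⇒Only {i} off)
              (insert-run (base+Z≤X i<k) refl refl (c<L c<n) (no′ E≤q) S))))) }))
      where
      β≤X : base i ≤ X
      β≤X = ≤-trans (m≤m+n (base i) Z) (base+Z≤X i<k)

    -- Q is kept general because at this moment the tree need not match the text: it may still list
    -- block c although the last occurrence there has just been overwritten.
    leave-run : ∀ {σ i c Q} → R σ rsym ≡ i → R σ rhome ≡ c → c * B < n → i < k → Text-at (M σ) →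
                Set-at (M σ) (base i) Q → Q c →
                Run leaveᶜ σ (B * 404) (λ σ′ → (Has i c × Set-at (M σ′) (base i) Q ⊎ ¬ Has i c × Set-at (M σ′) (base i) (Q ∖ c))
                  × Only (W + i) (M σ) (M σ′))
    leave-run {σ} {i} {c} q₁ q₂ c<n i<k txt S c∈ = weaken enter-time id
      (check-run q₁ q₂ c<n txt ▷ λ { {mk ρ _} ((refl , b≡ , yes′ , no′) , f) →
        pin rsym (trans (f rsym (<ᵇ⇒< rsym 22 _)) q₁) (pin rblk b≡ (branch {t = 10 + B * 320} _
          (λ q<E → weaken (m≤m+n 1 (9 + B * 320)) id (finish skip _ (inj₁ (yes′ q<E , S) , Only-refl)))
          (λ E≤q → exec baseᶜ ((_ , β≤X) , (_ , key≤X (+-monoʳ-≤ L (<⇒≤ (c<L c<n)))))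
            (weaken ≤-refl (λ (S′ , off) → inj₂ (no′ E≤q , S′) , Off⇒Only {i} off)
              (delete-run (base+Z≤X i<k) refl refl c∈ S))))) })
      where
      β≤X : base i ≤ X
      β≤X = ≤-trans (m≤m+n (base i) Z) (base+Z≤X i<k)

  module Edit (t : ℕ → ℕ) {p a : ℕ} (p<n : p < n) (a<k : a < k) (old<k : t p < k) where
    t′ = t [ p ↦ a ]
    o = t p
    c = p / B
    open Text-search t
    open Tables t using (tree-only; text-only)
    module Then = Text-search t′

    -- What the trees hold between the two halves of an update: block c has been added for the new
    -- symbol and nothing has been removed. For every symbol but the old one this is already the set
    -- of the new text; for the old one it can differ at c only.
    Mid : ℕ → Keys
    Mid j d = Has j d ⊎ (j ≡ a × d ≡ c)

    t′p : t′ p ≡ a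
    t′p = ↦-here t p a

    t′x : ∀ {x} → x ≢ p → t′ x ≡ t x
    t′x {x} ne = ↦-there t {p} a {x} ne

    after : ∀ {j d} → Then.Has j d → Mid j d
    after {j} (x , x<n , tx , xd) with x ≟ p
    ... | yes refl = inj₂ (trans (sym tx) t′p , sym xd)
    ... | no ne = inj₁ (x , x<n , trans (sym (t′x ne)) tx , xd)

    before : ∀ {j d} → j ≢ o → Mid j d → Then.Has j d
    before j≢o (inj₂ (refl , refl)) = p , p<n , t′p , refl
    before {j} j≢o (inj₁ (x , x<n , tx , xd)) = x , x<n , trans (t′x λ { refl → j≢o (sym tx) }) tx , xd

    before-old : ∀ {d} → d ≢ c → Mid o d → Then.Has o d
    before-old d≢c (inj₂ (_ , d≡c)) = contradiction d≡c d≢c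
    before-old d≢c (inj₁ (x , x<n , tx , xd)) = x , x<n , trans (t′x λ { refl → d≢c (sym xd) }) tx , xd

    text-edit : ∀ {m} → Text-at m → Then.Text-at (m [ p ↦ a ])
    text-edit {m} txt {x} x<n with x ≟ p
    ... | yes refl = trans (↦-here m p a) (sym t′p)
    ... | no ne = trans (↦-there m {p} a {x} ne) (trans (txt x<n) (sym (t′x ne)))

    c*B<n : c * B < n
    c*B<n = ≤-<-trans (m/n*n≤m p B) p<n

    only-text : ∀ m → Only 0 m (m [ p ↦ a ])
    only-text m = only-store {0} m p a (<-trans p<n (<-trans (n<1+n n) suc-n<W))

    edit-run : ∀ {σ} → R σ 0 ≡ p → R σ 1 ≡ a → Text-at (M σ) → Trees-at (M σ) →
               Run editᶜ σ (B * 900) (λ σ′ → Then.Text-at (M σ′) × Then.Trees-at (M σ′))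
    edit-run {σ} q₀ q₁ txt trees = weaken (≤-trans (≤-reflexive (solve 1 (λ x → con 13 :+ (x :* con 404 :+ (con 5 :+ x :* con 404)) :≈ x :* con 808 :+ con 18) refl B)) (budget 808 18 900)) id
      (pin 0 q₀ (pin 1 q₁
      (exec (rpos := reg 0 ⨾ rnew := reg 1 ⨾ rold := mem[ reg rpos ] ⨾ rhome := op div (reg rpos) (reg rB) ⨾ rsym := reg rnew)
        (_ , _ , (_ , ≤-trans (≤-reflexive (txt p<n)) (≤-trans (<⇒≤ old<k) (≤-trans (<⇒≤ k<W) W≤X))) , _)
      (Presence.enter-run t {i = a} {c = c} refl refl c*B<n a<k txt (trees a<k) ▷ λ { {mk ρ₁ m₁} ((S₁ , o₁) , f₁) →
        let txt₁ = text-only (≢-sym (zone≢ a (s≤s z≤n))) o₁ txt in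
        pin rpos (f₁ rpos (<ᵇ⇒< rpos 22 _)) (pin rnew (f₁ rnew (<ᵇ⇒< rnew 22 _)) (pin rold (trans (f₁ rold (<ᵇ⇒< rold 22 _)) (txt p<n)) (pin rhome (f₁ rhome (<ᵇ⇒< rhome 22 _))
        (exec (mem[ reg rpos ]:= reg rnew ⨾ rsym := reg rold) _
          (weaken ≤-refl (λ { {σ′} (S₂ , o₂) → finally m₁ (M σ′) txt₁ (mids m₁ o₁ S₁) o₂ S₂ })
            (Presence.leave-run t′ {i = o} {c = c} {Q = Mid o} refl refl c*B<n old<k (text-edit txt₁)
              (tree-only (zone≢ o (s≤s z≤n)) (only-text m₁) (mids m₁ o₁ S₁ old<k)) (inj₁ (p , p<n , refl , refl)))))))) }))))
      where
      mids : ∀ m₁ → Only (W + a) (M σ) m₁ → Set-at m₁ (base a) (Has a ∪ c) → ∀ {j} → j < k → Set-at m₁ (base j) (Mid j)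
      mids m₁ o₁ S₁ {j} j<k with j ≟ a
      ... | yes refl = Set-cong (λ { (inj₁ h) → inj₁ h ; (inj₂ e) → inj₂ (refl , e) }) (λ { (inj₁ h) → inj₁ h ; (inj₂ (_ , e)) → inj₂ e }) S₁
      ... | no j≢a = Set-cong inj₁ (λ { (inj₁ h) → h ; (inj₂ (e , _)) → contradiction e j≢a })
          (tree-only (λ e → j≢a (sym (+-cancelˡ-≡ W a j e))) o₁ (trees j<k))
      finally : ∀ m₁ m₂ → Text-at m₁ → (∀ {j} → j < k → Set-at m₁ (base j) (Mid j)) → Only (W + o) (m₁ [ p ↦ a ]) m₂ →
                Then.Has o c × Set-at m₂ (base o) (Mid o) ⊎ ¬ Then.Has o c × Set-at m₂ (base o) (Mid o ∖ c) →
                Then.Text-at m₂ × Then.Trees-at m₂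
      finally m₁ m₂ txt₁ mid o₂ S₂ = Tables.text-only t′ (≢-sym (zone≢ o (s≤s z≤n))) o₂ (text-edit txt₁) , λ {j} → trees′ j
        where
        old-tree : Then.Has o c × Set-at m₂ (base o) (Mid o) ⊎ ¬ Then.Has o c × Set-at m₂ (base o) (Mid o ∖ c) → Set-at m₂ (base o) (Then.Has o)
        old-tree (inj₁ (h , S)) = Set-cong (λ {d} q → there′ d q (d ≟ c)) after S
          where
          there′ : ∀ d → Mid o d → Dec (d ≡ c) → Then.Has o d
          there′ d q (yes refl) = h
          there′ d q (no d≢c) = before-old d≢c q
        old-tree (inj₂ (h , S)) = Set-cong (λ (q , d≢c) → before-old d≢c q) (λ q → after q , λ { refl → h q }) S
        trees′ : ∀ j → j < k → Set-at m₂ (base j) (Then.Has j)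
        trees′ j j<k with j ≟ o
        ... | yes refl = old-tree S₂
        ... | no j≢o = Set-cong (before j≢o) after
            (tree-only (λ e → j≢o (sym (+-cancelˡ-≡ W o j e))) o₂ (tree-only (zone≢ j (s≤s z≤n)) (only-text m₁) (mid j<k)))

-- The data structure and its time bounds

structure : DataStructure
structure = record
  { initialise = clearᶜ 62 ⨾ setupᶜ ⨾ buildᶜ ⨾ dpᶜ lookupᶜ
  ; update     = editᶜ ⨾ dpᶜ nxtᶜ
  ; query      = 0 := reg rans
  }

opaque
  -- Dictated by the update: its coefficient 2244 is rounded up to 2500 and multiplied by the 4 of
  -- `levels≤`. The word length asks for 161, initialization for 3000 and a query for 2.
  factor : ℕ
  factor = 10000

  ≤factor : ∀ x {_ : T (x ≤ᵇ 10000)} → x ≤ factor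
  ≤factor x {p} = ≤ᵇ⇒≤ x 10000 p

n<2^log : ∀ n → n < 2 ^ suc ⌊log₂ n ⌋
n<2^log n = ≰⇒> λ p → 1+n≰n (≤-trans (≤-reflexive (sym (⌊log₂[2^n]⌋≡n (suc ⌊log₂ n ⌋)))) (⌊log₂⌋-mono-≤ p))

-- Minimality of the two logarithms gives h ≤ 1 + l, so h + 2 ≤ 3 + l. As `loglog n` is at least 1
-- and at least l, four copies of it suffice.
levels≤ : ∀ {n} (z : Sizes n) → suc (suc (Sizes.h z)) ≤ 4 * loglog n
levels≤ {n} z = ≤-trans (+-monoʳ-≤ 2 (h≤ h log₁)) (≤-trans (+-mono-≤ (*-monoʳ-≤ 3 (m≤m⊔n 1 l)) (m≤n⊔m 1 l)) (≤-reflexive (+-comm (3 * loglog n) (loglog n))))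
  where
  open Sizes z
  l = ⌊log₂ ⌊log₂ n ⌋ ⌋
  ℓ₀∸1≤ : ∀ ℓ₀ → Log 1 n ℓ₀ → ℓ₀ ∸ 1 ≤ ⌊log₂ n ⌋
  ℓ₀∸1≤ zero _ = z≤n
  ℓ₀∸1≤ (suc zero) _ = z≤n
  ℓ₀∸1≤ (suc (suc j)) L = ≤-trans (≤-reflexive (sym (⌊log₂[2^n]⌋≡n (suc j)))) (⌊log₂⌋-mono-≤ (Log.tight L (s≤s z≤n) ≤-refl))
  h≤ : ∀ h → Log 0 (ℓ₀ ∸ 1) h → h ≤ suc l
  h≤ zero _ = z≤n
  h≤ (suc j) L = s≤s (≤-trans (≤-reflexive (sym (⌊log₂[2^n]⌋≡n j)))
    (⌊log₂⌋-mono-≤ (≤-trans (Log.tight L z≤n ≤-refl) (ℓ₀∸1≤ ℓ₀ log₀))))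

-- The left side has the shape of `width`. It is at most 86 times the square of p, and 86 ≤ `2 ^ 7`
-- ≤ `p ^ 7` accounts for the exponent 9.
quadratic⇒power : ∀ p {x y z s} → 2 ≤ p → x ≤ p → y ≤ p → s ≤ 5 * p → z ≤ 2 * p →
                  x + y + 2 * (s * z) + 64 ≤ p ^ 9
quadratic⇒power p {x} {y} {z} {s} 2≤p x≤ y≤ s≤ z≤ = begin
  x + y + 2 * (s * z) + 64                          ≤⟨ +-mono-≤ (+-mono-≤ (+-mono-≤ (≤-trans x≤ p≤p²) (≤-trans y≤ p≤p²)) (*-monoʳ-≤ 2 (*-mono-≤ s≤ z≤))) (*-monoʳ-≤ 64 1≤p²) ⟩
  p * p + p * p + 2 * (5 * p * (2 * p)) + 64 * (p * p) ≡⟨ solve 1 (λ p → p :* p :+ p :* p :+ con 2 :* (con 5 :* p :* (con 2 :* p)) :+ con 64 :* (p :* p) :≈ con 86 :* (p :* p)) refl p ⟩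
  86 * (p * p)                                      ≤⟨ *-mono-≤ (≤-trans (≤ᵇ⇒≤ 86 128 _) (^-monoˡ-≤ 7 2≤p)) (≤-reflexive (cong (p *_) (sym (*-identityʳ p)))) ⟩
  p ^ 7 * p ^ 2                                     ≡⟨ sym (^-distribˡ-+-* p 7 2) ⟩
  p ^ 9                                             ∎
  where
  open ≤-Reasoning
  instance
    p≢0 : NonZero p
    p≢0 = >-nonZero (≤-trans (s≤s z≤n) 2≤p)
  p≤p² : p ≤ p * p
  p≤p² = m≤m*n p p
  1≤p² : 1 ≤ p * p
  1≤p² = ≤-trans (≤-trans (s≤s z≤n) 2≤p) p≤p²

-- With 4 ≤ `p ^ 2` the number x is at most `p ^ 20`, its eighth power at most `p ^ 160`, and one
-- more factor p makes the inequality strict. This is the origin of 161.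
power-fits : ∀ p {w x} → 2 ≤ p → w ≤ p ^ 9 → x ≡ 4 * (w * w) → x ^ 8 < p ^ 161
power-fits p {w} {x} 2≤p w≤ x≡ = begin-strict
  x ^ 8        ≤⟨ ^-monoˡ-≤ 8 x≤ ⟩
  (p ^ 20) ^ 8 ≡⟨ ^-*-assoc p 20 8 ⟩
  p ^ 160      <⟨ ^-monoʳ-< p 2≤p {160} {161} (≤ᵇ⇒≤ 161 161 _) ⟩
  p ^ 161      ∎
  where
  open ≤-Reasoning
  x≤ : x ≤ p ^ 20
  x≤ = begin
    x                     ≡⟨ x≡ ⟩
    4 * (w * w)           ≤⟨ *-mono-≤ (^-monoˡ-≤ 2 2≤p) (*-mono-≤ w≤ w≤) ⟩
    p ^ 2 * (p ^ 9 * p ^ 9) ≡⟨ cong (p ^ 2 *_) (sym (^-distribˡ-+-* p 9 9)) ⟩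
    p ^ 2 * p ^ 18        ≡⟨ sym (^-distribˡ-+-* p 2 18) ⟩
    p ^ 20                ∎

2^-power≤ : ∀ c e {b} → c * e ≤ b → (2 ^ e) ^ c ≤ 2 ^ b
2^-power≤ c e {b} fit = ≤-trans (≤-reflexive (^-*-assoc 2 e c)) (^-monoʳ-≤ 2 {e * c} {b} (≤-trans (≤-reflexive (*-comm e c)) fit))

limit-fits : ∀ {n k b} (z : Sizes n) → 161 * suc (k + ⌊log₂ n ⌋) ≤ b →
             limit n k (Sizes.h z) (Sizes.ℓ z) ^ 8 < 2 ^ b
limit-fits {n} {k} {b} z fit = <-≤-trans
  (power-fits p 2≤p (≤-trans (≤-reflexive (sym (width-def n k h ℓ)))
      (quadratic⇒power p 2≤p 2^k≤p (≤-trans (n≤1+n n) n<p) ones depth)) (sym (limit-def n k h ℓ)))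
  (2^-power≤ 161 e fit)
  where
  open Sizes z
  e p : ℕ
  e = suc (k + ⌊log₂ n ⌋)
  p = 2 ^ e
  2≤p : 2 ≤ p
  2≤p = ^-monoʳ-≤ 2 {1} {e} (s≤s z≤n)
  n<p : suc n ≤ p
  n<p = ≤-trans (n<2^log n) (^-monoʳ-≤ 2 (s≤s (m≤n+m ⌊log₂ n ⌋ k)))
  2^k≤p : 2 ^ k ≤ p
  2^k≤p = ^-monoʳ-≤ 2 (≤-trans (m≤m+n k ⌊log₂ n ⌋) (n≤1+n _))
  ones : suc (2 ^ ℓ + 2 ^ ℓ) ≤ 5 * p
  ones = begin
    suc (2 ^ ℓ + 2 ^ ℓ)  ≤⟨ s≤s (+-mono-≤ q q) ⟩
    suc ((2 + (n + n)) + (2 + (n + n))) ≤⟨ m≤m+n _ n ⟩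
    suc ((2 + (n + n)) + (2 + (n + n))) + n ≡⟨ solve 1 (λ n → con 1 :+ ((con 2 :+ (n :+ n)) :+ (con 2 :+ (n :+ n))) :+ n :≈ con 5 :* (con 1 :+ n)) refl n ⟩
    5 * suc n            ≤⟨ *-monoʳ-≤ 5 n<p ⟩
    5 * p                ∎
    where
    open ≤-Reasoning
    q = ≤-trans 2^ℓ≤ (+-monoʳ-≤ 2 (+-mono-≤ (m/n≤m n _) (m/n≤m n _)))
  depth : suc (suc h) ≤ 2 * p
  depth = ≤-trans (s≤s (s≤s h≤n)) (≤-trans (+-mono-≤ (≤-trans (s≤s z≤n) 2≤p) n<p) (≤-reflexive (cong (p +_) (sym (+-identityʳ p)))))

module _ {b : ℕ} where
  peek : (Fin (2 ^ b) → Word b) → ℕ → ℕ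
  peek m a with a <? 2 ^ b
  ... | yes p = toℕ (m (fromℕ< p))
  ... | no _  = 0

  peek-toℕ : ∀ m a → toℕ (m a) ≡ peek m (toℕ a)
  peek-toℕ m a with toℕ a <? 2 ^ b
  ... | yes p = cong (toℕ ∘ m) (sym (Fin.fromℕ<-toℕ a p))
  ... | no p = contradiction (Fin.toℕ<n a) p

  -- Stated for the bare semantics: before clearing, the registers may exceed X, and then no store
  -- simulates the state.
  clear-run : ∀ q (s : State b) → ∃₂ λ t s′ → (s ⊢ clearᶜ q ⇓[ t ] s′) × t ≤ q * 2 + 1 ×
              memory s′ ≡ memory s × (∀ r → r < 2 → registers s′ r ≡ registers s r) ×
              (∀ r → 2 ≤ r → r < 2 + q → registers s′ r ≡ word b 0)
  clear-run zero s = 1 , s , ⇓skip , ≤-refl , refl , (λ _ _ → refl) , λ r p q → contradiction p (<⇒≱ q)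
  clear-run (suc q) s with clear-run q s
  ... | t , s′ , d , t≤ , m≡ , low , mid = t + 2 , _ , ⇓seq d ⇓assign ,
      ≤-trans (+-monoˡ-≤ 2 t≤) (≤-reflexive (+-comm (q * 2 + 1) 2)) , m≡ , low′ , mid′
    where
    low′ : ∀ r → r < 2 → (if r ≡ᵇ suc (suc q) then word b 0 else registers s′ r) ≡ registers s r
    low′ r r<2 rewrite ≢⇒≡ᵇ (<⇒≢ (<-≤-trans r<2 (s≤s (s≤s (z≤n {q}))))) = low r r<2
    mid′ : ∀ r → 2 ≤ r → r < 3 + q → (if r ≡ᵇ suc (suc q) then word b 0 else registers s′ r) ≡ word b 0
    mid′ r p (s≤s r≤) with m≤n⇒m<n∨m≡n r≤
    ... | inj₁ r< rewrite ≢⇒≡ᵇ (<⇒≢ r<) = mid r p r<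
    ... | inj₂ refl rewrite ≡ᵇ-refl q = refl

-- Room in a register for the path of a successor search, which has h + 1 bits.
root-fits : ∀ {n} k (z : Sizes n) → 2 ^ suc (Sizes.h z) ≤ limit n k (Sizes.h z) (Sizes.ℓ z)
root-fits {n} k z = ≤-trans 2^≤ (≤-trans (*-monoʳ-≤ 4 n+1≤) (4width≤limit n k h ℓ))
  where
  open Sizes z
  2^≤ : 2 * 2 ^ h ≤ 4 * (n + 1)
  2^≤ = ≤-trans (*-monoʳ-≤ 2 (≤-trans 2^h≤n (⊔-lub (≤-trans (m≤n+m 1 (n + n)) (+-monoʳ-≤ (n + n) (n≤1+n 1))) (m≤m+n (n + n) 2))))
    (≤-reflexive (solve 1 (λ n → con 2 :* (n :+ n :+ con 2) :≈ con 4 :* (n :+ con 1)) refl n))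
  n+1≤ : n + 1 ≤ width n k h ℓ
  n+1≤ = ≤width n k h ℓ (+-mono-≤ (≤-trans (m≤n+m n (2 ^ k)) (m≤m+n (2 ^ k + n) (size h ℓ))) (≤ᵇ⇒≤ 1 64 _))

-- Both the size of a tree and the cost of its insertions are a number of blocks times B, up to
-- constants. As `n / B * B ≤ n`, each is linear in n.
symbol-time≤ : ∀ {n} (z : Sizes n) → let B = suc (suc (Sizes.h z)) in
  size (Sizes.h z) (Sizes.ℓ z) * 20 + n * 20 + suc (n / B) * (B * 320 + 50) + 100 ≤ n * 1120 + 1240
symbol-time≤ {n} z = begin
  size h ℓ * 20 + n * 20 + suc (n / B) * (B * 320 + 50) + 100
    ≤⟨ +-monoˡ-≤ 100 (+-mono-≤ (+-monoˡ-≤ (n * 20) (*-monoˡ-≤ 20 size≤)) blocks≤) ⟩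
  (n * 18 + 20) * 20 + n * 20 + (n + (2 + n)) * 370 + 100
    ≡⟨ solve 1 (λ n → (n :* con 18 :+ con 20) :* con 20 :+ n :* con 20 :+ (n :+ (con 2 :+ n)) :* con 370 :+ con 100 :≈ n :* con 1120 :+ con 1240) refl n ⟩
  n * 1120 + 1240 ∎
  where
  open ≤-Reasoning
  open Sizes z
  B : ℕ
  B = suc (suc h)
  q : ℕ
  q = n / suc (suc h)
  qB≤n : q * B ≤ n
  qB≤n = m/n*n≤m n (suc (suc h))
  B≤ : B ≤ 2 + n
  B≤ = s≤s (s≤s h≤n)
  size≤ : size h ℓ ≤ n * 18 + 20
  size≤ = begin
    2 * (suc (2 ^ ℓ + 2 ^ ℓ) * B)      ≤⟨ *-monoʳ-≤ 2 (*-monoˡ-≤ B (s≤s (+-mono-≤ 2^ℓ≤ 2^ℓ≤))) ⟩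
    2 * (suc ((2 + (q + q)) + (2 + (q + q))) * B) ≡⟨ solve 2 (λ q b → con 2 :* ((con 1 :+ ((con 2 :+ (q :+ q)) :+ (con 2 :+ (q :+ q)))) :* b) :≈ (q :* b) :* con 8 :+ b :* con 10) refl q B ⟩
    q * B * 8 + B * 10                 ≤⟨ +-mono-≤ (*-monoˡ-≤ 8 qB≤n) (*-monoˡ-≤ 10 B≤) ⟩
    n * 8 + (2 + n) * 10               ≡⟨ solve 1 (λ n → n :* con 8 :+ (con 2 :+ n) :* con 10 :≈ n :* con 18 :+ con 20) refl n ⟩
    n * 18 + 20                        ∎
  blocks≤ : suc q * (B * 320 + 50) ≤ (n + (2 + n)) * 370
  blocks≤ = begin
    suc q * (B * 320 + 50)     ≤⟨ *-monoʳ-≤ (suc q) (+-monoʳ-≤ (B * 320) (m≤n*m 50 B)) ⟩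
    suc q * (B * 320 + B * 50) ≡⟨ solve 2 (λ q b → (con 1 :+ q) :* (b :* con 320 :+ b :* con 50) :≈ (q :* b :+ b) :* con 370) refl q B ⟩
    (q * B + B) * 370          ≤⟨ *-monoˡ-≤ 370 (+-mono-≤ qB≤n B≤) ⟩
    (n + (2 + n)) * 370        ∎

build-time≤ : ∀ c n k (s : ℕ) → 3000 ≤ c → s ≤ n * 1120 + 1240 → (k ≡ 0 → n ≡ 0) →
  125 + (n * 60 + 250 + (k * s + 10 + 2 ^ k * (k * 88 + 80))) ≤ c * (1 ⊔ (k * 2 ^ k + k * n))
-- A text over the empty alphabet is empty, so only constant time is left, and the 1 in the maximum
-- pays for it.
build-time≤ c n zero s c≥ s≤ n≡0 rewrite n≡0 refl = ≤-trans (≤-trans (≤ᵇ⇒≤ 465 3000 _) c≥) (≤-reflexive (sym (*-identityʳ c)))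
build-time≤ c n k@(suc k-1) s c≥ s≤ n≡0 = ≤-trans (begin
  125 + (n * 60 + 250 + (k * s + 10 + u * (k * 88 + 80)))
    ≤⟨ +-monoʳ-≤ 125 (+-mono-≤ (+-monoˡ-≤ 250 (*-monoˡ-≤ 60 n≤kn)) (+-mono-≤ (+-monoˡ-≤ 10 (*-monoʳ-≤ k s≤)) (≤-refl {u * (k * 88 + 80)}))) ⟩
  125 + (k * n * 60 + 250 + (k * (n * 1120 + 1240) + 10 + u * (k * 88 + 80)))
    ≡⟨ solve 3 (λ k n u → con 125 :+ (k :* n :* con 60 :+ con 250 :+ (k :* (n :* con 1120 :+ con 1240) :+ con 10 :+ u :* (k :* con 88 :+ con 80))) :≈
         k :* n :* con 1180 :+ k :* u :* con 88 :+ (k :* con 1240 :+ u :* con 80 :+ con 385)) refl k n u ⟩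
  k * n * 1180 + k * u * 88 + (k * 1240 + u * 80 + 385)
    ≤⟨ +-monoʳ-≤ (k * n * 1180 + k * u * 88) (+-mono-≤ (+-mono-≤ (*-monoˡ-≤ 1240 k≤ku) (*-monoˡ-≤ 80 u≤ku)) (*-monoˡ-≤ 385 1≤ku)) ⟩
  k * n * 1180 + k * u * 88 + (k * u * 1240 + k * u * 80 + k * u * 385)
    ≡⟨ solve 2 (λ x y → y :* con 1180 :+ x :* con 88 :+ (x :* con 1240 :+ x :* con 80 :+ x :* con 385) :≈ x :* con 1793 :+ y :* con 1180) refl (k * u) (k * n) ⟩
  k * u * 1793 + k * n * 1180
    ≤⟨ +-mono-≤ (*-monoʳ-≤ (k * u) (≤-trans (≤ᵇ⇒≤ 1793 3000 _) c≥)) (*-monoʳ-≤ (k * n) (≤-trans (≤ᵇ⇒≤ 1180 3000 _) c≥)) ⟩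
  k * u * c + k * n * c
    ≡⟨ solve 3 (λ x y c → x :* c :+ y :* c :≈ c :* (x :+ y)) refl (k * u) (k * n) c ⟩
  c * (k * u + k * n) ∎)
  (*-monoʳ-≤ c (m≤n⊔m 1 (k * u + k * n)))
  where
  open ≤-Reasoning
  u : ℕ
  u = 2 ^ k
  n≤kn : n ≤ k * n
  n≤kn = m≤n*m n k
  u≤ku : u ≤ k * u
  u≤ku = m≤n*m u k
  k≤ku : k ≤ k * u
  k≤ku = m≤m*n k u {{m^n≢0 2 k}}
  1≤ku : 1 ≤ k * u
  1≤ku = ≤-trans (s≤s z≤n) k≤ku

-- An update supplies an element of `Fin k`, which gives `1 ≤ k`; then the terms in `2 ^ k` alone
-- and in B alone are absorbed.
update-time≤ : ∀ c B l k → 10000 ≤ c → 1 ≤ k → 1 ≤ B → B ≤ 4 * l →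
  B * 900 + 2 ^ k * (k * (B * 600 + B * 600 + 64) + 80) ≤ c * (k * 2 ^ k * l)
update-time≤ c B l k c≥ 1≤k 1≤B B≤ = begin
  B * 900 + u * (k * (B * 600 + B * 600 + 64) + 80)
    ≡⟨ solve 3 (λ b k u → b :* con 900 :+ u :* (k :* (b :* con 600 :+ b :* con 600 :+ con 64) :+ con 80) :≈
         b :* con 900 :+ (k :* u :* b :* con 1200 :+ k :* u :* con 64 :+ u :* con 80)) refl B k u ⟩
  B * 900 + (k * u * B * 1200 + k * u * 64 + u * 80)
    ≤⟨ +-mono-≤ (*-monoˡ-≤ 900 (m≤n*m B v {{v≢0}})) (+-mono-≤ (+-monoʳ-≤ (k * u * B * 1200) (*-monoˡ-≤ 64 v≤vB)) (*-monoˡ-≤ 80 (≤-trans u≤ku v≤vB))) ⟩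
  v * B * 900 + (v * B * 1200 + v * B * 64 + v * B * 80)
    ≡⟨ solve 1 (λ x → x :* con 900 :+ (x :* con 1200 :+ x :* con 64 :+ x :* con 80) :≈ x :* con 2244) refl (v * B) ⟩
  v * B * 2244       ≤⟨ *-mono-≤ (*-monoʳ-≤ v B≤) (≤ᵇ⇒≤ 2244 2500 _) ⟩
  v * (4 * l) * 2500 ≡⟨ solve 2 (λ v l → v :* (con 4 :* l) :* con 2500 :≈ con 10000 :* (v :* l)) refl v l ⟩
  10000 * (v * l)    ≤⟨ *-monoˡ-≤ (v * l) c≥ ⟩
  c * (v * l)        ∎
  where
  open ≤-Reasoning
  u v : ℕ
  u = 2 ^ k
  v = k * u
  v≢0 : NonZero v
  v≢0 = m*n≢0 k u {{>-nonZero 1≤k}} {{m^n≢0 2 k}}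
  v≤vB : v ≤ v * B
  v≤vB = m≤m*n v B {{>-nonZero 1≤B}}
  u≤ku : u ≤ v
  u≤ku = m≤n*m u k {{>-nonZero 1≤k}}

-- Correctness in all reachable states

after-run : ∀ {b T c t s′} {s : State b} {Q} → RunsWithin T c s Q → s ⊢ c ⇓[ t ] s′ → Q s′
after-run {Q = Q} (_ , _ , d , _ , q) d′ = subst Q (deterministic d d′) q

module Correctness (c : ℕ) (c≥ : 10000 ≤ c) (k n b : ℕ) (z : Sizes n)
  (fits : limit n k (Sizes.h z) (Sizes.ℓ z) ^ 8 < 2 ^ b)
  (2^h≤ : 2 ^ suc (Sizes.h z) ≤ limit n k (Sizes.h z) (Sizes.ℓ z))
  (1≤ℓ : 1 ≤ Sizes.ℓ z) (ℓ≤ : Sizes.ℓ z ≤ 2 ^ Sizes.h z)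
  (blocks : n / suc (suc (Sizes.h z)) < 2 ^ Sizes.ℓ z) where
  open Sizes z using (h; ℓ)
  open Layout n k h ℓ b fits 2^h≤ 1≤ℓ ℓ≤ blocks
  module Initial = Setup n k b z fits

  Spells : Text k n → (ℕ → ℕ) → Set
  Spells w t = ∀ x → t (toℕ x) ≡ toℕ (lookup w x)

  -- The invariant of reachable states. Here t agrees with w below n and is arbitrary beyond, so
  -- replacing a symbol is a point update of t.
  Holds : Text k n → State b → Set
  Holds w s = ∃₂ λ t σ → s ~ σ × Spells w t × Current t σ

  X<2^b : ∀ {m} → m ≤ X → m < 2 ^ b
  X<2^b m≤ = ≤-<-trans m≤ (≤-<-trans (≤-trans (≤-reflexive (sym (^-identityʳ X))) (^-monoʳ-≤ X {{>-nonZero (≤-trans (s≤s z≤n) 64≤X)}} {1} {8} (s≤s z≤n))) fits)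

  k≤X : k ≤ X
  k≤X = ≤-trans (<⇒≤ k<W) W≤X

  0<2^b : 0 < 2 ^ b
  0<2^b = X<2^b z≤n

  symbol<k : ∀ {w t} → Spells w t → ∀ {x} → x < n → t x < k
  symbol<k {w} {t} sp x<n = subst (λ x → t x < k) (Fin.toℕ-fromℕ< x<n)
    (≤-<-trans (≤-reflexive (sp (fromℕ< x<n))) (Fin.toℕ<n (lookup w (fromℕ< x<n))))

  no-symbols : Text k n → k ≡ 0 → n ≡ 0
  no-symbols [] _ = refl
  no-symbols (() ∷ _) refl

  open Initial using (setup-steps)

  clear-steps build-steps : ℕ
  clear-steps = 62 * 2 + 1
  build-steps = k * symbol-time + 10 + 2 ^ k * (k * 88 + 80)

  initialise-steps≤ : Text k n → clear-steps + (setup-steps + build-steps) ≤ c * (1 ⊔ (k * 2 ^ k + k * n))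
  initialise-steps≤ w = build-time≤ c n k symbol-time (≤-trans (≤ᵇ⇒≤ 3000 10000 _) c≥) (symbol-time≤ z) (no-symbols w)

  build-solve-run : ∀ {σ t} → Text-search.Text-at t (M σ) → Run (buildᶜ ⨾ dpᶜ lookupᶜ) σ build-steps (Current t)
  build-solve-run {σ} {t} txt =
    _▷_ {c = buildᶜ} {d = dpᶜ lookupᶜ} {σ = σ} {t = k * symbol-time + 10} {u = 2 ^ k * (k * 88 + 80)}
      {P = λ σ′ → Built t (M σ′) k} (build-run {σ} {t} txt) (λ {σ′} P → solve-tables-run {σ′} {t} P)

  initialise-run : ∀ w s → Input w s → RunsWithin (c * (1 ⊔ (k * 2 ^ k + k * n))) (initialise structure) s (Holds w)
  initialise-run w s inp = initialise-from (clear-run 62 s)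
   where
   initialise-from : (∃₂ λ t s′ → (s ⊢ clearᶜ 62 ⇓[ t ] s′) × t ≤ clear-steps ×
      memory s′ ≡ memory s × (∀ r → r < 2 → registers s′ r ≡ registers s r) ×
      (∀ r → 2 ≤ r → r < 64 → registers s′ r ≡ word b 0)) →
     RunsWithin (c * (1 ⊔ (k * 2 ^ k + k * n))) (initialise structure) s (Holds w)
   initialise-from (t₁ , s₁ , d₁ , t₁≤ , m≡ , low , mid) = go (Initial.setup-run {σ₁} regs0 regs1 s₁ sim₁)
    where
    σ₁ : Store
    σ₁ = mk (λ r → toℕ (registers s₁ r)) (peek {b} (memory s))
    text : ℕ → ℕ
    text = peek {b} (memory s)
    regs0 : toℕ (registers s₁ 0) ≡ k
    regs0 = trans (cong toℕ (trans (low 0 (s≤s z≤n)) (Input.alphabet inp))) (toℕ-word (X<2^b k≤X))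
    regs1 : toℕ (registers s₁ 1) ≡ n
    regs1 = trans (cong toℕ (trans (low 1 (s≤s (s≤s z≤n))) (Input.size inp))) (toℕ-word (X<2^b n≤X))
    small : ∀ r → r < 64 → toℕ (registers s₁ r) ≤ X
    small zero _ = ≤-trans (≤-reflexive regs0) k≤X
    small (suc zero) _ = ≤-trans (≤-reflexive regs1) n≤X
    small (suc (suc r)) r< = ≤-trans (≤-reflexive (trans (cong toℕ (mid (suc (suc r)) (s≤s (s≤s z≤n)) r<)) (toℕ-word 0<2^b))) z≤n
    sim₁ : s₁ Initial.~ σ₁
    sim₁ = Initial.sim (λ _ → refl) (λ a → trans (cong (λ m → toℕ (m a)) m≡) (peek-toℕ {b} (memory s) a)) small
    spells : Spells w text
    spells x = begin
      text (toℕ x)                       ≡⟨ cong text (sym (toℕ-word x<)) ⟩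
      text (toℕ (word b (toℕ x)))        ≡⟨ sym (peek-toℕ {b} (memory s) (word b (toℕ x))) ⟩
      toℕ (memory s (word b (toℕ x)))    ≡⟨ cong toℕ (Input.text inp x) ⟩
      toℕ (word b (toℕ (lookup w x)))    ≡⟨ toℕ-word (X<2^b (≤-trans (<⇒≤ (Fin.toℕ<n (lookup w x))) k≤X)) ⟩
      toℕ (lookup w x)                   ∎
      where
      open ≡-Reasoning
      x< : toℕ x < 2 ^ b
      x< = X<2^b (≤-trans (<⇒≤ (Fin.toℕ<n x)) n≤X)
    go : (∃₂ λ t s₂ → (s₁ ⊢ setupᶜ ⇓[ t ] s₂) × t ≤ setup-steps × ∃ λ σ₂ → s₂ Initial.~ σ₂ × Initial.Ready text σ₂) →
         RunsWithin (c * (1 ⊔ (k * 2 ^ k + k * n))) (initialise structure) s (Holds w)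
    go (t₂ , s₂ , d₂ , t₂≤ , mk ρ₂ _ , sim₂ , ((refl , e₂ , e₃ , e₄) , e₅ , e₆ , e₇ , e₈ , e₉)) =
      finally (build-solve-run {σ₂} {text} (λ _ → refl) s₂ (sim regs₂ (Initial.cells sim₂) bound₂))
      where
      σ₂ : Store
      σ₂ = mk ρ₂ text
      -- The change of machine: the registers of the parameters, tracked until now, become
      -- constants, as `Ready` permits.
      regs₂ : ∀ r → toℕ (registers s₂ r) ≡ R σ₂ r
      regs₂ 2 = trans (Initial.regs sim₂ 2) e₂
      regs₂ 3 = trans (Initial.regs sim₂ 3) e₃
      regs₂ 4 = trans (Initial.regs sim₂ 4) e₄
      regs₂ 5 = trans (Initial.regs sim₂ 5) e₅
      regs₂ 6 = trans (Initial.regs sim₂ 6) e₆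
      regs₂ 7 = trans (Initial.regs sim₂ 7) e₇
      regs₂ 8 = trans (Initial.regs sim₂ 8) e₈
      regs₂ 9 = trans (Initial.regs sim₂ 9) e₉
      regs₂ 0 = Initial.regs sim₂ 0
      regs₂ 1 = Initial.regs sim₂ 1
      regs₂ r@(suc (suc (suc (suc (suc (suc (suc (suc (suc (suc _)))))))))) = Initial.regs sim₂ r
      bound₂ : ∀ r → r < 64 → R σ₂ r ≤ X
      bound₂ r r< = ≤-trans (≤-reflexive (trans (sym (regs₂ r)) (Initial.regs sim₂ r))) (Initial.bound sim₂ r r<)
      finally : (∃₂ λ t s₃ → (s₂ ⊢ buildᶜ ⨾ dpᶜ lookupᶜ ⇓[ t ] s₃) × t ≤ build-steps ×
                 ∃ λ σ₃ → s₃ ~ σ₃ × Current text σ₃) →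
                RunsWithin (c * (1 ⊔ (k * 2 ^ k + k * n))) (initialise structure) s (Holds w)
      finally (t₃ , s₃ , d₃ , t₃≤ , σ₃ , sim₃ , C) =
        t₁ + (t₂ + t₃) , s₃ , ⇓seq d₁ (⇓seq d₂ d₃) ,
        ≤-trans (+-mono-≤ t₁≤ (+-mono-≤ t₂≤ t₃≤)) (initialise-steps≤ w) ,
        text , σ₃ , sim₃ , spells , C

  update-steps : ℕ
  update-steps = B * 900 + 2 ^ k * (k * (B * 600 + B * 600 + 64) + 80)

  update-steps≤ : 1 ≤ k → update-steps ≤ c * (k * 2 ^ k * loglog n)
  update-steps≤ 1≤k = update-time≤ c B (loglog n) k c≥ 1≤k (s≤s z≤n) (levels≤ z)

  edit-solve-run : ∀ {σ t p a} → p < n → a < k → t p < k → R σ 0 ≡ p → R σ 1 ≡ a →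
                   Text-search.Text-at t (M σ) → Text-search.Trees-at t (M σ) →
                   Run (update structure) σ update-steps (Current (t [ p ↦ a ]))
  edit-solve-run {σ} {t} {p} {a} p< a< o< q₀ q₁ txt trees =
    _▷_ {c = editᶜ} {d = dpᶜ nxtᶜ} {σ = σ} {t = B * 900} {u = 2 ^ k * (k * (B * 600 + B * 600 + 64) + 80)} (Edit.edit-run t {p} {a} p< a< o< {σ} q₀ q₁ txt trees) solves
    where
    solves : ∀ {σ′} → Text-search.Text-at (t [ p ↦ a ]) (M σ′) × Text-search.Trees-at (t [ p ↦ a ]) (M σ′) →
             Run (dpᶜ nxtᶜ) σ′ (2 ^ k * (k * (B * 600 + B * 600 + 64) + 80)) (Current (t [ p ↦ a ]))
    solves {σ′} (txt , trees) = solve-trees-run {σ′} {t [ p ↦ a ]} txt (λ {i} → trees {i})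

  update-run : ∀ {w s} p a → Holds w s →
               RunsWithin (c * (k * 2 ^ k * loglog n)) (update structure) (withArgs p a s) (Holds (w [ p ]≔ a))
  update-run {w} {s} p a (t , σ , s~σ , sp , C) =
    finally (edit-solve-run {σ′} {t} {toℕ p} {toℕ a} (Fin.toℕ<n p) (Fin.toℕ<n a) (symbol<k {w} {t} sp (Fin.toℕ<n p))
               refl refl (Current.text-ok C) (Current.trees-ok C) (withArgs p a s) sim′)
    where
    a≤X : toℕ a ≤ X
    a≤X = ≤-trans (<⇒≤ (Fin.toℕ<n a)) k≤X
    p≤X : toℕ p ≤ X
    p≤X = ≤-trans (<⇒≤ (Fin.toℕ<n p)) n≤X
    σ′ : Store
    σ′ = setR 0 (toℕ p) (setR 1 (toℕ a) σ)
    sim′ : withArgs p a s ~ σ′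
    sim′ = ~setR {r = 0} _ (~setR {r = 1} _ s~σ (toℕ-word (X<2^b a≤X)) a≤X) (toℕ-word (X<2^b p≤X)) p≤X
    spell : ∀ x → Dec (x ≡ p) → (t [ toℕ p ↦ toℕ a ]) (toℕ x) ≡ toℕ (lookup (w [ p ]≔ a) x)
    spell x (yes refl) = trans (↦-here t (toℕ p) (toℕ a)) (cong toℕ (sym (lookup∘update p w a)))
    spell x (no ne) = trans (↦-there t {toℕ p} (toℕ a) {toℕ x} (ne ∘ Fin.toℕ-injective))
      (trans (sp x) (cong toℕ (sym (lookup∘update′ ne w a))))
    spells : Spells (w [ p ]≔ a) (t [ toℕ p ↦ toℕ a ])
    spells x = spell x (x Fin.≟ p)
    1≤k : 1 ≤ k
    1≤k = ≤-trans (s≤s z≤n) (Fin.toℕ<n a)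
    finally : (∃₂ λ t′ s′ → (withArgs p a s ⊢ update structure ⇓[ t′ ] s′) ×
               t′ ≤ update-steps ×
               ∃ λ σ′ → s′ ~ σ′ × Current (t [ toℕ p ↦ toℕ a ]) σ′) →
              RunsWithin (c * (k * 2 ^ k * loglog n)) (update structure) (withArgs p a s) (Holds (w [ p ]≔ a))
    finally (t′ , s′ , d , t≤ , σ′ , sim″ , C′) =
      t′ , s′ , d , ≤-trans t≤ (update-steps≤ 1≤k) , t [ toℕ p ↦ toℕ a ] , σ′ , sim″ , spells , C′

  query-run : ∀ {w s} → Holds w s →
              RunsWithin c (query structure) s (λ s′ → Answers (DisjointFactors w) s′ × Holds w s′)
  query-run {w} {s} (t , σ , s~σ , sp , C@(current txt trees v O ans)) =
    finally (finish (0 := reg rans) {σ = σ} {Q = λ σ′ → R σ′ 0 ≡ (if v <ᵇ suc n then 1 else 0) × Current t σ′} _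
              (ans , current txt trees v O ans) s s~σ)
    where
    answers : ∀ {s′ : State b} → Dec (v ≤ n) → toℕ (registers s′ 0) ≡ (if v <ᵇ suc n then 1 else 0) →
              Answers (DisjointFactors w) s′
    answers (yes v≤n) e = inj₁ (trans e (cong (if_then 1 else 0) (<⇒<ᵇ≡ (s≤s v≤n))) ,
      packing⇒factors w sp v≤n (Packings.Optimal.packs O v≤n))
    answers (no v≰n) e = inj₂ (trans e (cong (if_then 1 else 0) (≥⇒<ᵇ≡ (≰⇒> v≰n))) ,
      λ F → v≰n (Packings.Optimal.least O ≤-refl (factors⇒packing w sp F)))
    finally : (∃₂ λ t′ s′ → (s ⊢ query structure ⇓[ t′ ] s′) × t′ ≤ 2 ×
               ∃ λ σ′ → s′ ~ σ′ × R σ′ 0 ≡ (if v <ᵇ suc n then 1 else 0) × Current t σ′) →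
              RunsWithin c (query structure) s (λ s′ → Answers (DisjointFactors w) s′ × Holds w s′)
    finally (t′ , s′ , d , t≤ , σ′ , sim′ , e , C′) =
      t′ , s′ , d , ≤-trans t≤ (≤-trans (≤ᵇ⇒≤ 2 10000 _) c≥) , answers {s′} (v ≤? n) (trans (regs sim′ 0) e) , t , σ′ , sim′ , sp , C′

  holds : ∀ {w s} → Reachable structure w s → Holds w s
  holds (initialised {w} {s} {s′ = s′} inp d) = after-run {Q = Holds w} (initialise-run w s inp) d
  holds (updated {w} p a r d) = after-run {Q = Holds (w [ p ]≔ a)} (update-run {w} p a (holds r)) d
  holds (queried {w} r d) = proj₂ (after-run {Q = λ s′ → Answers (DisjointFactors w) s′ × Holds w s′} (query-run {w} (holds r)) d)

theorem3 : Σ[ D ∈ DataStructure ] Σ[ c ∈ ℕ ]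
    (∀ (k n b : ℕ) → c * suc (k + ⌊log₂ n ⌋) ≤ b →
    (∀ (w : Text k n) (s : State b) → Input w s →
    RunsWithin (c * (1 ⊔ (k * 2 ^ k + k * n))) (initialise D) s (λ _ → ⊤))
    × (∀ (w : Text k n) (s : State b) → Reachable D w s →
    RunsWithin c (query D) s (Answers (DisjointFactors w)))
    × (∀ (w : Text k n) (s : State b) → Reachable D w s → ∀ (p : Fin n) (a : Fin k) →
    RunsWithin (c * (k * 2 ^ k * loglog n)) (update D) (withArgs p a s) (λ _ → ⊤)))
theorem3 = structure , factor , λ k n b fit →
  let z = sizes n
      open Correctness factor (≤factor 10000) k n b z
        (limit-fits z (≤-trans (*-monoˡ-≤ (suc (k + ⌊log₂ n ⌋)) (≤factor 161)) fit))
        (root-fits k z) (Sizes.1≤ℓ z) (Sizes.ℓ≤ z) (Sizes.blocks z)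
  in
  (λ w s inp → forget (initialise-run w s inp)) ,
  (λ w s r → only-answers (query-run {w} (holds r))) ,
  (λ w s r p a → forget (update-run {w} p a (holds r)))
  where
  forget : ∀ {b t c} {s : State b} {Q} → RunsWithin t c s Q → RunsWithin t c s (λ _ → ⊤)
  forget (t′ , s′ , d , t≤ , _) = t′ , s′ , d , t≤ , tt
  only-answers : ∀ {b t c} {s : State b} {Q Q′ : State b → Set} →
                 RunsWithin t c s (λ s′ → Q s′ × Q′ s′) → RunsWithin t c s Q
  only-answers (t′ , s′ , d , t≤ , q , _) = t′ , s′ , d , t≤ , q
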